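{- Suppose that there exists an algorithm for solving the target-(min,max)-product problem on $n\times n$ matrices in $T_{TMM}(n)\ge n^2$ time. Then there exists an algorithm for solving the $\{ -1,0,1\}$-APSP problem on graphs with $n$ vertices in $\tilde O(T_{TMM}(n)+n^{\omega})$ time.
   Context: The target-(min,max)-product problem: the input is three matrices $A,B,T\in\mathbb{R}^{n\times n}$ with entries $a_{ij},b_{ij},t_{ij}$, and the output is the Boolean matrix $C\in\{0,1\}^{n\times n}$ such that $c_{ij}=1$ if and only if $t_{ij}=\min_{k=1}^{n}\{\max(a_{ik},b_{kj})\}$. The $\{ -1,0,1\}$-APSP problem: the input is a weighted directed graph $G=(V,E,w)$ with $V=\{v_1,\dots,v_n\}$ and $w:E\to\{ -1,0,1\}$, given by its weighted adjacency matrix with entries in $\{ -1,0,1,\infty\}$ ($\infty$ meaning that there is no edge). The goal is to compute the matrix $A^*$ whose entry $a^*_{ij}$ is the weight of the shortest path from $v_i$ to $v_j$, where $a^*_{ij}=\infty$ if there is no path and $a^*_{ij}=-\infty$ if there are paths (with repeated vertices allowed) of arbitrarily small weight. $\omega$ denotes the exponent in the fastest matrix multiplication algorithm, so that multiplying two $n\times n$ matrices takes $O(n^\omega)$ time. $\tilde O$ suppresses poly-logarithmic factors. -}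

module Defs where

open import Algebra.Definitions.RawMonoid using (sum)
open import Data.Bool.Base using (Bool; true; false; if_then_else_; _∧_)
open import Data.Fin.Base using (Fin; zero; suc; toℕ)
open import Data.Integer.Base as ℤ using (ℤ; +_; -[1+_]; ∣_∣; 0ℤ; 1ℤ; -1ℤ)
open import Data.Maybe.Base using (Maybe; just; nothing; _>>=_)
open import Data.Nat.Base as ℕ using (ℕ; zero; suc; NonZero; _≡ᵇ_; _≤ᵇ_)
open import Data.Nat.Logarithm using (⌊log₂_⌋)
open import Data.Product.Base using (Σ-syntax; ∃-syntax; _×_; _,_)
open import Data.Rational.Base as ℚ using (ℚ; _/_)
import Data.Rational.Properties as ℚ
open import Data.Sum.Base using (inj₁; inj₂)
open import Data.Unit.Base using (⊤)
open import Function.Bundles using (_⇔_)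
open import Relation.Binary.PropositionalEquality.Core using (_≡_; sym; subst)
open import Relation.Nullary.Construct.Add.Extrema using (_±; ⊥±; ⊤±; [_])
open import Relation.Nullary.Construct.Add.Supremum as Supremum using (_⁺; ⊤⁺)
open import Relation.Nullary.Negation.Core using (¬_)

------------------------------------------------------------------------
-- Real numbers (Bishop): regular sequences of rationals, the n-th term
-- being within 1/(n+1) of the limit.

ε : ℕ → ℚ
ε n = + 1 / suc n

-- The one-sided bound for all pairs (m , n) gives the bound on the
-- absolute value.
record ℝ : Set where
  field
    seq     : ℕ → ℚ
    regular : ∀ m n → seq m ℚ.≤ seq n ℚ.+ (ε m ℚ.+ ε n)

open ℝ public

infix 4 _<ᴿ_ _≤ᴿ_ _≈ᴿ_

_<ᴿ_ : ℝ → ℝ → Set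
x <ᴿ y = ∃[ n ] seq x n ℚ.+ (ε n ℚ.+ ε n) ℚ.< seq y n

_≤ᴿ_ : ℝ → ℝ → Set
x ≤ᴿ y = ¬ (y <ᴿ x)

_≈ᴿ_ : ℝ → ℝ → Set
x ≈ᴿ y = (x ≤ᴿ y) × (y ≤ᴿ x)

fromℚ : ℚ → ℝ
fromℚ q = record
  { seq     = λ _ → q
  ; regular = λ m n → subst (ℚ._≤ q ℚ.+ (ε m ℚ.+ ε n)) (ℚ.+-identityʳ q)
                (ℚ.+-monoʳ-≤ q (ℚ.+-mono-≤ (0≤ε m) (0≤ε n)))
  }
  where
  0≤ε : ∀ n → ℚ.0ℚ ℚ.≤ ε n
  0≤ε n = ℚ.nonNegative⁻¹ (ε n) {{ℚ.normalize-nonNeg 1 (suc n)}}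

_⊔ᴿ_ : ℝ → ℝ → ℝ
x ⊔ᴿ y = record
  { seq     = λ n → seq x n ℚ.⊔ seq y n
  ; regular = λ m n → ℚ.⊔-lub
      (ℚ.≤-trans (regular x m n)
        (ℚ.+-monoˡ-≤ (ε m ℚ.+ ε n) (ℚ.p≤p⊔q (seq x n) (seq y n))))
      (ℚ.≤-trans (regular y m n)
        (ℚ.+-monoˡ-≤ (ε m ℚ.+ ε n) (ℚ.p≤q⊔p (seq x n) (seq y n))))
  }

_⊓ᴿ_ : ℝ → ℝ → ℝ
x ⊓ᴿ y = record { seq = s ; regular = reg }
  where
  s : ℕ → ℚ
  s n = seq x n ℚ.⊓ seq y n

  reg : ∀ m n → s m ℚ.≤ s n ℚ.+ (ε m ℚ.+ ε n)
  reg m n with ℚ.⊓-sel (seq x n) (seq y n)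
  ... | inj₁ eq = subst (λ q → s m ℚ.≤ q ℚ.+ (ε m ℚ.+ ε n)) (sym eq)
                    (ℚ.≤-trans (ℚ.p⊓q≤p (seq x m) (seq y m)) (regular x m n))
  ... | inj₂ eq = subst (λ q → s m ℚ.≤ q ℚ.+ (ε m ℚ.+ ε n)) (sym eq)
                    (ℚ.≤-trans (ℚ.p⊓q≤q (seq x m) (seq y m)) (regular y m n))

------------------------------------------------------------------------
-- Computation model: a unit-cost RAM whose words are integers of absolute
-- value at most B, with B polynomial in n (words of O(log n) bits).  Real
-- numbers live in separate cells; they can be copied, compared, and
-- created from words.  There is no arithmetic on reals: unit-cost
-- arithmetic of unbounded precision would be unrealistically powerful.
-- Memory is divided into arrays; a program names finitely many of them,
-- and cells of a fixed index serve as registers.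

record Memory : Set where
  constructor ⟨_,_⟩
  field
    word : ℕ → ℕ → ℤ
    real : ℕ → ℕ → ℝ

open Memory public

_[_,_↦_] : {A : Set} → (ℕ → ℕ → A) → ℕ → ℕ → A → (ℕ → ℕ → A)
(f [ a , i ↦ v ]) b j = if (a ≡ᵇ b) ∧ (i ≡ᵇ j) then v else f b j

data Op : Set where
  add sub mul div : Op

data Exp : Set where
  lit  : ℤ → Exp
  load : ℕ → Exp → Exp
  op   : Op → Exp → Exp → Exp

data Cmd : Set where
  skip          : Cmd
  store         : ℕ → Exp → Exp → Cmd              -- wordᵃ[e] ≔ f
  copyᴿ         : ℕ → Exp → ℕ → Exp → Cmd          -- realᵃ[e] ≔ realᵇ[f]
  castᴿ         : ℕ → Exp → Exp → Cmd              -- realᵃ[e] ≔ f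
  _⨾_           : Cmd → Cmd → Cmd
  if_≤_then_else_       : Exp → Exp → Cmd → Cmd → Cmd
  ifᴿ_[_]≤_[_]then_else_ : ℕ → Exp → ℕ → Exp → Cmd → Cmd → Cmd
  while_≤_loop_ : Exp → Exp → Cmd → Cmd

size : Exp → ℕ
size (lit _)    = 1
size (load _ e) = 1 ℕ.+ size e
size (op _ e f) = 1 ℕ.+ (size e ℕ.+ size f)

module Semantics (B : ℕ) where

  -- Overflow, division by zero and negative addresses make the machine
  -- stuck, so a run within a word bound is also a run within any larger one.

  fit : ℤ → Maybe ℤ
  fit z = if ∣ z ∣ ≤ᵇ B then just z else nothing

  apply : Op → ℤ → ℤ → Maybe ℤ
  apply add x y            = fit (x ℤ.+ y)
  apply sub x y            = fit (x ℤ.- y)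
  apply mul x y            = fit (x ℤ.* y)
  apply div x (+ 0)        = nothing
  apply div x y@(+ suc _)  = fit (x ℤ./ y)
  apply div x y@(-[1+ _ ]) = fit (x ℤ./ y)

  address : ℤ → Maybe ℕ
  address (+ i)    = just i
  address -[1+ _ ] = nothing

  eval : Memory → Exp → Maybe ℤ
  eval μ (lit z)    = fit z
  eval μ (load a e) = eval μ e >>= λ z → address z >>= λ i → just (word μ a i)
  eval μ (op o e f) = eval μ e >>= λ x → eval μ f >>= λ y → apply o x y

  evalAddress : Memory → Exp → Maybe ℕ
  evalAddress μ e = eval μ e >>= address

  -- Run c μ k μ′: started in μ, the program c halts in μ′ after k steps.
  data Run : Cmd → Memory → ℕ → Memory → Set where

    skip : ∀ {μ} → Run skip μ 1 μ

    store : ∀ {μ a e f i v} →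
      evalAddress μ e ≡ just i → eval μ f ≡ just v →
      Run (store a e f) μ (1 ℕ.+ (size e ℕ.+ size f))
        ⟨ word μ [ a , i ↦ v ] , real μ ⟩

    copyᴿ : ∀ {μ a e b f i j} →
      evalAddress μ e ≡ just i → evalAddress μ f ≡ just j →
      Run (copyᴿ a e b f) μ (1 ℕ.+ (size e ℕ.+ size f))
        ⟨ word μ , real μ [ a , i ↦ real μ b j ] ⟩

    castᴿ : ∀ {μ a e f i v} →
      evalAddress μ e ≡ just i → eval μ f ≡ just v →
      Run (castᴿ a e f) μ (1 ℕ.+ (size e ℕ.+ size f))
        ⟨ word μ , real μ [ a , i ↦ fromℚ (v / 1) ] ⟩

    _⨾_ : ∀ {μ μ′ μ″ c d k l} →
      Run c μ k μ′ → Run d μ′ l μ″ →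
      Run (c ⨾ d) μ (k ℕ.+ l) μ″

    if-then : ∀ {μ μ′ e f x y c d k} →
      eval μ e ≡ just x → eval μ f ≡ just y → x ℤ.≤ y → Run c μ k μ′ →
      Run (if e ≤ f then c else d) μ (1 ℕ.+ (size e ℕ.+ size f) ℕ.+ k) μ′

    if-else : ∀ {μ μ′ e f x y c d k} →
      eval μ e ≡ just x → eval μ f ≡ just y → y ℤ.< x → Run d μ k μ′ →
      Run (if e ≤ f then c else d) μ (1 ℕ.+ (size e ℕ.+ size f) ℕ.+ k) μ′

    ifᴿ-then : ∀ {μ μ′ a e b f i j c d k} →
      evalAddress μ e ≡ just i → evalAddress μ f ≡ just j →
      real μ a i ≤ᴿ real μ b j → Run c μ k μ′ →
      Run (ifᴿ a [ e ]≤ b [ f ]then c else d) μ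
        (1 ℕ.+ (size e ℕ.+ size f) ℕ.+ k) μ′

    ifᴿ-else : ∀ {μ μ′ a e b f i j c d k} →
      evalAddress μ e ≡ just i → evalAddress μ f ≡ just j →
      real μ b j <ᴿ real μ a i → Run d μ k μ′ →
      Run (ifᴿ a [ e ]≤ b [ f ]then c else d) μ
        (1 ℕ.+ (size e ℕ.+ size f) ℕ.+ k) μ′

    while-stop : ∀ {μ e f x y c} →
      eval μ e ≡ just x → eval μ f ≡ just y → y ℤ.< x →
      Run (while e ≤ f loop c) μ (1 ℕ.+ (size e ℕ.+ size f)) μ

    while-step : ∀ {μ μ′ μ″ e f x y c k l} →
      eval μ e ≡ just x → eval μ f ≡ just y → x ℤ.≤ y →
      Run c μ k μ′ → Run (while e ≤ f loop c) μ′ l μ″ →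
      Run (while e ≤ f loop c) μ (1 ℕ.+ (size e ℕ.+ size f) ℕ.+ (k ℕ.+ l)) μ″

open Semantics public using (Run)

------------------------------------------------------------------------
-- A problem whose inputs and outputs are graded by a size parameter n,
-- together with their layout in memory.
record Problem : Set₁ where
  field
    Input    : ℕ → Set
    Output   : ℕ → Set
    Solution : ∀ {n} → Input n → Output n → Set
    StoresIn  : ∀ {n} → Memory → Input n → Set
    StoresOut : ∀ {n} → Memory → Output n → Set

Bounded : ℕ → Memory → Set
Bounded B μ = ∀ a i → ∣ word μ a i ∣ ℕ.≤ B

-- The program is uniform in n, and must be correct for every word bound B
-- that is at least (n + 2)^c.  Cells that do not hold the input initially
-- have arbitrary contents.
_Solves_InTime_ : Cmd → Problem → (ℕ → ℕ) → Set
p Solves P InTime t =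
  ∃[ c ] ∀ n (x : Input n) B → (2 ℕ.+ n) ℕ.^ c ℕ.≤ B →
    ∀ μ → Bounded B μ → word μ 0 0 ≡ + n → StoresIn μ x →
    ∃[ k ] ∃[ μ′ ] Run B p μ k μ′ × k ℕ.≤ t n ×
      Σ[ y ∈ Output n ] StoresOut μ′ y × Solution x y
  where open Problem P

-- m ≤ C · (t + n^ω), where n^ω = inf { n^(p/q) | p/q > ω }  (for n ≥ 1, ω ≥ 0).
_≤_·⟨_+_^_⟩ : ℕ → ℕ → ℕ → ℕ → ℝ → Set
m ≤ C ·⟨ t + n ^ ω ⟩ =
  ∀ p q .{{_ : NonZero q}} → ω <ᴿ fromℚ (+ p / q) →
  (m ℕ.∸ C ℕ.* t) ℕ.^ q ℕ.≤ C ℕ.^ q ℕ.* n ℕ.^ p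

infix 4 _∈O[n^_] _∈Õ[_+n^_]

_∈O[n^_] : (ℕ → ℕ) → ℝ → Set
f ∈O[n^ ω ] =
  ∃[ C ] ∃[ N ] ∀ n → N ℕ.≤ n → f n ≤ C ·⟨ 0 + n ^ ω ⟩

_∈Õ[_+n^_] : (ℕ → ℕ) → (ℕ → ℕ) → ℝ → Set
f ∈Õ[ T +n^ ω ] =
  ∃[ C ] ∃[ d ] ∃[ N ] ∀ n → N ℕ.≤ n →
    f n ≤ C ℕ.* (1 ℕ.+ ⌊log₂ n ⌋) ℕ.^ d ·⟨ T n + n ^ ω ⟩

------------------------------------------------------------------------
Matrix : Set → ℕ → Set
Matrix A n = Fin n → Fin n → A

index : ∀ {n} → Fin n → Fin n → ℕ
index {n} i j = toℕ i ℕ.* n ℕ.+ toℕ j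

StoresWords : ∀ {n} → Memory → ℕ → Matrix ℤ n → Set
StoresWords μ a M = ∀ i j → word μ a (index i j) ≡ M i j

StoresReals : ∀ {n} → Memory → ℕ → Matrix ℝ n → Set
StoresReals μ a M = ∀ i j → real μ a (index i j) ≡ M i j

-- Extended integers take two words: one tells -∞, finite and ∞ apart
-- (-1, 0, 1), the other holds the value if it is finite.
Encodes : ℤ → ℤ → ℤ ± → Set
Encodes t v ⊥±    = t ≡ -1ℤ
Encodes t v [ z ] = t ≡ 0ℤ × v ≡ z
Encodes t v ⊤±    = t ≡ 1ℤ

StoresExtended : ∀ {n} → Memory → ℕ → ℕ → Matrix (ℤ ±) n → Set
StoresExtended μ a b M =
  ∀ i j → Encodes (word μ a (index i j)) (word μ b (index i j)) (M i j)

------------------------------------------------------------------------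
-- The entries of the factors are integers of absolute value at most n^e, so
-- that they fit in O(log n) bits.

MatMul : ℕ → Problem
MatMul e = record
  { Input     = λ n → Small n × Small n
  ; Output    = Matrix ℤ
  ; Solution  = λ { {n} ((A , _) , (B , _)) C →
      ∀ i j → C i j ≡ sum ℤ.+-0-rawMonoid {n} (λ k → A i k ℤ.* B k j) }
  ; StoresIn  = λ { μ ((A , _) , (B , _)) →
      StoresWords μ 1 A × StoresWords μ 2 B }
  ; StoresOut = λ μ C → StoresWords μ 3 C
  }
  where
  Small : ℕ → Set
  Small n = Σ[ A ∈ Matrix ℤ n ] (∀ i j → ∣ A i j ∣ ℕ.≤ n ℕ.^ e)

-- Two n × n matrices can be multiplied in O(n^ω) time.  Minimality of ω is
-- not part of the definition, so the exponent of any algorithm qualifies, in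
-- particular that of the fastest one.
MatMulExponent : ℝ → Set
MatMulExponent ω =
  ∀ e → ∃[ p ] ∃[ f ] p Solves MatMul e InTime f × f ∈O[n^ ω ]

------------------------------------------------------------------------
minimum : ∀ {n} → (Fin (suc n) → ℝ) → ℝ
minimum {zero}  f = f zero
minimum {suc n} f = f zero ⊓ᴿ minimum (λ k → f (suc k))

minMaxProduct : ∀ {n} → Matrix ℝ n → Matrix ℝ n → Matrix ℝ n
minMaxProduct {suc n} A B i j = minimum (λ k → A i k ⊔ᴿ B k j)

bit : Bool → ℤ
bit true  = 1ℤ
bit false = 0ℤ

TargetMinMax : Problem
TargetMinMax = record
  { Input     = λ n → Matrix ℝ n × Matrix ℝ n × Matrix ℝ n
  ; Output    = Matrix Bool
  ; Solution  = λ { (A , B , T) C →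
      ∀ i j → C i j ≡ true ⇔ T i j ≈ᴿ minMaxProduct A B i j }
  ; StoresIn  = λ { μ (A , B , T) →
      StoresReals μ 0 A × StoresReals μ 1 B × StoresReals μ 2 T }
  ; StoresOut = λ μ C → StoresWords μ 1 (λ i j → bit (C i j))
  }

------------------------------------------------------------------------
data Weight : Set where
  -1ʷ 0ʷ 1ʷ : Weight

⟦_⟧ : Weight → ℤ
⟦ -1ʷ ⟧ = -1ℤ
⟦ 0ʷ  ⟧ = 0ℤ
⟦ 1ʷ  ⟧ = 1ℤ

-- Weighted adjacency matrices; ⊤⁺ is ∞, the absence of an edge.
Graph : ℕ → Set
Graph = Matrix (Weight ⁺)

extended : Weight ⁺ → ℤ ±
extended Supremum.[ w ] = [ ⟦ w ⟧ ]
extended ⊤⁺             = ⊤±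

-- Path G i j z: a path from i to j, possibly empty and possibly with
-- repeated vertices, of weight z.
data Path {n} (G : Graph n) : Fin n → Fin n → ℤ → Set where
  []   : ∀ {i} → Path G i i 0ℤ
  cons : ∀ {i j k w z} → G i j ≡ Supremum.[ w ] → Path G j k z →
         Path G i k (⟦ w ⟧ ℤ.+ z)

IsDistance : ∀ {n} → Graph n → Fin n → Fin n → ℤ ± → Set
IsDistance G i j ⊥±    = ∀ m → ∃[ z ] z ℤ.≤ m × Path G i j z
IsDistance G i j [ d ] = Path G i j d × (∀ z → Path G i j z → d ℤ.≤ z)
IsDistance G i j ⊤±    = ∀ z → ¬ Path G i j z

APSP : Problem
APSP = record
  { Input     = Graph
  ; Output    = Matrix (ℤ ±)
  ; Solution  = λ G D → ∀ i j → IsDistance G i j (D i j)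
  ; StoresIn  = λ μ G → StoresExtended μ 1 2 (λ i j → extended (G i j))
  ; StoresOut = λ μ D → StoresExtended μ 3 4 D
  }

module Submission where

-- The reduction halves the distances.  A layer is a graph with edge relations P, N
-- and Z for the weights 1, -1 and 0, where Z is reflexive and transitive.  Cutting a
-- walk at the vertices where its weight so far is even makes it a walk of half the
-- weight in the layer with edges P P of weight 1, N N of weight -1, and Z, P N and N P
-- of weight 0.  Adding P with weight 1 and N with weight 0 for a last odd step turns
-- every distance d into ⌈ d / 2 ⌉, and it halves the number of steps of weight ±1 as
-- well.  After ℓ ≈ log n halvings at most one of them is left, and the distances
-- can be read off.
--
-- Going back, let x = ⌈ d / 2 ⌉.  Then d is 2x or 2x - 1, and it is 2x - 1 if and
-- only if the last step of weight ±1 leads to j from some k with x(i,k) = x(i,j) - 1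
-- and P(k,j), or x(i,k) = x(i,j) and N(k,j).  Since x(i,j) - 1 ≤ x(i,k) for all k with
-- P(k,j), the former means that x(i,j) - 1 is the minimum of x(i,k) over these k,
-- which is an entry of a target-(min,max)-product; likewise for N.  Closed walks of
-- negative weight are found on the way back by Boolean products.  Everything is done
-- with O(log² n) products, and the layers are kept as bits of O(log n)-bit words.

open import Defs
open import Algebra.Definitions.RawMonoid using (sum)
open import Data.Bool.Base using (Bool; true; false; T; _∧_; _∨_; if_then_else_)
open import Data.Bool.Properties using (¬-not)
open import Data.Empty using (⊥; ⊥-elim)
open import Data.Fin.Base using (Fin; zero; suc; toℕ; combine; fromℕ<)
import Data.Fin.Properties as Fin
open import Data.Integer.Base as ℤ using (ℤ; +_; -[1+_]; ∣_∣; 0ℤ; 1ℤ; -1ℤ; +≤+; -≤+; -≤-)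
import Data.Integer.Properties as ℤ
open import Data.Integer.Tactic.RingSolver using (solve-∀)
open import Data.List.Base using (List; []; _∷_; length; lookup)
open import Data.List.Membership.Propositional using (_∈_)
open import Data.List.Membership.Propositional.Properties using (∈-lookup)
open import Data.List.Relation.Unary.All as All using ([]; _∷_)
open import Data.List.Relation.Unary.All.Properties using (¬Any⇒All¬)
open import Data.List.Relation.Unary.AllPairs using ([]; _∷_)
open import Data.List.Relation.Unary.Any using (here; there)
open import Data.List.Relation.Unary.Unique.Propositional using (Unique)
open import Data.Maybe.Base using (just)
open import Data.Nat.Base as ℕ using (ℕ; zero; suc; _+_; _*_; _^_; _∸_; _⊔_; _≤_; _<_; _≡ᵇ_; _≤ᵇ_; z≤n; s≤s)
open import Data.Nat.Divisibility using (divides-refl)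
import Data.Nat.DivMod as ℕ
open import Data.Nat.Logarithm using (⌊log₂_⌋; ⌊log₂⌋-mono-≤; ⌊log₂[2^n]⌋≡n)
import Data.Nat.Properties as ℕ
open import Data.Nat.Tactic.RingSolver renaming (solve-∀ to ℕ-solve-∀)
open import Data.Product.Base using (Σ-syntax; ∃-syntax; _×_; _,_; proj₁; proj₂)
open import Data.Rational.Base as ℚ using (_/_)
import Data.Rational.Properties as ℚ
import Data.Rational.Unnormalised.Base as ℚᵘ
import Data.Rational.Unnormalised.Properties as ℚᵘ
open import Data.Sum.Base using (_⊎_; inj₁; inj₂)
open import Data.Unit.Base using (tt)
open import Function.Base using (_∘_; case_of_)
open import Function.Bundles using (_⇔_; Equivalence)
open import Relation.Binary.Construct.Closure.ReflexiveTransitive using (Star; _◅_; _◅◅_) renaming (ε to nil)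
open import Relation.Binary.Definitions using (Tri; tri<; tri≈; tri>)
open import Relation.Binary.PropositionalEquality.Core using (_≡_; _≢_; refl; sym; trans; cong; cong₂; subst; subst₂)
open import Relation.Nullary using (¬_; Dec; yes; no; contradiction)
open import Relation.Nullary.Construct.Add.Extrema using (_±; ⊥±; ⊤±; [_])
open import Relation.Nullary.Construct.Add.Supremum as Supremum using (_⁺; ⊤⁺)
open import Relation.Nullary.Decidable using (decidable-stable; ⌊_⌋)

-- Integer inequalities

-- Distances may be -∞, and which pairs are of this kind is known only at the end. So the
-- intermediate matrices are claimed to be exact only where a minimum is attained by a walk with few
-- counted steps, and merely sound elsewhere. They cannot be trusted to reveal closed walks of
-- negative weight, which is why signs are tracked by separate Boolean matrices. Rounding up turns a
-- single step of weight 1 into a step of weight 1 again, so halving bottoms out at one counted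
-- step, not at none. Every claim carries a bound `s` on counted steps, which doubles on the way
-- back from 1 to `2 ^ ℓ`; loop removal shows that this covers all walks that matter, since
-- `n < 2 ^ ℓ`. On the machine, a program names finitely many arrays, so the layers cannot have an
-- array each; this forces the stacks of bits. The given programs are black boxes that may overwrite
-- every array they name, so all lasting data lives in word arrays beyond these, and the arguments
-- of a call are written afresh each time.

≤-by : ∀ {a b x y} k → x ℤ.≤ y → b ℤ.- a ≡ (y ℤ.- x) ℤ.+ + k → a ℤ.≤ b
≤-by {a} {b} {x} {y} k x≤y eq = ℤ.0≤i-j⇒j≤i (subst (0ℤ ℤ.≤_) (sym eq)
  (ℤ.+-mono-≤ (ℤ.i≤j⇒0≤j-i x≤y) (+≤+ z≤n)))

-- Both versions turn a linear inequality into a ring identity for the solver, with `k` as the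
-- slack.
≤-by₂ : ∀ {a b x y u v} k → x ℤ.≤ y → u ℤ.≤ v →
        b ℤ.- a ≡ ((y ℤ.- x) ℤ.+ (v ℤ.- u)) ℤ.+ + k → a ℤ.≤ b
≤-by₂ {a} {b} {x} {y} {u} {v} k x≤y u≤v eq = ≤-by {a} {b} {x ℤ.+ u} {y ℤ.+ v} k
  (ℤ.+-mono-≤ x≤y u≤v) (trans eq (cong (ℤ._+ + k) (lemma x y u v)))
  where
  lemma : ∀ x y u v → (y ℤ.- x) ℤ.+ (v ℤ.- u) ≡ (y ℤ.+ v) ℤ.- (x ℤ.+ u)
  lemma = solve-∀

half-mono : ∀ h k → h ℤ.+ h ℤ.≤ k ℤ.+ k ℤ.+ 1ℤ → h ℤ.≤ k
half-mono h k p with h ℤ.≤? k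
... | yes q = q
... | no ¬q = contradiction (ℤ.<-≤-trans below (ℤ.≤-trans above p)) (ℤ.<-irrefl refl)
  where
  1+k≤h : 1ℤ ℤ.+ k ℤ.≤ h
  1+k≤h = ℤ.i<j⇒suc[i]≤j (ℤ.≰⇒> ¬q)

  above : (1ℤ ℤ.+ k) ℤ.+ (1ℤ ℤ.+ k) ℤ.≤ h ℤ.+ h
  above = ℤ.+-mono-≤ 1+k≤h 1+k≤h

  below : k ℤ.+ k ℤ.+ 1ℤ ℤ.< (1ℤ ℤ.+ k) ℤ.+ (1ℤ ℤ.+ k)
  below = ℤ.suc[i]≤j⇒i<j (ℤ.≤-reflexive (lemma k))
    where
    lemma : ∀ k → 1ℤ ℤ.+ (k ℤ.+ k ℤ.+ 1ℤ) ≡ (1ℤ ℤ.+ k) ℤ.+ (1ℤ ℤ.+ k)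
    lemma = solve-∀

i≤∣i∣ : ∀ i → i ℤ.≤ + ∣ i ∣
i≤∣i∣ (+ _)    = ℤ.≤-refl
i≤∣i∣ -[1+ _ ] = -≤+

∣bit∣≤1 : ∀ b → ∣ bit b ∣ ≤ 1
∣bit∣≤1 true  = ℕ.≤-refl
∣bit∣≤1 false = z≤n

half-≤ : ∀ {v s} → v + v ≤ suc (s + s) → v ≤ s
half-≤ {zero}          _        = z≤n
half-≤ {suc v} {zero}  (s≤s le) rewrite ℕ.+-suc v v = case le of λ ()
half-≤ {suc v} {suc s} (s≤s le) rewrite ℕ.+-suc v v | ℕ.+-suc s s = s≤s (half-≤ (ℕ.≤-pred le))

n<2^n : ∀ m → m < 2 ^ m
n<2^n zero    = s≤s z≤n
n<2^n (suc m) = ℕ.+-mono-≤ (ℕ.m^n>0 2 m) (ℕ.≤-trans (n<2^n m) (ℕ.m≤m+n (2 ^ m) 0))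

-- Boolean matrices

some : ∀ {n} → (Fin n → Bool) → Bool
some {zero}  f = false
some {suc n} f = f zero ∨ some (f ∘ suc)

some-intro : ∀ {n} (f : Fin n → Bool) k → f k ≡ true → some f ≡ true
some-intro f zero    p rewrite p = refl
some-intro f (suc k) p with f zero
... | true  = refl
... | false = some-intro (f ∘ suc) k p

some-elim : ∀ {n} (f : Fin n → Bool) → some f ≡ true → ∃[ k ] f k ≡ true
some-elim {suc n} f p with f zero in eq
... | true  = zero , eq
... | false with k , q ← some-elim (f ∘ suc) p = suc k , q

infix 4 _∋_⟶_

-- A record and not the bare equation, so that unification recovers the matrix and both vertices.
record _∋_⟶_ {n} (A : Matrix Bool n) (i j : Fin n) : Set where
  constructor ⟪_⟫
  field holds : A i j ≡ true

open _∋_⟶_ public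

infixl 6 _∪_
infixl 7 _∙_

_∪_ : ∀ {n} → Matrix Bool n → Matrix Bool n → Matrix Bool n
(A ∪ B) i j = A i j ∨ B i j

_∙_ : ∀ {n} → Matrix Bool n → Matrix Bool n → Matrix Bool n
(A ∙ B) i j = some (λ k → A i k ∧ B k j)

module _ {n} {A B : Matrix Bool n} {i j : Fin n} where

  ∪-introˡ : A ∋ i ⟶ j → A ∪ B ∋ i ⟶ j
  ∪-introˡ ⟪ p ⟫ = ⟪ cong (_∨ B i j) p ⟫

  ∪-introʳ : B ∋ i ⟶ j → A ∪ B ∋ i ⟶ j
  ∪-introʳ ⟪ p ⟫ with A i j in eq
  ... | true  = ⟪ cong (_∨ B i j) eq ⟫
  ... | false = ⟪ trans (cong (_∨ B i j) eq) p ⟫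

  ∪-elim : A ∪ B ∋ i ⟶ j → A ∋ i ⟶ j ⊎ B ∋ i ⟶ j
  ∪-elim ⟪ p ⟫ with A i j in eq
  ... | true  = inj₁ ⟪ eq ⟫
  ... | false = inj₂ ⟪ p ⟫

  ∙-intro : ∀ {k} → A ∋ i ⟶ k → B ∋ k ⟶ j → A ∙ B ∋ i ⟶ j
  ∙-intro {k} ⟪ p ⟫ ⟪ q ⟫ = ⟪ some-intro _ k (cong₂ _∧_ p q) ⟫

  ∙-elim : A ∙ B ∋ i ⟶ j → ∃[ k ] A ∋ i ⟶ k × B ∋ k ⟶ j
  ∙-elim ⟪ p ⟫ with k , q ← some-elim (λ k → A i k ∧ B k j) p
    with A i k in eqA | B k j in eqB
  ... | true  | true  = k , ⟪ eqA ⟫ , ⟪ eqB ⟫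
  ... | true  | false = case q of λ ()
  ... | false | _     = case q of λ ()

identity : ∀ {n} → Matrix Bool n
identity zero    zero    = true
identity zero    (suc j) = false
identity (suc i) zero    = false
identity (suc i) (suc j) = identity i j

identity-refl : ∀ {n} (i : Fin n) → identity i i ≡ true
identity-refl zero    = refl
identity-refl (suc i) = identity-refl i

identity⇒≡ : ∀ {n} (i j : Fin n) → identity i j ≡ true → i ≡ j
identity⇒≡ zero    zero    _ = refl
identity⇒≡ (suc i) (suc j) p = cong suc (identity⇒≡ i j p)

squares : ∀ {n} → ℕ → Matrix Bool n → Matrix Bool n
squares zero    A = A
squares (suc t) A = squares t A ∙ squares t A

lookup-injective : ∀ {A : Set} {xs : List A} → Unique xs →
  ∀ {i j} → lookup xs i ≡ lookup xs j → i ≡ j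
lookup-injective (x∉ ∷ u) {zero}  {zero}  _  = refl
lookup-injective (x∉ ∷ u) {zero}  {suc j} eq = contradiction eq (All.lookup x∉ (∈-lookup j))
lookup-injective (x∉ ∷ u) {suc i} {zero}  eq = contradiction (sym eq) (All.lookup x∉ (∈-lookup i))
lookup-injective (x∉ ∷ u) {suc i} {suc j} eq = cong suc (lookup-injective u eq)

unique-length : ∀ {n} {xs : List (Fin n)} → Unique xs → length xs ≤ n
unique-length u = Fin.injective⇒≤ (lookup-injective u)

-- Weighted walks and loop removal

module Walks {n : ℕ} (E : Fin n → Fin n → ℤ → Set) where

  open import Data.List.Membership.DecPropositional (Fin._≟_ {n}) using (_∈?_)

  infixr 5 _▹_

  data Walk : Fin n → Fin n → ℤ → ℕ → Set where
    []  : ∀ {i} → Walk i i 0ℤ 0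
    _▹_ : ∀ {i j k w z m} → E i j w → Walk j k z m → Walk i k (w ℤ.+ z) (suc m)

  later : ∀ {i j z m} → Walk i j z m → List (Fin n)
  later []                = []
  later (_▹_ {j = j} e w) = j ∷ later w

  length-later : ∀ {i j z m} (w : Walk i j z m) → length (later w) ≡ m
  length-later []      = refl
  length-later (e ▹ w) = cong suc (length-later w)

  -- The suffix from `i` on inherits simplicity and is what remains when the loop is dropped; of the
  -- prefix only its length matters.
  split : ∀ {i j k z m} (w : Walk j k z m) → Unique (j ∷ later w) → i ∈ (j ∷ later w) →
    ∃[ z₁ ] ∃[ m₁ ] ∃[ z₂ ] ∃[ m₂ ] Walk j i z₁ m₁ ×
    (Σ[ v ∈ Walk i k z₂ m₂ ] Unique (i ∷ later v)) × z ≡ z₁ ℤ.+ z₂ × m₁ ≤ m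
  split {z = z} {m} w u (here refl) = _ , _ , z , m , [] , (w , u) , sym (ℤ.+-identityˡ z) , z≤n
  split (_▹_ {w = x} e w) (_ ∷ u) (there p)
    with z₁ , m₁ , z₂ , m₂ , v , w′ , eq , le ← split w u p =
    _ , _ , z₂ , m₂ , e ▹ v , w′ , trans (cong (λ y → x ℤ.+ y) eq) (sym (ℤ.+-assoc x z₁ z₂)) , s≤s le

  -- The bound on the number of steps makes the loop visible to matrices that only see walks with at
  -- most `2 ^ ℓ` counted steps.
  NegativeLoop : Fin n → Fin n → Set
  NegativeLoop i j = ∃[ v ] (∃[ z ] ∃[ m ] Walk i v z m) ×
    (∃[ z ] ∃[ m ] Walk v v z m × z ℤ.< 0ℤ × m ≤ n) × (∃[ z ] ∃[ m ] Walk v j z m)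

  -- Prepending an edge to a simple walk closes at most one loop, at its first vertex. A loop of
  -- nonnegative weight is dropped, which does not increase the weight; any other loop is returned.
  simplify : ∀ {i j z m} → Walk i j z m →
    (∃[ z′ ] ∃[ m′ ] (Σ[ v ∈ Walk i j z′ m′ ] Unique (i ∷ later v)) × z′ ℤ.≤ z) ⊎ NegativeLoop i j
  simplify [] = inj₁ (_ , _ , ([] , [] ∷ []) , ℤ.≤-refl)
  simplify (_▹_ {i = i} {w = x} {z = z} e w) with simplify w
  ... | inj₂ (v , (_ , _ , a) , b) = inj₂ (v , (_ , _ , e ▹ a) , b)
  ... | inj₁ (z′ , m′ , (v , u) , le) with i ∈? (_ ∷ later v)
  ...   | no i∉ = inj₁ (_ , _ , (e ▹ v , ¬Any⇒All¬ _ i∉ ∷ u) , ℤ.+-monoʳ-≤ x le)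
  ...   | yes i∈ with z₁ , m₁ , z₂ , m₂ , a , (b , ub) , refl , m₁≤m ← split v u i∈
          with x ℤ.+ z₁ ℤ.<? 0ℤ
  ...     | yes neg = inj₂ (i , (_ , _ , []) ,
              (_ , _ , e ▹ a , neg ,
                -- The loop is no longer than the vertex list of the simple walk `v`, which has no
                -- repetition.
                ℕ.≤-trans (s≤s m₁≤m) (subst (λ l → suc l ≤ n) (length-later v) (unique-length u))) ,
              (_ , _ , b))
  ...     | no ¬neg = inj₁ (z₂ , m₂ , (b , ub) ,
              ≤-by₂ 0 le (ℤ.≮⇒≥ ¬neg) (rearrange x z₁ z₂ z))
    where
    rearrange : ∀ x z₁ z₂ z → (x ℤ.+ z) ℤ.- z₂ ≡ ((z ℤ.- (z₁ ℤ.+ z₂)) ℤ.+ ((x ℤ.+ z₁) ℤ.- 0ℤ)) ℤ.+ 0ℤ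
    rearrange = solve-∀

  shorten : ∀ {i j z m} → Walk i j z m →
    (∃[ z′ ] ∃[ m′ ] Walk i j z′ m′ × z′ ℤ.≤ z × m′ < n) ⊎ NegativeLoop i j
  shorten w with simplify w
  ... | inj₂ neg = inj₂ neg
  ... | inj₁ (z′ , m′ , (v , u) , le) =
    inj₁ (z′ , m′ , v , le , subst (λ l → suc l ≤ n) (length-later v) (unique-length u))

  infixr 5 _++_

  _++_ : ∀ {i j k z z′ m m′} → Walk i j z m → Walk j k z′ m′ →
         Walk i k (z ℤ.+ z′) (m + m′)
  _++_ {z′ = z′} []                            v = subst (λ x → Walk _ _ x _) (sym (ℤ.+-identityˡ z′)) v
  _++_ {z′ = z′} (_▹_ {w = w} {z = z} e u) v =
    subst (λ x → Walk _ _ x _) (sym (ℤ.+-assoc w z z′)) (e ▹ (u ++ v))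

  halves : ∀ {i j z m} a {b} → m ≤ a + b → Walk i j z m →
    ∃[ k ] (∃[ z₁ ] ∃[ m₁ ] Walk i k z₁ m₁ × m₁ ≤ a) × (∃[ z₂ ] ∃[ m₂ ] Walk k j z₂ m₂ × m₂ ≤ b)
  halves zero    le       w       = _ , (_ , _ , [] , z≤n) , (_ , _ , w , le)
  halves (suc a) le       []      = _ , (_ , _ , [] , z≤n) , (_ , _ , [] , z≤n)
  halves (suc a) (s≤s le) (e ▹ w) with k , (z₁ , m₁ , u , p) , q ← halves a le w =
    k , (_ , _ , e ▹ u , s≤s p) , q

-- Reflexive transitive closure by repeated squaring

module Closure {n : ℕ} (ℓ : ℕ) (n<2^ℓ : n < 2 ^ ℓ) where

  closure : Matrix Bool n → Matrix Bool n
  closure A = squares ℓ (A ∪ identity)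

  module _ {A : Matrix Bool n} where

    private
      E : Fin n → Fin n → ℤ → Set
      E i j w = A ∋ i ⟶ j × w ≡ 0ℤ

      open Walks E

      fromStar : ∀ {i j} → Star (A ∋_⟶_) i j → ∃[ z ] ∃[ m ] Walk i j z m
      fromStar nil     = _ , _ , []
      fromStar (e ◅ s) with _ , _ , w ← fromStar s = _ , _ , (e , refl) ▹ w

      weightless : ∀ {i j z m} → Walk i j z m → z ≡ 0ℤ
      weightless []               = refl
      weightless ((_ , refl) ▹ w) = trans (ℤ.+-identityˡ _) (weightless w)

      short⇒squares : ∀ t {i j z m} → Walk i j z m → m ≤ 2 ^ t → squares t (A ∪ identity) ∋ i ⟶ j
      short⇒squares zero {i} []              _ = ∪-introʳ {A = A} {B = identity} ⟪ identity-refl i ⟫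
      short⇒squares zero     ((e , _) ▹ [])      _ = ∪-introˡ e
      short⇒squares zero     (_ ▹ _ ▹ _) (s≤s ())
      short⇒squares (suc t) w le
        with k , (_ , _ , u , p) , (_ , _ , v , q)
          ← halves (2 ^ t) (ℕ.≤-trans le (ℕ.≤-reflexive (cong (λ y → 2 ^ t + y) (ℕ.+-identityʳ (2 ^ t))))) w =
        ∙-intro (short⇒squares t u p) (short⇒squares t v q)

      squares⇒star : ∀ t {i j} → squares t (A ∪ identity) ∋ i ⟶ j → Star (A ∋_⟶_) i j
      squares⇒star zero {i} {j} e with ∪-elim {A = A} e
      ... | inj₁ e′    = e′ ◅ nil
      ... | inj₂ ⟪ p ⟫ with refl ← identity⇒≡ i j p = nil
      squares⇒star (suc t) e with k , p , q ← ∙-elim {A = squares t (A ∪ identity)} e =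
        squares⇒star t p ◅◅ squares⇒star t q

    -- All edges get weight 0, so `shorten` cannot answer with a negative loop and yields fewer than
    -- `n` steps. The identity in `closure` lets the squares accumulate all lengths up to `2 ^ ℓ`.
    star⇒closure : ∀ {i j} → Star (A ∋_⟶_) i j → closure A ∋ i ⟶ j
    star⇒closure s with _ , _ , w ← fromStar s with shorten w
    ... | inj₁ (_ , m , v , _ , m<n) = short⇒squares ℓ v (ℕ.<⇒≤ (ℕ.<-trans m<n n<2^ℓ))
    ... | inj₂ (_ , _ , (_ , _ , c , c<0 , _) , _) =
      contradiction c<0 (ℤ.<-irrefl (weightless c))

    closure⇒star : ∀ {i j} → closure A ∋ i ⟶ j → Star (A ∋_⟶_) i j
    closure⇒star = squares⇒star ℓ

    closure-refl : ∀ i → closure A ∋ i ⟶ i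
    closure-refl i = star⇒closure nil

    closure-trans : ∀ {i j k} → closure A ∋ i ⟶ j → closure A ∋ j ⟶ k → closure A ∋ i ⟶ k
    closure-trans p q = star⇒closure (closure⇒star p ◅◅ closure⇒star q)

    closure-edge : ∀ {i j} → A ∋ i ⟶ j → closure A ∋ i ⟶ j
    closure-edge e = star⇒closure (e ◅ nil)

-- Layers and halving

data Dir : Set where
  ↑ ↓ : Dir

δ : Dir → ℤ
δ ↑ = 1ℤ
δ ↓ = -1ℤ

record Layer (n : ℕ) : Set where
  constructor layer
  field
    P N Z : Matrix Bool n

  edge : Dir → Matrix Bool n
  edge ↑ = P
  edge ↓ = N

open Layer public

-- Absorbing zero steps on the right is enough: a walk in `W` opens with one zero step, and every
-- later one follows a counted step.
record Saturated {n} (X : Layer n) : Set where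
  field
    Z-refl   : ∀ i → Z X ∋ i ⟶ i
    Z-trans  : ∀ {i j k} → Z X ∋ i ⟶ j → Z X ∋ j ⟶ k → Z X ∋ i ⟶ k
    absorb   : ∀ d {i j k} → edge X d ∋ i ⟶ j → Z X ∋ j ⟶ k → edge X d ∋ i ⟶ k

open Saturated public

-- A walk is read as follows: zero-weight steps are collected in Z and not
-- counted, and u is the number of the other ones.
data W {n} (X : Layer n) (i : Fin n) : Fin n → ℤ → ℕ → Set where
  still : ∀ {j} → Z X ∋ i ⟶ j → W X i j 0ℤ 0
  move  : ∀ {k j z u} d → W X i k z u → edge X d ∋ k ⟶ j → W X i j (z ℤ.+ δ d) (suc u)

still-then : ∀ {n} {X : Layer n} → Saturated X → ∀ {i k j z u} →
             W X i k z u → Z X ∋ k ⟶ j → W X i j z u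
still-then sat (still p)    q = still (Z-trans sat p q)
still-then sat (move d w e) q = move d w (absorb sat d e q)

weight-bound : ∀ {n} {X : Layer n} {i j z u} → W X i j z u → ∣ z ∣ ≤ u
weight-bound (still _) = z≤n
weight-bound (move {z = z} {u = u} d w _) = ℕ.≤-trans (ℤ.∣i+j∣≤∣i∣+∣j∣ z (δ d))
  (ℕ.≤-trans (ℕ.+-mono-≤ (weight-bound w) (unit d)) (ℕ.≤-reflexive (ℕ.+-comm u 1)))
  where
  unit : ∀ d → ∣ δ d ∣ ≤ 1
  unit ↑ = s≤s z≤n
  unit ↓ = s≤s z≤n

module Halving {n : ℕ} (ℓ : ℕ) (n<2^ℓ : n < 2 ^ ℓ) where

  open Closure ℓ n<2^ℓ public

  saturate : Matrix Bool n → Matrix Bool n → Matrix Bool n → Layer n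
  saturate P N E = layer (P ∙ closure E) (N ∙ closure E) (closure E)

  saturate-saturated : ∀ P N E → Saturated (saturate P N E)
  saturate-saturated P N E = record
    { Z-refl  = closure-refl
    ; Z-trans = closure-trans
    ; absorb  = λ { ↑ → extend {P} ; ↓ → extend {N} }
    }
    where
    extend : ∀ {A i j k} → A ∙ closure E ∋ i ⟶ j → closure E ∋ j ⟶ k → A ∙ closure E ∋ i ⟶ k
    extend {A} p q with m , a , b ← ∙-elim {A = A} p = ∙-intro a (closure-trans b q)

  halve⁰ : Layer n → Matrix Bool n
  halve⁰ X = P X ∙ N X ∪ N X ∙ P X ∪ N X ∪ Z X

  -- Odd walks are rounded up: a last step of weight 1 becomes a step of
  -- weight 1, and one of weight -1 becomes a step of weight 0.
  halve : Layer n → Layer n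
  halve X = saturate (P X ∪ P X ∙ P X) (N X ∙ N X) (halve⁰ X)

  halve-saturated : ∀ X → Saturated (halve X)
  halve-saturated X = saturate-saturated _ _ _

  module _ {X : Layer n} where

    private
      X′ = halve X

      extend : ∀ A {E i j} → A ∋ i ⟶ j → A ∙ closure E ∋ i ⟶ j
      extend A p = ∙-intro p (closure-refl _)

      up-up : ∀ {i k j} → P X ∋ i ⟶ k → P X ∋ k ⟶ j → P X′ ∋ i ⟶ j
      up-up p q = extend _ (∪-introʳ {A = P X} (∙-intro p q))

      up-last : ∀ {i j} → P X ∋ i ⟶ j → P X′ ∋ i ⟶ j
      up-last p = extend _ (∪-introˡ p)

      down-down : ∀ {i k j} → N X ∋ i ⟶ k → N X ∋ k ⟶ j → N X′ ∋ i ⟶ j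
      down-down p q = extend _ (∙-intro p q)

      up-down : ∀ {i k j} → P X ∋ i ⟶ k → N X ∋ k ⟶ j → Z X′ ∋ i ⟶ j
      up-down p q = closure-edge (∪-introˡ (∪-introˡ (∪-introˡ (∙-intro p q))))

      down-up : ∀ {i k j} → N X ∋ i ⟶ k → P X ∋ k ⟶ j → Z X′ ∋ i ⟶ j
      down-up p q = closure-edge (∪-introˡ (∪-introˡ (∪-introʳ {A = P X ∙ N X} (∙-intro p q))))

      down-last : ∀ {i j} → N X ∋ i ⟶ j → Z X′ ∋ i ⟶ j
      down-last p = closure-edge (∪-introˡ (∪-introʳ {A = P X ∙ N X ∪ N X ∙ P X} p))

      stay : ∀ {i j} → Z X ∋ i ⟶ j → Z X′ ∋ i ⟶ j
      stay p = closure-edge (∪-introʳ {A = P X ∙ N X ∪ N X ∙ P X ∪ N X} p)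

      double+ : ∀ h d → ((h ℤ.+ h) ℤ.+ d) ℤ.+ d ≡ (h ℤ.+ d) ℤ.+ (h ℤ.+ d)
      double+ = solve-∀

      cancel : ∀ x y → x ℤ.+ y ℤ.- y ≡ x
      cancel = solve-∀

    data Halved (i j : Fin n) (z : ℤ) (u : ℕ) : Set where
      even : ∀ {h v} → W X′ i j h v → v + v ≤ u → z ≡ h ℤ.+ h → Halved i j z u
      odd  : ∀ {k h v} d → W X′ i k h v → edge X d ∋ k ⟶ j →
             suc (v + v) ≤ u → z ≡ (h ℤ.+ h) ℤ.+ δ d → Halved i j z u

    -- Counted steps are paired from the left, with at most one left pending. A pair of equal
    -- directions becomes one counted step; a pair of opposite ones becomes a zero step, absorbed by
    -- saturation.
    split-even : ∀ {i j z u} → W X i j z u → Halved i j z u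
    split-even (still p) = even (still (stay p)) z≤n refl
    split-even (move d w e) with split-even w
    ... | even w′ le eq   = odd d w′ e (s≤s le) (cong (ℤ._+ δ d) eq)
    ... | odd {h = h} {v} d′ w′ e′ le eq with d′ | d
    ...   | ↑ | ↑ = even (move ↑ w′ (up-up e′ e))
                      (ℕ.≤-trans (ℕ.≤-reflexive (cong suc (ℕ.+-suc v v))) (s≤s le))
                      (trans (cong (ℤ._+ 1ℤ) eq) (double+ h 1ℤ))
    ...   | ↓ | ↓ = even (move ↓ w′ (down-down e′ e))
                      (ℕ.≤-trans (ℕ.≤-reflexive (cong suc (ℕ.+-suc v v))) (s≤s le))
                      (trans (cong (ℤ._+ -1ℤ) eq) (double+ h -1ℤ))
    ...   | ↑ | ↓ = even (still-then (halve-saturated X) w′ (up-down e′ e))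
                      (ℕ.≤-trans (ℕ.n≤1+n _) (ℕ.≤-trans le (ℕ.n≤1+n _)))
                      (trans (cong (ℤ._+ -1ℤ) eq) (cancel (h ℤ.+ h) 1ℤ))
    ...   | ↓ | ↑ = even (still-then (halve-saturated X) w′ (down-up e′ e))
                      (ℕ.≤-trans (ℕ.n≤1+n _) (ℕ.≤-trans le (ℕ.n≤1+n _)))
                      (trans (cong (ℤ._+ 1ℤ) eq) (cancel (h ℤ.+ h) -1ℤ))

    -- h = ⌈ z / 2 ⌉.
    halved-walk : ∀ {i j z u} → W X i j z u →
      ∃[ h ] ∃[ v ] W X′ i j h v × v + v ≤ suc u × z ℤ.≤ h ℤ.+ h × h ℤ.+ h ℤ.≤ z ℤ.+ 1ℤ
    halved-walk w with split-even w
    ... | even {h} w′ le refl =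
      h , _ , w′ , ℕ.≤-trans le (ℕ.n≤1+n _) , ℤ.≤-refl , ℤ.i≤i+j (h ℤ.+ h) 1ℤ
    ... | odd {h = h} ↓ w′ e le refl =
      h , _ , still-then (halve-saturated X) w′ (down-last e) ,
      ℕ.≤-trans (ℕ.n≤1+n _) (ℕ.≤-trans le (ℕ.n≤1+n _)) ,
      ℤ.i-j≤i (h ℤ.+ h) 1ℤ , ℤ.≤-reflexive (sym (cancel (h ℤ.+ h) -1ℤ))
    -- The pending step is promoted to a counted one; this is the case that costs the extra 1 in
    -- `v + v ≤ suc u`.
    ... | odd {h = h} {v} ↑ w′ e le refl =
      h ℤ.+ 1ℤ , _ , move ↑ w′ (up-last e) ,
      s≤s (ℕ.≤-trans (ℕ.≤-reflexive (ℕ.+-suc v v)) le) ,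
      ℤ.≤-trans (ℤ.i≤i+j _ 1ℤ) (ℤ.≤-reflexive (double+ h 1ℤ)) ,
      ℤ.≤-reflexive (sym (double+ h 1ℤ))

    module _ (sat : Saturated X) where

      private
        Below : Fin n → Fin n → ℤ → Set
        Below i j b = ∃[ z ] ∃[ u ] W X i j z u × z ℤ.≤ b

        move-below : ∀ {i k j b} d → Below i k b → edge X d ∋ k ⟶ j → Below i j (b ℤ.+ δ d)
        move-below d (z , u , w , le) e = _ , _ , move d w e , ℤ.+-monoˡ-≤ (δ d) le

        still-below : ∀ {i k j b} → Below i k b → Z X ∋ k ⟶ j → Below i j b
        still-below (z , u , w , le) e = _ , _ , still-then sat w e , le

        weaken : ∀ {i j a b} → a ℤ.≤ b → Below i j a → Below i j b
        weaken le (z , u , w , le′) = z , u , w , ℤ.≤-trans le′ le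

        zero-below : ∀ {i k j b} → Below i k b → halve⁰ X ∋ k ⟶ j → Below i j b
        zero-below {b = b} p e with ∪-elim {A = P X ∙ N X ∪ N X ∙ P X ∪ N X} e
        ... | inj₂ q = still-below p q
        ... | inj₁ e₁ with ∪-elim {A = P X ∙ N X ∪ N X ∙ P X} e₁
        ...   | inj₂ q = weaken (ℤ.i-j≤i b 1ℤ) (move-below ↓ p q)
        ...   | inj₁ e₂ with ∪-elim {A = P X ∙ N X} e₂
        ...     | inj₁ q with m , x , y ← ∙-elim {A = P X} q =
                  weaken (ℤ.≤-reflexive (cancel b 1ℤ)) (move-below ↓ (move-below ↑ p x) y)
        ...     | inj₂ q with m , x , y ← ∙-elim {A = N X} q =
                  weaken (ℤ.≤-reflexive (cancel b -1ℤ)) (move-below ↑ (move-below ↓ p x) y)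

        zeros-below : ∀ {i k j b} → Below i k b → Star (halve⁰ X ∋_⟶_) k j → Below i j b
        zeros-below p nil     = p
        zeros-below p (e ◅ s) = zeros-below (zero-below p e) s

      -- Only an upper bound, because the rounding edges can be used anywhere in a walk and not just
      -- at its end. They err on one side: weight 1 may stand for 1 instead of 2, and weight 0 for
      -- -1 instead of 0.
      unhalve : ∀ {i j h v} → W X′ i j h v → ∃[ z ] ∃[ u ] W X i j z u × z ℤ.≤ h ℤ.+ h
      unhalve (still e) = zeros-below (_ , _ , still (Z-refl sat _) , ℤ.≤-refl) (closure⇒star e)
      unhalve (move {z = h} ↑ w e) with m , a , b ← ∙-elim {A = P X ∪ P X ∙ P X} e
        with ∪-elim {A = P X} a
      ... | inj₁ p = zeros-below (weaken (ℤ.≤-trans (ℤ.i≤i+j _ 1ℤ) (ℤ.≤-reflexive (double+ h 1ℤ)))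
                       (move-below ↑ (unhalve w) p)) (closure⇒star b)
      ... | inj₂ q with l , x , y ← ∙-elim {A = P X} q =
        zeros-below (weaken (ℤ.≤-reflexive (double+ h 1ℤ)) (move-below ↑ (move-below ↑ (unhalve w) x) y))
          (closure⇒star b)
      unhalve (move {z = h} ↓ w e) with m , a , b ← ∙-elim {A = N X ∙ N X} e
        with l , x , y ← ∙-elim {A = N X} a =
        zeros-below (weaken (ℤ.≤-reflexive (double+ h -1ℤ)) (move-below ↓ (move-below ↓ (unhalve w) x) y))
          (closure⇒star b)

-- Refining distances and signs from a halved layer

module Refinement {n : ℕ} (ℓ : ℕ) (n<2^ℓ : n < 2 ^ ℓ) where

  open Halving ℓ n<2^ℓ public

  IsDist : Layer n → ℕ → Fin n → Fin n → ℤ → Set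
  IsDist Y s i j d = (∃[ u ] W Y i j d u × u ≤ s) × (∀ {z u} → W Y i j z u → d ℤ.≤ z)

  -- Nothing is claimed about pairs with walks of arbitrarily small weight,
  -- except that their entries are attained by walks.
  record Approximates (Y : Layer n) (s : ℕ) (x : Matrix ℤ n) : Set where
    field
      -- An entry above `s` plays the role of ∞: a walk with at most `s` counted steps weighs at
      -- most `s`, and `x > s` gives `2x - 1 > 2s`, so the mark survives refinement.
      sound : ∀ i j → + s ℤ.< x i j ⊎ ∃[ z ] ∃[ u ] W Y i j z u × z ℤ.≤ x i j
      exact : ∀ {i j d} → IsDist Y s i j d → x i j ≡ d
      -- Holds with `s = 1` for entries of absolute value at most 2, and is preserved since
      -- `|2x - b| + 1 ≤ 2 (|x| + 1)` for a bit `b`.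
      small : ∀ i j → suc ∣ x i j ∣ ≤ 3 * s

  open Approximates public

  offset : Dir → ℤ
  offset ↑ = 1ℤ
  offset ↓ = 0ℤ

  -- The interface between refinement and the target product. `attained` does not mention
  -- minimality, so it also serves pairs without a least walk; `detected` asks for the lower bound
  -- over all edges into `j`.
  record IsTarget (x : Matrix ℤ n) (A : Matrix Bool n) (o : ℤ) (c : Matrix Bool n) : Set where
    field
      attained : ∀ {i j} → c ∋ i ⟶ j → ∃[ m ] A ∋ m ⟶ j × x i m ≡ x i j ℤ.- o
      detected : ∀ {i j m} → A ∋ m ⟶ j → x i m ≡ x i j ℤ.- o →
                 (∀ m′ → A ∋ m′ ⟶ j → x i j ℤ.- o ℤ.≤ x i m′) → c ∋ i ⟶ j

  open IsTarget public

  refine : Matrix ℤ n → Matrix Bool n → Matrix ℤ n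
  refine x b i j = (x i j ℤ.+ x i j) ℤ.- bit (b i j)

  private
    -- Both kinds of last step lead to the same value `2x - 1`, so the two target products can be
    -- merged into one bit.
    2[x-o]+δ : ∀ d x → ((x ℤ.- offset d) ℤ.+ (x ℤ.- offset d)) ℤ.+ δ d ≡ (x ℤ.+ x) ℤ.- 1ℤ
    2[x-o]+δ ↑ = solve-∀
    2[x-o]+δ ↓ = solve-∀

    x-o≤x : ∀ d x → x ℤ.- offset d ℤ.≤ x
    x-o≤x ↑ x = ℤ.i-j≤i x 1ℤ
    x-o≤x ↓ x = ℤ.i-j≤i x 0ℤ

    double-< : ∀ a x → + a ℤ.< x → + (a + a) ℤ.< (x ℤ.+ x) ℤ.- 1ℤ
    double-< a x a<x = ℤ.suc[i]≤j⇒i<j (≤-by₂ {x = 1ℤ ℤ.+ + a} {x} {1ℤ ℤ.+ + a} {x} 0 a<x′ a<x′ (eq (+ a) x))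
      where
      a<x′ = ℤ.i<j⇒suc[i]≤j a<x

      eq : ∀ a x → ((x ℤ.+ x) ℤ.- 1ℤ) ℤ.- (1ℤ ℤ.+ (a ℤ.+ a)) ≡
           ((x ℤ.- (1ℤ ℤ.+ a)) ℤ.+ (x ℤ.- (1ℤ ℤ.+ a))) ℤ.+ 0ℤ
      eq = solve-∀

    2x-bit≤ : ∀ x b → (x ℤ.+ x) ℤ.- bit b ℤ.≤ x ℤ.+ x
    2x-bit≤ x true  = ℤ.i-j≤i _ 1ℤ
    2x-bit≤ x false = ℤ.i-j≤i _ 0ℤ

    ≤2x-bit : ∀ x b → (x ℤ.+ x) ℤ.- 1ℤ ℤ.≤ (x ℤ.+ x) ℤ.- bit b
    ≤2x-bit x true  = ℤ.≤-refl
    ≤2x-bit x false = ℤ.≤-trans (ℤ.i-j≤i (x ℤ.+ x) 1ℤ) (ℤ.≤-reflexive (sym (ℤ.+-identityʳ _)))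

  module _ {Y : Layer n} (sat : Saturated Y) {s : ℕ} where

    private
      move-unhalved : ∀ d {i k j z u y} → W (halve Y) i k z u → z ℤ.≤ y → edge Y d ∋ k ⟶ j →
        ∃[ z′ ] ∃[ u′ ] W Y i j z′ u′ × z′ ℤ.≤ (y ℤ.+ y) ℤ.+ δ d
      move-unhalved d w z≤y e with z′ , u′ , w′ , le ← unhalve sat w =
        _ , _ , move d w′ e , ℤ.+-monoˡ-≤ (δ d) (ℤ.≤-trans le (ℤ.+-mono-≤ z≤y z≤y))

    -- Soundness lifts each half-weight walk by `unhalve`, with one more edge if the bit is set.
    -- Exactness is a sandwich: `sound′` gives the lower bound, and the parity of a shortest walk
    -- gives the upper one.
    refine-approximates : ∀ {x} {c : Dir → Matrix Bool n} → Approximates (halve Y) s x →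
      (∀ d → IsTarget x (edge Y d) (offset d) (c d)) →
      Approximates Y (s + s) (refine x (c ↑ ∪ c ↓))
    refine-approximates {x} {c} ap target = record
      { sound = sound′ ; exact = exact′ ; small = small′ }
      where
      b : Matrix Bool n
      b = c ↑ ∪ c ↓

      x′ : Matrix ℤ n
      x′ = refine x b

      pick : ∀ {i j} → b ∋ i ⟶ j → ∃[ d ] c d ∋ i ⟶ j
      pick p with ∪-elim {A = c ↑} {B = c ↓} p
      ... | inj₁ q = ↑ , q
      ... | inj₂ q = ↓ , q

      unpick : ∀ d {i j} → c d ∋ i ⟶ j → b ∋ i ⟶ j
      unpick ↑ = ∪-introˡ {A = c ↑} {B = c ↓}
      unpick ↓ = ∪-introʳ {A = c ↑} {B = c ↓}

      sound′ : ∀ i j → + (s + s) ℤ.< x′ i j ⊎ ∃[ z ] ∃[ u ] W Y i j z u × z ℤ.≤ x′ i j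
      sound′ i j with b i j in eq
      sound′ i j | false with sound ap i j
      ... | inj₁ s<x = inj₁ (ℤ.<-≤-trans (double-< s (x i j) s<x) (≤2x-bit (x i j) false))
      ... | inj₂ (z , u , w , le) with z′ , u′ , w′ , le′ ← unhalve sat w =
        inj₂ (z′ , u′ , w′ , ℤ.≤-trans (ℤ.≤-trans le′ (ℤ.+-mono-≤ le le))
                               (ℤ.≤-reflexive (sym (ℤ.+-identityʳ _))))
      sound′ i j | true with d , p ← pick {i} {j} ⟪ eq ⟫
        with m , e , xm ← attained (target d) p with sound ap i m
      ... | inj₁ s<x = inj₁ (double-< s (x i j)
              (ℤ.<-≤-trans (subst (+ s ℤ.<_) xm s<x) (x-o≤x d (x i j))))
      ... | inj₂ (z , u , w , le)
        with z′ , u′ , w′ , le′ ← move-unhalved d w (subst (z ℤ.≤_) xm le) e =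
        inj₂ (z′ , u′ , w′ , ℤ.≤-trans le′ (ℤ.≤-reflexive (2[x-o]+δ d (x i j))))

      exact′ : ∀ {i j d} → IsDist Y (s + s) i j d → x′ i j ≡ d
      exact′ {i} {j} {d} ((u , w , u≤2s) , least)
        with h , v , w′ , 2v≤1+u , d≤2h , 2h≤d+1 ← halved-walk w =
        ℤ.≤-antisym x′≤d d≤x′
        where
        v≤s : v ≤ s
        v≤s = half-≤ (ℕ.≤-trans 2v≤1+u (s≤s u≤2s))

        x≡h : x i j ≡ h
        -- `h` is least in the halved layer: a walk of weight `z` there lifts to weight at most
        -- `2z`, so `d ≤ 2z` and `2h ≤ d + 1 ≤ 2z + 1`.
        x≡h = exact ap ((v , w′ , v≤s) , λ {z} w″ →
          case unhalve sat w″ of λ { (z₀ , _ , w₀ , le) →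
            half-mono h z (ℤ.≤-trans 2h≤d+1 (ℤ.+-monoˡ-≤ 1ℤ (ℤ.≤-trans (least w₀) le))) })

        h≤s : h ℤ.≤ + s
        h≤s = ℤ.≤-trans (i≤∣i∣ h) (+≤+ (ℕ.≤-trans (weight-bound w′) v≤s))

        x≤s : x i j ℤ.≤ + s
        x≤s = subst (ℤ._≤ + s) (sym x≡h) h≤s

        d≤x′ : d ℤ.≤ x′ i j
        d≤x′ with sound′ i j
        ... | inj₁ 2s<x′ = contradiction
                (ℤ.<-≤-trans 2s<x′ (ℤ.≤-trans (2x-bit≤ (x i j) (b i j)) (ℤ.+-mono-≤ x≤s x≤s)))
                (ℤ.<-irrefl refl)
        ... | inj₂ (z , _ , w″ , le) = ℤ.≤-trans (least w″) le

        x′≤d : x′ i j ℤ.≤ d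
        x′≤d with b i j in eq
        ... | true rewrite x≡h = ≤-by {x = h ℤ.+ h} 0 2h≤d+1 (shift h d)
          where
          shift : ∀ h d → d ℤ.- ((h ℤ.+ h) ℤ.- 1ℤ) ≡ ((d ℤ.+ 1ℤ) ℤ.- (h ℤ.+ h)) ℤ.+ 0ℤ
          shift = solve-∀
        ... | false with split-even w
        ...   | even {h₂} _ _ refl rewrite x≡h =
                ℤ.≤-trans (ℤ.≤-reflexive (ℤ.+-identityʳ _))
                  (ℤ.+-mono-≤ (half-mono h h₂ 2h≤d+1) (half-mono h h₂ 2h≤d+1))
        -- An odd shortest walk forces the bit: its last edge is a witness for the target, so a
        -- cleared bit is absurd.
        ...   | odd {m} {h₂} {v₂} dir w₂ e 2v₂<u refl =
                case trans (sym eq) (holds (unpick dir (detected (target dir) e xm bound))) of λ ()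
          where
          -- A prefix of a shortest walk is shortest: a lighter one, followed by the same edge,
          -- would undercut `d`. Hence the entry at `m` is exact too.
          h₂-least : ∀ {z u} → W (halve Y) i m z u → h₂ ℤ.≤ z
          h₂-least {z} w″ with z₀ , _ , w₀ , le ← move-unhalved dir w″ ℤ.≤-refl e =
            half-mono h₂ z (ℤ.≤-trans
              (≤-by 0 (ℤ.≤-trans (least w₀) le) (shift h₂ z (δ dir)))
              (ℤ.i≤i+j (z ℤ.+ z) 1ℤ))
            where
            shift : ∀ h z d → (z ℤ.+ z) ℤ.- (h ℤ.+ h) ≡
              (((z ℤ.+ z) ℤ.+ d) ℤ.- ((h ℤ.+ h) ℤ.+ d)) ℤ.+ 0ℤ
            shift = solve-∀

          -- The hypotheses say that `h` rounds up half of `2h₂ + 1` or `2h₂ - 1`, which is `h₂ + 1`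
          -- or `h₂`.
          shifted : ∀ dir h → h ℤ.+ h ℤ.≤ ((h₂ ℤ.+ h₂) ℤ.+ δ dir) ℤ.+ 1ℤ →
            (h₂ ℤ.+ h₂) ℤ.+ δ dir ℤ.≤ h ℤ.+ h → h₂ ≡ h ℤ.- offset dir
          shifted ↓ h p q = trans (ℤ.≤-antisym
            (half-mono h₂ h (≤-by 0 q (eq₁ h₂ h)))
            (half-mono h h₂ (ℤ.≤-trans p (≤-by {x = 0ℤ} 1 ℤ.≤-refl (eq₂ h₂)))))
            (sym (ℤ.+-identityʳ h))
            where
            eq₁ : ∀ a h → (h ℤ.+ h ℤ.+ 1ℤ) ℤ.- (a ℤ.+ a) ≡ ((h ℤ.+ h) ℤ.- ((a ℤ.+ a) ℤ.+ -1ℤ)) ℤ.+ 0ℤ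
            eq₁ = solve-∀
            eq₂ : ∀ a → (a ℤ.+ a ℤ.+ 1ℤ) ℤ.- (((a ℤ.+ a) ℤ.+ -1ℤ) ℤ.+ 1ℤ) ≡ (0ℤ ℤ.- 0ℤ) ℤ.+ 1ℤ
            eq₂ = solve-∀
          shifted ↑ h p q = ℤ.≤-antisym
            (half-mono h₂ (h ℤ.- 1ℤ) (≤-by 0 q (eq₁ h₂ h)))
            (half-mono (h ℤ.- 1ℤ) h₂ (≤-by 1 p (eq₂ h₂ h)))
            where
            eq₁ : ∀ a h → ((h ℤ.- 1ℤ) ℤ.+ (h ℤ.- 1ℤ) ℤ.+ 1ℤ) ℤ.- (a ℤ.+ a) ≡
                  ((h ℤ.+ h) ℤ.- ((a ℤ.+ a) ℤ.+ 1ℤ)) ℤ.+ 0ℤ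
            eq₁ = solve-∀
            eq₂ : ∀ a h → (a ℤ.+ a ℤ.+ 1ℤ) ℤ.- ((h ℤ.- 1ℤ) ℤ.+ (h ℤ.- 1ℤ)) ≡
                  ((((a ℤ.+ a) ℤ.+ 1ℤ) ℤ.+ 1ℤ) ℤ.- (h ℤ.+ h)) ℤ.+ 1ℤ
            eq₂ = solve-∀

          h₂≡x-o : h₂ ≡ x i j ℤ.- offset dir
          h₂≡x-o = trans (shifted dir h 2h≤d+1 d≤2h) (cong (ℤ._- offset dir) (sym x≡h))

          xm : x i m ≡ x i j ℤ.- offset dir
          xm = trans (exact ap ((v₂ , w₂ , half-≤ (ℕ.≤-trans (ℕ.n≤1+n _) (ℕ.≤-trans 2v₂<u
                 (ℕ.≤-trans u≤2s (ℕ.n≤1+n _))))) , h₂-least)) h₂≡x-o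

          bound : ∀ m′ → edge Y dir ∋ m′ ⟶ j → x i j ℤ.- offset dir ℤ.≤ x i m′
          bound m′ e′ with sound ap i m′
          -- An entry standing for ∞ cannot undercut the target, as `x i j ≤ s`.
          ... | inj₁ s<x = ℤ.≤-trans (x-o≤x dir (x i j)) (ℤ.≤-trans x≤s (ℤ.<⇒≤ s<x))
          ... | inj₂ (z , _ , w″ , le) with z₀ , _ , w₀ , le₀ ← move-unhalved dir w″ le e′ =
            subst (ℤ._≤ x i m′) h₂≡x-o (half-mono h₂ (x i m′)
              (ℤ.≤-trans (≤-by 0 (ℤ.≤-trans (least w₀) le₀) (shift h₂ (x i m′) (δ dir)))
                (ℤ.i≤i+j (x i m′ ℤ.+ x i m′) 1ℤ)))
            where
            shift : ∀ h z d → (z ℤ.+ z) ℤ.- (h ℤ.+ h) ≡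
              (((z ℤ.+ z) ℤ.+ d) ℤ.- ((h ℤ.+ h) ℤ.+ d)) ℤ.+ 0ℤ
            shift = solve-∀

      small′ : ∀ i j → suc ∣ x′ i j ∣ ≤ 3 * (s + s)
      small′ i j = ℕ.≤-trans
        (s≤s (ℕ.≤-trans (ℤ.∣i-j∣≤∣i∣+∣j∣ (x i j ℤ.+ x i j) (bit (b i j)))
                        (ℕ.+-mono-≤ (ℤ.∣i+j∣≤∣i∣+∣j∣ (x i j) (x i j)) (∣bit∣≤1 (b i j)))))
        (doubled (small ap i j))
        where
        doubled : ∀ {a} → suc a ≤ 3 * s → suc (a + a + 1) ≤ 3 * (s + s)
        doubled {a} le = begin
          suc (a + a + 1)    ≡⟨ cong suc (ℕ.+-assoc a a 1) ⟩
          suc a + (a + 1)    ≡⟨ cong (λ y → suc a + y) (ℕ.+-comm a 1) ⟩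
          suc a + suc a      ≤⟨ ℕ.+-mono-≤ le le ⟩
          3 * s + 3 * s      ≡⟨ ℕ.*-distribˡ-+ 3 s s ⟨
          3 * (s + s)        ∎
          where open ℕ.≤-Reasoning

-- `R`, `O` and `Q` will detect walks of weight at most 1, 0 and -1, so they are nested. Counting
-- how many hold yields the least weight, and 2 if there is no walk, which exceeds `s = 1` and so
-- means ∞.
start : ∀ {n} → Matrix Bool n → Matrix Bool n → Matrix Bool n → Matrix ℤ n
start R O Q i j = (((+ 2) ℤ.- bit (R i j)) ℤ.- bit (O i j)) ℤ.- bit (Q i j)

module Signs {n : ℕ} (ℓ : ℕ) (n<2^ℓ : n < 2 ^ ℓ) where

  open Refinement ℓ n<2^ℓ public

  -- Asymmetric on purpose: any witness of negative weight justifies an answer -∞, however long it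
  -- is, while completeness is claimed for walks with at most `s` counted steps, among which loop
  -- removal finds the ones sought.
  record Detects (Y : Layer n) (s : ℕ) (b : ℤ) (Q : Matrix Bool n) : Set where
    field
      witness  : ∀ {i j} → Q ∋ i ⟶ j → ∃[ z ] ∃[ u ] W Y i j z u × z ℤ.≤ b
      complete : ∀ {i j z u} → W Y i j z u → u ≤ s → z ℤ.≤ b → Q ∋ i ⟶ j

  open Detects public

  module _ {Y : Layer n} (sat : Saturated Y) {s : ℕ} {O : Matrix Bool n}
           (nonpositive : Detects (halve Y) s 0ℤ O) where

    -- An integer is at most 0 if and only if half of it, rounded up, is. So the same matrix works
    -- for all layers.
    nonpositive-refine : Detects Y (s + s) 0ℤ O
    nonpositive-refine = record { witness = witness′ ; complete = complete′ }
      where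
      witness′ : ∀ {i j} → O ∋ i ⟶ j → ∃[ z ] ∃[ u ] W Y i j z u × z ℤ.≤ 0ℤ
      witness′ p with z , _ , w , le ← witness nonpositive p with z′ , u , w′ , le′ ← unhalve sat w =
        z′ , u , w′ , ℤ.≤-trans le′ (ℤ.+-mono-≤ le le)

      complete′ : ∀ {i j z u} → W Y i j z u → u ≤ s + s → z ℤ.≤ 0ℤ → O ∋ i ⟶ j
      complete′ w u≤ z≤0 with h , v , w′ , v≤ , _ , h≤ ← halved-walk w =
        complete nonpositive w′ (half-≤ (ℕ.≤-trans v≤ (s≤s u≤)))
          (half-mono h 0ℤ (ℤ.≤-trans h≤ (ℤ.+-monoˡ-≤ 1ℤ z≤0)))

    -- With `h` the weight of the paired part, `2h` and `2h + 1` are negative if and only if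
    -- `h < 0`, but `2h - 1` already if `h ≤ 0`. This is why nonpositive pairs are tracked besides
    -- negative ones.
    negative-refine : ∀ {Q} → Detects (halve Y) s -1ℤ Q →
                      Detects Y (s + s) -1ℤ (Q ∪ O ∙ N Y ∪ Q ∙ P Y)
    negative-refine {Q} neg = record { witness = witness′ ; complete = complete′ }
      where
      Q′ : Matrix Bool n
      Q′ = Q ∪ O ∙ N Y ∪ Q ∙ P Y

      lower : ∀ d {i k j b} → (∃[ z ] ∃[ u ] W (halve Y) i k z u × z ℤ.≤ b) → edge Y d ∋ k ⟶ j →
              b ℤ.+ b ℤ.+ δ d ℤ.≤ -1ℤ → ∃[ z ] ∃[ u ] W Y i j z u × z ℤ.≤ -1ℤ
      lower d (z , _ , w , le) e le₁ with z′ , u , w′ , le′ ← unhalve sat w =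
        _ , _ , move d w′ e , ℤ.≤-trans (ℤ.+-monoˡ-≤ (δ d) (ℤ.≤-trans le′ (ℤ.+-mono-≤ le le))) le₁

      witness′ : ∀ {i j} → Q′ ∋ i ⟶ j → ∃[ z ] ∃[ u ] W Y i j z u × z ℤ.≤ -1ℤ
      witness′ p with ∪-elim {A = Q ∪ O ∙ N Y} {B = Q ∙ P Y} p
      ... | inj₂ q with k , a , e ← ∙-elim {A = Q} q = lower ↑ (witness neg a) e ℤ.≤-refl
      ... | inj₁ q with ∪-elim {A = Q} {B = O ∙ N Y} q
      ...   | inj₁ a with z , _ , w , le ← witness neg a with z′ , u , w′ , le′ ← unhalve sat w =
              z′ , u , w′ , ℤ.≤-trans (ℤ.≤-trans le′ (ℤ.+-mono-≤ le le)) (-≤- z≤n)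
      ...   | inj₂ a with k , b , e ← ∙-elim {A = O} a = lower ↓ (witness nonpositive b) e ℤ.≤-refl

      complete′ : ∀ {i j z u} → W Y i j z u → u ≤ s + s → z ℤ.≤ -1ℤ → Q′ ∋ i ⟶ j
      complete′ w u≤ z≤ with split-even w
      ... | even {h} w′ v≤ refl =
        ∪-introˡ (∪-introˡ (complete neg w′ (half-≤ (ℕ.≤-trans v≤ (ℕ.≤-trans u≤ (ℕ.n≤1+n _))))
          (half-mono h -1ℤ z≤)))
      ... | odd {h = h} {v} d w′ e v< refl with half-≤ {v} {s} (ℕ.≤-trans (ℕ.n≤1+n _) (ℕ.≤-trans v< (ℕ.≤-trans u≤ (ℕ.n≤1+n _))))
      ...   | v≤ with d
      ...     | ↑ = ∪-introʳ {A = Q ∪ O ∙ N Y} (∙-intro (complete neg w′ v≤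
                      (half-mono h -1ℤ (ℤ.≤-trans (ℤ.i≤i+j (h ℤ.+ h) 1ℤ) (ℤ.≤-trans z≤ ℤ.≤-refl)))) e)
      ...     | ↓ = ∪-introˡ (∪-introʳ {A = Q} (∙-intro (complete nonpositive w′ v≤
                      (half-mono h 0ℤ (≤-by {x = h ℤ.+ h ℤ.+ -1ℤ} {y = -1ℤ} 1 z≤ (eq h)))) e))
        where
        eq : ∀ h → 1ℤ ℤ.- (h ℤ.+ h) ≡ (-1ℤ ℤ.- (h ℤ.+ h ℤ.+ -1ℤ)) ℤ.+ 1ℤ
        eq = solve-∀

-- The last layer, where at most one counted step is left

module Top {n : ℕ} (ℓ : ℕ) (n<2^ℓ : n < 2 ^ ℓ) {Y : Layer n} (sat : Saturated Y) where

  open Signs ℓ n<2^ℓ public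

  private
    Q = Z Y ∙ N Y
    O = Z Y ∪ Q
    R = O ∪ Z Y ∙ P Y

    fromQ : ∀ {i j} → Q ∋ i ⟶ j → W Y i j -1ℤ 1
    fromQ p with k , a , e ← ∙-elim {A = Z Y} {B = N Y} p = move ↓ (still a) e

    fromZ∙P : ∀ {i j} → Z Y ∙ P Y ∋ i ⟶ j → W Y i j 1ℤ 1
    fromZ∙P p with k , a , e ← ∙-elim {A = Z Y} {B = P Y} p = move ↑ (still a) e

    Q⇒O : ∀ {i j} → Q ∋ i ⟶ j → O ∋ i ⟶ j
    Q⇒O = ∪-introʳ {A = Z Y} {B = Q}

    O⇒R : ∀ {i j} → O ∋ i ⟶ j → R ∋ i ⟶ j
    O⇒R = ∪-introˡ {A = O} {B = Z Y ∙ P Y}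

  top-negative : Detects Y 1 -1ℤ Q
  top-negative = record { witness = λ p → _ , _ , fromQ p , ℤ.≤-refl ; complete = complete′ }
    where
    complete′ : ∀ {i j z u} → W Y i j z u → u ≤ 1 → z ℤ.≤ -1ℤ → Q ∋ i ⟶ j
    complete′ (still _)            _ ()
    complete′ (move ↓ (still a) e) _ _ = ∙-intro a e
    complete′ (move ↑ (still a) e) _ ()
    complete′ (move _ (move _ _ _) _) (s≤s ()) _

  top-nonpositive : Detects Y 1 0ℤ O
  top-nonpositive = record { witness = witness′ ; complete = complete′ }
    where
    witness′ : ∀ {i j} → O ∋ i ⟶ j → ∃[ z ] ∃[ u ] W Y i j z u × z ℤ.≤ 0ℤ
    witness′ p with ∪-elim {A = Z Y} {B = Q} p
    ... | inj₁ a = _ , _ , still a , ℤ.≤-refl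
    ... | inj₂ q = _ , _ , fromQ q , -≤+

    complete′ : ∀ {i j z u} → W Y i j z u → u ≤ 1 → z ℤ.≤ 0ℤ → O ∋ i ⟶ j
    complete′ (still a)            _ _ = ∪-introˡ a
    complete′ (move ↓ (still a) e) _ _ = Q⇒O (∙-intro a e)
    complete′ (move ↑ (still a) e) _ (+≤+ ())
    complete′ (move _ (move _ _ _) _) (s≤s ()) _

  top-approximates : Approximates Y 1 (start R O Q)
  top-approximates = record { sound = sound′ ; exact = exact′ ; small = small′ }
    where
    x = start R O Q

    sound′ : ∀ i j → 1ℤ ℤ.< x i j ⊎ ∃[ z ] ∃[ u ] W Y i j z u × z ℤ.≤ x i j
    sound′ i j = cases (R i j) (O i j) (Q i j) refl refl refl
      where
      cases : ∀ r o q → R i j ≡ r → O i j ≡ o → Q i j ≡ q →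
        1ℤ ℤ.< (((+ 2) ℤ.- bit r) ℤ.- bit o) ℤ.- bit q ⊎
        ∃[ z ] ∃[ u ] W Y i j z u × z ℤ.≤ (((+ 2) ℤ.- bit r) ℤ.- bit o) ℤ.- bit q
      cases true true true _ _ q = inj₂ (_ , _ , fromQ ⟪ q ⟫ , ℤ.≤-refl)
      cases true true false _ o q with ∪-elim {A = Z Y} {B = Q} ⟪ o ⟫
      ... | inj₁ a = inj₂ (_ , _ , still a , ℤ.≤-refl)
      ... | inj₂ a = case trans (sym q) (holds a) of λ ()
      cases true false false r o _ with ∪-elim {A = O} {B = Z Y ∙ P Y} ⟪ r ⟫
      ... | inj₁ a = case trans (sym o) (holds a) of λ ()
      ... | inj₂ a = inj₂ (_ , _ , fromZ∙P a , ℤ.≤-refl)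
      cases false false false _ _ _ = inj₁ (ℤ.+<+ (s≤s (s≤s z≤n)))
      cases _ false true _ o q = case trans (sym o) (holds (Q⇒O {i} {j} ⟪ q ⟫)) of λ ()
      cases false true _ r o _ = case trans (sym r) (holds (O⇒R {i} {j} ⟪ o ⟫)) of λ ()

    upper : ∀ {i j z u} → W Y i j z u → u ≤ 1 → x i j ℤ.≤ z
    upper {i} {j} (still a) _ = cases (R i j) (O i j) (Q i j)
      (holds (O⇒R (∪-introˡ {A = Z Y} {B = Q} a))) (holds (∪-introˡ {A = Z Y} {B = Q} a))
      where
      cases : ∀ r o q → r ≡ true → o ≡ true → (((+ 2) ℤ.- bit r) ℤ.- bit o) ℤ.- bit q ℤ.≤ 0ℤ
      cases _ _ true  refl refl = -≤+
      cases _ _ false refl refl = +≤+ z≤n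
    upper {i} {j} (move ↑ (still a) e) _ = cases (R i j) (O i j) (Q i j)
      (holds (∪-introʳ {A = O} {B = Z Y ∙ P Y} (∙-intro a e)))
      where
      cases : ∀ r o q → r ≡ true → (((+ 2) ℤ.- bit r) ℤ.- bit o) ℤ.- bit q ℤ.≤ 1ℤ
      cases _ false false refl = ℤ.≤-refl
      cases _ false true  refl = +≤+ z≤n
      cases _ true  false refl = +≤+ z≤n
      cases _ true  true  refl = -≤+
    upper {i} {j} (move ↓ (still a) e) _ = cases (R i j) (O i j) (Q i j)
      (holds (O⇒R (Q⇒O q))) (holds (Q⇒O q)) (holds q)
      where
      q : Q ∋ i ⟶ j
      q = ∙-intro a e

      cases : ∀ r o q → r ≡ true → o ≡ true → q ≡ true →
        (((+ 2) ℤ.- bit r) ℤ.- bit o) ℤ.- bit q ℤ.≤ -1ℤ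
      cases _ _ _ refl refl refl = ℤ.≤-refl
    upper (move _ (move _ _ _) _) (s≤s ())

    exact′ : ∀ {i j d} → IsDist Y 1 i j d → x i j ≡ d
    exact′ {i} {j} {d} ((u , w , u≤1) , least) = ℤ.≤-antisym (upper w u≤1) d≤x
      where
      d≤x : d ℤ.≤ x i j
      d≤x with sound′ i j
      ... | inj₂ (_ , _ , w′ , le) = ℤ.≤-trans (least w′) le
      ... | inj₁ 1<x = ℤ.≤-trans (i≤∣i∣ d) (ℤ.≤-trans (+≤+ (ℕ.≤-trans (weight-bound w) u≤1)) (ℤ.<⇒≤ 1<x))

    small′ : ∀ i j → suc ∣ x i j ∣ ≤ 3
    small′ i j = cases (R i j) (O i j) (Q i j)
      where
      cases : ∀ r o q → suc ∣ (((+ 2) ℤ.- bit r) ℤ.- bit o) ℤ.- bit q ∣ ≤ 3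
      cases false false false = ℕ.≤-refl
      cases false false true  = s≤s (s≤s z≤n)
      cases false true  false = s≤s (s≤s z≤n)
      cases false true  true  = s≤s z≤n
      cases true  false false = s≤s (s≤s z≤n)
      cases true  false true  = s≤s z≤n
      cases true  true  false = s≤s z≤n
      cases true  true  true  = s≤s (s≤s z≤n)

-- From the first layer to distances

weighs : Weight → Weight ⁺ → Bool
weighs _   ⊤⁺                = false
weighs 1ʷ  Supremum.[ 1ʷ ]  = true
weighs 0ʷ  Supremum.[ 0ʷ ]  = true
weighs -1ʷ Supremum.[ -1ʷ ] = true
weighs _   Supremum.[ _ ]   = false

weighs-refl : ∀ w → weighs w Supremum.[ w ] ≡ true
weighs-refl 1ʷ  = refl
weighs-refl 0ʷ  = refl
weighs-refl -1ʷ = refl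

weighs⇒≡ : ∀ w x → weighs w x ≡ true → x ≡ Supremum.[ w ]
weighs⇒≡ 1ʷ  Supremum.[ 1ʷ ]  _ = refl
weighs⇒≡ 0ʷ  Supremum.[ 0ʷ ]  _ = refl
weighs⇒≡ -1ʷ Supremum.[ -1ʷ ] _ = refl

-- `Pr` is not assumed decidable, so a minimum exists only up to double negation. The natural number
-- `t` bounds the distance to `b`: an element is least unless a smaller one exists, and that one has
-- a smaller `t`.
¬¬-least : (Pr : ℤ → Set) (b : ℤ) → (∀ z → Pr z → b ℤ.≤ z) → ∀ {z} → Pr z →
           ¬ ¬ (∃[ m ] Pr m × (∀ z → Pr z → m ℤ.≤ z))
¬¬-least Pr b bounded {z} pz no-least = search ∣ z ℤ.- b ∣ pz
  (ℤ.≤-trans (ℤ.≤-reflexive (split z b)) (ℤ.+-monoʳ-≤ b (i≤∣i∣ (z ℤ.- b))))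
  where
  split : ∀ z b → z ≡ b ℤ.+ (z ℤ.- b)
  split = solve-∀

  search : ∀ t {z} → Pr z → z ℤ.≤ b ℤ.+ + t → ⊥
  least : ∀ t {z} → z ℤ.≤ b ℤ.+ + t → ∀ y → Pr y → z ℤ.≤ y

  search t {z} pz z≤ = no-least (z , pz , least t z≤)

  least zero z≤ y py =
    ℤ.≤-trans z≤ (ℤ.≤-trans (ℤ.≤-reflexive (ℤ.+-identityʳ b)) (bounded y py))
  least (suc t) {z} z≤ y py with z ℤ.≤? y
  ... | yes z≤y = z≤y
  ... | no  z≰y = ⊥-elim (search t py (≤-by₂ {x = 1ℤ ℤ.+ y} {z} {z} {b ℤ.+ + suc t} 0
                    (ℤ.i<j⇒suc[i]≤j (ℤ.≰⇒> z≰y)) z≤ (eq b y z (+ t))))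
    where
    eq : ∀ b y z t → (b ℤ.+ t) ℤ.- y ≡ ((z ℤ.- (1ℤ ℤ.+ y)) ℤ.+ ((b ℤ.+ (1ℤ ℤ.+ t)) ℤ.- z)) ℤ.+ 0ℤ
    eq = solve-∀

_∩_ : ∀ {n} → Matrix Bool n → Matrix Bool n → Matrix Bool n
(A ∩ B) i j = A i j ∧ B i j

∩-intro : ∀ {n} {A B : Matrix Bool n} {i j} → A ∋ i ⟶ j → B ∋ i ⟶ j → A ∩ B ∋ i ⟶ j
∩-intro ⟪ p ⟫ ⟪ q ⟫ = ⟪ cong₂ _∧_ p q ⟫

∩-elim : ∀ {n} {A B : Matrix Bool n} {i j} → A ∩ B ∋ i ⟶ j → A ∋ i ⟶ j × B ∋ i ⟶ j
∩-elim {A = A} {B} {i} {j} ⟪ p ⟫ with A i j in eqA | B i j in eqB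
... | true  | true  = ⟪ eqA ⟫ , ⟪ eqB ⟫
... | true  | false = case p of λ ()
... | false | _     = case p of λ ()

module Distances {n : ℕ} (ℓ : ℕ) (n<2^ℓ : n < 2 ^ ℓ) (G : Graph n) where

  open Signs ℓ n<2^ℓ public

  private
    E : Weight → Matrix Bool n
    E w i j = weighs w (G i j)

  first : Layer n
  first = saturate (E 1ʷ) (E -1ʷ) (E 0ʷ)

  first-saturated : Saturated first
  first-saturated = saturate-saturated _ _ _

  reach : Matrix Bool n
  reach = closure (E 1ʷ ∪ E -1ʷ ∪ E 0ʷ)

  -- The diagonal part of `Q` marks the vertices on closed walks of negative weight; a pair has
  -- distance -∞ if it can be joined through one of them.
  unbounded : Matrix Bool n → Matrix Bool n
  unbounded Q = reach ∙ (Q ∩ identity) ∙ reach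

  answer : Matrix ℤ n → Matrix Bool n → Matrix (ℤ ±) n
  answer x Q i j = if reach i j then (if unbounded Q i j then ⊥± else [ x i j ]) else ⊤±

  private
    open Walks (λ i j z → ∃[ w ] G i j ≡ Supremum.[ w ] × z ≡ ⟦ w ⟧)

    toWalk : ∀ {i j z} → Path G i j z → ∃[ m ] Walk i j z m
    toWalk []         = _ , []
    toWalk (cons e p) with _ , w ← toWalk p = _ , (_ , e , refl) ▹ w

    fromWalk : ∀ {i j z m} → Walk i j z m → Path G i j z
    fromWalk []                  = []
    fromWalk ((_ , e , refl) ▹ w) = cons e (fromWalk w)

    infixr 5 _⊕_

    _⊕_ : ∀ {i j k z z′} → Path G i j z → Path G j k z′ → Path G i k (z ℤ.+ z′)
    _⊕_ p q with _ , u ← toWalk p with _ , v ← toWalk q = fromWalk (u ++ v)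

    single : ∀ w {i j} → E w ∋ i ⟶ j → Path G i j ⟦ w ⟧
    single w ⟪ p ⟫ = subst (Path G _ _) (ℤ.+-identityʳ ⟦ w ⟧) (cons (weighs⇒≡ w _ p) [])

    zeros : ∀ {i j} → Star (E 0ʷ ∋_⟶_) i j → Path G i j 0ℤ
    zeros nil     = []
    zeros (e ◅ s) = single 0ʷ e ⊕ zeros s

    steps : ∀ {A} w {i j} → A ≡ E w → A ∙ closure (E 0ʷ) ∋ i ⟶ j → Path G i j ⟦ w ⟧
    steps w refl p with k , a , b ← ∙-elim {A = E w} p =
      subst (Path G _ _) (ℤ.+-identityʳ ⟦ w ⟧) (single w a ⊕ zeros (closure⇒star b))

    fromW : ∀ {i j z u} → W first i j z u → Path G i j z
    fromW (still p)    = zeros (closure⇒star p)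
    fromW (move ↑ w e) = fromW w ⊕ steps 1ʷ refl e
    fromW (move ↓ w e) = fromW w ⊕ steps -1ʷ refl e

    edge-step : ∀ w {i j} → G i j ≡ Supremum.[ w ] → E w ∋ i ⟶ j
    edge-step w eq = ⟪ trans (cong (weighs w) eq) (weighs-refl w) ⟫

    -- The accumulator is needed because `W` grows at its end while `Walk` grows at its start.
    toW : ∀ {i k j z z′ u m} → W first i k z u → Walk k j z′ m →
          ∃[ v ] W first i j (z ℤ.+ z′) v × v ≤ u + m
    toW {z = z} {u = u} w [] =
      u , subst (λ y → W first _ _ y u) (sym (ℤ.+-identityʳ z)) w , ℕ.m≤m+n u 0
    toW {z = z} {u = u} w (_▹_ {z = z′} {m = m} (x , e , refl) p) with step x e
      where
      step : ∀ x → G _ _ ≡ Supremum.[ x ] →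
             ∃[ v ] W first _ _ (z ℤ.+ ⟦ x ⟧) v × v ≤ suc u
      step 1ʷ  e = _ , move ↑ w (∙-intro (edge-step 1ʷ e) (closure-refl _)) , ℕ.≤-refl
      step -1ʷ e = _ , move ↓ w (∙-intro (edge-step -1ʷ e) (closure-refl _)) , ℕ.≤-refl
      step 0ʷ  e = u , subst (λ y → W first _ _ y u) (sym (ℤ.+-identityʳ z))
                         (still-then first-saturated w (closure-edge (edge-step 0ʷ e))) , ℕ.n≤1+n u
    ... | v , w′ , v≤ with v′ , w″ , v′≤ ← toW w′ p =
      v′ , subst (λ y → W first _ _ y v′) (ℤ.+-assoc z ⟦ x ⟧ z′) w″ ,
      ℕ.≤-trans v′≤ (ℕ.≤-trans (ℕ.+-monoˡ-≤ m v≤) (ℕ.≤-reflexive (sym (ℕ.+-suc u m))))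

    walk⇒W : ∀ {i j z m} → Walk i j z m → ∃[ v ] W first i j z v × v ≤ m
    walk⇒W {i} {j} {z} p with v , w , v≤ ← toW (still (closure-refl i)) p =
      v , subst (λ y → W first i j y v) (ℤ.+-identityˡ z) w , v≤

    walk⇒reach : ∀ {i j z m} → Walk i j z m → reach ∋ i ⟶ j
    walk⇒reach p = star⇒closure (star p)
      where
      any : ∀ x {i j} → E x ∋ i ⟶ j → E 1ʷ ∪ E -1ʷ ∪ E 0ʷ ∋ i ⟶ j
      any 1ʷ  e = ∪-introˡ (∪-introˡ e)
      any -1ʷ e = ∪-introˡ (∪-introʳ {A = E 1ʷ} e)
      any 0ʷ  e = ∪-introʳ {A = E 1ʷ ∪ E -1ʷ} e

      star : ∀ {i j z m} → Walk i j z m → Star (E 1ʷ ∪ E -1ʷ ∪ E 0ʷ ∋_⟶_) i j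
      star []                 = nil
      star ((x , e , _) ▹ p) = any x (edge-step x e) ◅ star p

    reach⇒path : ∀ {i j} → reach ∋ i ⟶ j → ∃[ z ] Path G i j z
    reach⇒path p = path (closure⇒star p)
      where
      path : ∀ {i j} → Star (E 1ʷ ∪ E -1ʷ ∪ E 0ʷ ∋_⟶_) i j → ∃[ z ] Path G i j z
      path nil = _ , []
      path (e ◅ s) with z , p ← path s with ∪-elim {A = E 1ʷ ∪ E -1ʷ} e
      ... | inj₂ a = _ , single 0ʷ a ⊕ p
      ... | inj₁ b with ∪-elim {A = E 1ʷ} b
      ...   | inj₁ a = _ , single 1ʷ a ⊕ p
      ...   | inj₂ a = _ , single -1ʷ a ⊕ p

  module _ {x : Matrix ℤ n} {Q : Matrix Bool n}
           (approximates : Approximates first (2 ^ ℓ) x) (negative : Detects first (2 ^ ℓ) -1ℤ Q) where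

    private
      unbounded-distance : ∀ {i j} → unbounded Q ∋ i ⟶ j → IsDistance G i j ⊥±
      unbounded-distance {i} {j} p
        with k , p₁ , p₂ ← ∙-elim {A = reach ∙ (Q ∩ identity)} p
        with m , a , q ← ∙-elim {A = reach} p₁
        with qq , ⟪ diagonal ⟫ ← ∩-elim {A = Q} {B = identity} q
        with refl ← identity⇒≡ m k diagonal
        with za , pa ← reach⇒path a
        with zb , pb ← reach⇒path p₂
        with c , _ , wc , c<0 ← witness negative qq = λ b →
          -- Each round of the loop lowers the weight by at least 1, so as many rounds as the
          -- difference to `b` reach it.
          _ , below b (za ℤ.+ zb) c c<0 , pumped (∣ b ℤ.- (za ℤ.+ zb) ∣) za zb c pa (fromW wc) pb
        where
        times : ℕ → ℤ → ℤ
        times zero    c = 0ℤ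
        times (suc t) c = c ℤ.+ times t c

        repeat : ∀ {v c} t → Path G v v c → Path G v v (times t c)
        repeat zero    p = []
        repeat (suc t) p = p ⊕ repeat t p

        pumped : ∀ {v} t za zb c → Path G i v za → Path G v v c → Path G v j zb →
                 Path G i j ((za ℤ.+ zb) ℤ.+ times t c)
        pumped t za zb c pa pc pb = subst (Path G i j) (swap za zb (times t c)) (pa ⊕ repeat t pc ⊕ pb)
          where
          swap : ∀ a b c → a ℤ.+ (c ℤ.+ b) ≡ (a ℤ.+ b) ℤ.+ c
          swap = solve-∀

        times≤ : ∀ t c → c ℤ.≤ -1ℤ → times t c ℤ.≤ ℤ.- (+ t)
        times≤ zero    c le = ℤ.≤-refl
        times≤ (suc t) c le = ℤ.≤-trans (ℤ.+-mono-≤ le (times≤ t c le)) (ℤ.≤-reflexive (neg-suc (+ t)))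
          where
          neg-suc : ∀ t → -1ℤ ℤ.- t ≡ ℤ.- (1ℤ ℤ.+ t)
          neg-suc = solve-∀

        below : ∀ b z c → c ℤ.≤ -1ℤ → z ℤ.+ times ∣ b ℤ.- z ∣ c ℤ.≤ b
        below b z c le = ℤ.≤-trans (ℤ.+-monoʳ-≤ z (times≤ ∣ b ℤ.- z ∣ c le)) (≤-by 0 -i≤∣i∣ (eq b z _))
          where
          -i≤∣i∣ : z ℤ.- b ℤ.≤ + ∣ b ℤ.- z ∣
          -i≤∣i∣ = subst (λ t → z ℤ.- b ℤ.≤ + t) (ℤ.∣i-j∣≡∣j-i∣ z b) (i≤∣i∣ (z ℤ.- b))

          eq : ∀ b z t → b ℤ.- (z ℤ.+ ℤ.- t) ≡ (t ℤ.- (z ℤ.- b)) ℤ.+ 0ℤ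
          eq = solve-∀

      module _ {i j} (r : reach ∋ i ⟶ j) (bounded : ¬ unbounded Q ∋ i ⟶ j) where

        -- The loop has at most `n < 2 ^ ℓ` steps, hence lies within the range in which `negative`
        -- is complete.
        no-negative-loop : ¬ NegativeLoop i j
        no-negative-loop (v , (_ , _ , a) , (c , m , w , c<0 , m≤n) , (_ , _ , b))
          with u , w′ , u≤m ← walk⇒W w =
          bounded (∙-intro (∙-intro (walk⇒reach a)
            (∩-intro {A = Q} {B = identity}
              (complete negative w′ (ℕ.≤-trans u≤m (ℕ.≤-trans m≤n (ℕ.<⇒≤ n<2^ℓ))) (below-zero c<0))
              ⟪ identity-refl v ⟫))
            (walk⇒reach b))
          where
          below-zero : ∀ {c} → c ℤ.< 0ℤ → c ℤ.≤ -1ℤ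
          below-zero {c} c<0 = ≤-by {x = 1ℤ ℤ.+ c} {y = 0ℤ} 0 (ℤ.i<j⇒suc[i]≤j c<0) (eq c)
            where
            eq : ∀ c → -1ℤ ℤ.- c ≡ (0ℤ ℤ.- (1ℤ ℤ.+ c)) ℤ.+ 0ℤ
            eq = solve-∀

        short : ∀ {z} → Path G i j z → ∃[ z′ ] (∃[ m ] Walk i j z′ m × m < n) × z′ ℤ.≤ z
        short p with _ , w ← toWalk p with shorten w
        ... | inj₁ (z′ , m , v , le , m<n) = z′ , (m , v , m<n) , le
        ... | inj₂ neg = ⊥-elim (no-negative-loop neg)

        bounded-below : ∀ z → (∃[ m ] Walk i j z m × m < n) → ℤ.- (+ n) ℤ.≤ z
        bounded-below z (m , w , m<n) with u , w′ , u≤m ← walk⇒W w =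
          -bound (ℕ.≤-trans (weight-bound w′) (ℕ.≤-trans u≤m (ℕ.<⇒≤ m<n)))
          where
          -bound : ∀ {z} → ∣ z ∣ ≤ n → ℤ.- (+ n) ℤ.≤ z
          -bound {+ z}       _  = ℤ.≤-trans (ℤ.neg-mono-≤ {0ℤ} {+ n} (+≤+ z≤n)) (+≤+ z≤n)
          -bound { -[1+ z ]} le = ℤ.neg-mono-≤ (+≤+ le)

        -- Without negative loops all paths are dominated by walks of fewer than `n` steps, whose
        -- weights are bounded below. Their minimum, available under double negation, is the
        -- distance that `exact` asks for.
        entry-exact : ¬ ¬ (x i j ℤ.< + (2 ^ ℓ) × (∀ z → Path G i j z → x i j ℤ.≤ z))
        entry-exact refute with z , p ← reach⇒path r with z′ , short-walk , _ ← short p =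
          ¬¬-least (λ z → ∃[ m ] Walk i j z m × m < n) (ℤ.- (+ n)) bounded-below short-walk found
          where
          found : ¬ (∃[ d ] (∃[ m ] Walk i j d m × m < n) ×
                      (∀ z → (∃[ m ] Walk i j z m × m < n) → d ℤ.≤ z))
          found (d , (m , w , m<n) , least) with u , w′ , u≤m ← walk⇒W w =
            refute (subst (ℤ._< + (2 ^ ℓ)) (sym x≡d)
                     (ℤ.≤-<-trans (i≤∣i∣ d) (ℤ.+<+ (ℕ.≤-<-trans (weight-bound w′)
                       (ℕ.≤-<-trans u≤m (ℕ.<-trans m<n n<2^ℓ))))) ,
                   λ z p → subst (ℤ._≤ z) (sym x≡d) (d≤ p))
            where
            d≤ : ∀ {z} → Path G i j z → d ℤ.≤ z
            d≤ p with z′ , s , le ← short p = ℤ.≤-trans (least z′ s) le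

            x≡d : x i j ≡ d
            x≡d = exact approximates
              ((u , w′ , ℕ.<⇒≤ (ℕ.≤-<-trans u≤m (ℕ.<-trans m<n n<2^ℓ))) , λ w → d≤ (fromW w))

        entry-least : ∀ z → Path G i j z → x i j ℤ.≤ z
        -- Comparison of integers is decidable, so the double negation can be removed here.
        entry-least z p = decidable-stable (x i j ℤ.≤? z) λ x≰z → entry-exact λ (_ , least) → x≰z (least z p)

        entry-path : Path G i j (x i j)
        entry-path with sound approximates i j
        ... | inj₁ big = ⊥-elim (entry-exact λ (x< , _) → ℤ.<-irrefl refl (ℤ.<-trans big x<))
        ... | inj₂ (z , _ , w , z≤x) with p ← fromW w =
          subst (Path G i j) (ℤ.≤-antisym z≤x (entry-least z p)) p

    answer-correct : ∀ i j → IsDistance G i j (answer x Q i j)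
    answer-correct i j with reach i j in eqR
    ... | false = λ z p → case trans (sym eqR) (holds (walk⇒reach (proj₂ (toWalk p)))) of λ ()
    ... | true with unbounded Q i j in eqU
    ...   | true  = unbounded-distance ⟪ eqU ⟫
    ...   | false = entry-path ⟪ eqR ⟫ ¬u , entry-least ⟪ eqR ⟫ ¬u
      where
      ¬u : ¬ unbounded Q ∋ i ⟶ j
      ¬u ⟪ p ⟫ = case trans (sym eqU) p of λ ()

-- Target-(min,max)-products of integers

minimumℤ : ∀ {n} → (Fin (suc n) → ℤ) → ℤ
minimumℤ {zero}  f = f zero
minimumℤ {suc n} f = f zero ℤ.⊓ minimumℤ (f ∘ suc)

minimumℤ-attained : ∀ {n} (f : Fin (suc n) → ℤ) → ∃[ k ] minimumℤ f ≡ f k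
minimumℤ-attained {zero}  f = zero , refl
minimumℤ-attained {suc n} f with ℤ.⊓-sel (f zero) (minimumℤ (f ∘ suc))
... | inj₁ eq = zero , eq
... | inj₂ eq with k , eq′ ← minimumℤ-attained (f ∘ suc) = suc k , trans eq eq′

minimumℤ-≤ : ∀ {n} (f : Fin (suc n) → ℤ) k → minimumℤ f ℤ.≤ f k
minimumℤ-≤ {zero}  f zero    = ℤ.≤-refl
minimumℤ-≤ {suc n} f zero    = ℤ.i⊓j≤i (f zero) _
minimumℤ-≤ {suc n} f (suc k) = ℤ.≤-trans (ℤ.i⊓j≤j (f zero) _) (minimumℤ-≤ (f ∘ suc) k)

minMaxℤ : ∀ {n} → Matrix ℤ n → Matrix ℤ n → Matrix ℤ n
minMaxℤ {suc n} A B i j = minimumℤ (λ k → A i k ℤ.⊔ B k j)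

minMaxℤ-attained : ∀ {n} (A B : Matrix ℤ n) i j → ∃[ k ] minMaxℤ A B i j ≡ A i k ℤ.⊔ B k j
minMaxℤ-attained {suc n} A B i j = minimumℤ-attained (λ k → A i k ℤ.⊔ B k j)

minMaxℤ-≤ : ∀ {n} (A B : Matrix ℤ n) i j k → minMaxℤ A B i j ℤ.≤ A i k ℤ.⊔ B k j
minMaxℤ-≤ {suc n} A B i j = minimumℤ-≤ (λ k → A i k ℤ.⊔ B k j)

target? : ∀ {n} → Matrix ℤ n → Matrix ℤ n → Matrix ℤ n → Matrix Bool n
target? A B T i j = ⌊ T i j ℤ.≟ minMaxℤ A B i j ⌋

fromℤ : ℤ → ℝ
fromℤ z = fromℚ (z / 1)

/1-mono : ∀ {a b} → a ℤ.≤ b → a / 1 ℚ.≤ b / 1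
/1-mono {a} {b} a≤b = ℚ.toℚᵘ-cancel-≤ (ℚᵘ≤.≤-respˡ-≃ (ℚᵘ≤.≃-sym (ℚ.toℚᵘ-fromℚᵘ (ℚᵘ.mkℚᵘ a 0)))
  (ℚᵘ≤.≤-respʳ-≃ (ℚᵘ≤.≃-sym (ℚ.toℚᵘ-fromℚᵘ (ℚᵘ.mkℚᵘ b 0))) (ℚᵘ.*≤* (ℤ.*-monoʳ-≤-nonNeg (+ 1) a≤b))))
  where import Data.Rational.Unnormalised.Properties as ℚᵘ≤

/1-⊔ : ∀ a b → (a ℤ.⊔ b) / 1 ≡ (a / 1) ℚ.⊔ (b / 1)
/1-⊔ a b with ℤ.≤-total a b
... | inj₁ a≤b = trans (cong (_/ 1) (ℤ.i≤j⇒i⊔j≡j a≤b)) (sym (ℚ.p≤q⇒p⊔q≡q (/1-mono a≤b)))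
... | inj₂ b≤a = trans (cong (_/ 1) (ℤ.i≥j⇒i⊔j≡i b≤a)) (sym (ℚ.p≥q⇒p⊔q≡p (/1-mono b≤a)))

/1-⊓ : ∀ a b → (a ℤ.⊓ b) / 1 ≡ (a / 1) ℚ.⊓ (b / 1)
/1-⊓ a b with ℤ.≤-total a b
... | inj₁ a≤b = trans (cong (_/ 1) (ℤ.i≤j⇒i⊓j≡i a≤b)) (sym (ℚ.p≤q⇒p⊓q≡p (/1-mono a≤b)))
... | inj₂ b≤a = trans (cong (_/ 1) (ℤ.i≥j⇒i⊓j≡j b≤a)) (sym (ℚ.p≥q⇒p⊓q≡q (/1-mono b≤a)))

minimum-fromℤ : ∀ {n} (f : Fin (suc n) → ℝ) (g : Fin (suc n) → ℤ) m →
  (∀ k → seq (f k) m ≡ g k / 1) → seq (minimum f) m ≡ minimumℤ g / 1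
minimum-fromℤ {zero}  f g m eq = eq zero
minimum-fromℤ {suc n} f g m eq = trans
  (cong₂ ℚ._⊓_ (eq zero) (minimum-fromℤ (f ∘ suc) (g ∘ suc) m (eq ∘ suc)))
  (sym (/1-⊓ (g zero) (minimumℤ (g ∘ suc))))

minMaxProduct-fromℤ : ∀ {n} (A B : Matrix ℤ n) i j m →
  seq (minMaxProduct (λ i j → fromℤ (A i j)) (λ i j → fromℤ (B i j)) i j) m ≡ minMaxℤ A B i j / 1
minMaxProduct-fromℤ {suc n} A B i j m =
  minimum-fromℤ _ (λ k → A i k ℤ.⊔ B k j) m (λ k → sym (/1-⊔ (A i k) (B k j)))

≤ᴿ-reflexive : ∀ x y → (∀ m → seq x m ≡ seq y m) → x ≤ᴿ y
≤ᴿ-reflexive x y eq (n , lt) = ℚ.<-irrefl refl (ℚ.<-trans (ℚ.≤-<-trans p≤ lt) (subst (ℚ._< seq y n ℚ.+ ε n) (sym (eq n)) p<))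
  where
  p≤ : seq y n ℚ.+ ε n ℚ.≤ seq y n ℚ.+ (ε n ℚ.+ ε n)
  p≤ = ℚ.+-monoʳ-≤ (seq y n) (subst (ℚ._≤ ε n ℚ.+ ε n) (ℚ.+-identityʳ (ε n))
         (ℚ.+-monoʳ-≤ (ε n) (ℚ.nonNegative⁻¹ (ε n) {{ℚ.normalize-nonNeg 1 (suc n)}})))

  p< : seq y n ℚ.< seq y n ℚ.+ ε n
  p< = subst (ℚ._< seq y n ℚ.+ ε n) (ℚ.+-identityʳ (seq y n))
         (ℚ.+-monoʳ-< (seq y n) (ℚ.positive⁻¹ (ε n) {{ℚ.normalize-pos 1 (suc n)}}))

/1-suc : ∀ a → (a / 1) ℚ.+ ℚ.1ℚ ≡ (1ℤ ℤ.+ a) / 1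
/1-suc a = ℚ.toℚᵘ-injective (ℚᵘ≤.≃-trans (ℚ.toℚᵘ-homo-+ (a / 1) ℚ.1ℚ)
  (ℚᵘ≤.≃-trans (ℚᵘ≤.+-congˡ′ (ℚ.toℚᵘ-fromℚᵘ (ℚᵘ.mkℚᵘ a 0)))
  (ℚᵘ≤.≃-trans (ℚᵘ.*≡* (eq a)) (ℚᵘ≤.≃-sym (ℚ.toℚᵘ-fromℚᵘ (ℚᵘ.mkℚᵘ (1ℤ ℤ.+ a) 0))))))
  where
  module ℚᵘ≤ where
    open import Data.Rational.Unnormalised.Properties public
    +-congˡ′ : ∀ {p q r} → p ℚᵘ.≃ q → p ℚᵘ.+ r ℚᵘ.≃ q ℚᵘ.+ r
    +-congˡ′ {r = r} = +-congˡ r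
  eq : ∀ a → (a ℤ.* 1ℤ ℤ.+ 1ℤ ℤ.* 1ℤ) ℤ.* 1ℤ ≡ (1ℤ ℤ.+ a) ℤ.* (1ℤ ℤ.* 1ℤ)
  eq = solve-∀

fromℤ-<ᴿ : ∀ {a b} → a ℤ.< b → ∀ x y → (∀ m → seq x m ≡ a / 1) → (∀ m → seq y m ≡ b / 1) → x <ᴿ y
-- At index 3 the slack is `1/4 + 1/4`, less than the gap of at least 1 between distinct integers.
fromℤ-<ᴿ {a} {b} a<b x y eqx eqy = 3 ,
  subst (λ q → q ℚ.+ (ε 3 ℚ.+ ε 3) ℚ.< seq y 3) (sym (eqx 3))
    (subst (a / 1 ℚ.+ (ε 3 ℚ.+ ε 3) ℚ.<_) (sym (eqy 3))
      (ℚ.<-≤-trans (ℚ.+-monoʳ-< (a / 1) {ε 3 ℚ.+ ε 3} {ℚ.1ℚ} (ℚ.*<* (ℤ.+<+ (s≤s (s≤s z≤n)))))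
        (subst (ℚ._≤ b / 1) (sym (/1-suc a)) (/1-mono (ℤ.i<j⇒suc[i]≤j a<b)))))

-- Equality of reals is not decidable in general, but both sides here are constant sequences of
-- integers; so trichotomy decides it and the output is determined.
target-solution : ∀ {n} (A B T : Matrix ℤ n) (C : Matrix Bool n) →
  (∀ i j → C i j ≡ true ⇔
     fromℤ (T i j) ≈ᴿ minMaxProduct (λ i j → fromℤ (A i j)) (λ i j → fromℤ (B i j)) i j) →
  ∀ i j → C i j ≡ target? A B T i j
target-solution A B T C sol i j = decide (T i j ℤ.≟ minMaxℤ A B i j)
  where
  t m : ℝ
  t = fromℤ (T i j)
  m = minMaxProduct (λ i j → fromℤ (A i j)) (λ i j → fromℤ (B i j)) i j

  ≉ : T i j ≢ minMaxℤ A B i j → ¬ t ≈ᴿ m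
  ≉ ne (t≤m , m≤t) = compare (ℤ.<-cmp (T i j) (minMaxℤ A B i j))
    where
    compare : Tri (T i j ℤ.< minMaxℤ A B i j) (T i j ≡ minMaxℤ A B i j) (minMaxℤ A B i j ℤ.< T i j) → ⊥
    compare (tri< lt _ _) = m≤t (fromℤ-<ᴿ lt t m (λ _ → refl) (minMaxProduct-fromℤ A B i j))
    compare (tri≈ _ eq _) = ne eq
    compare (tri> _ _ gt) = t≤m (fromℤ-<ᴿ gt m t (minMaxProduct-fromℤ A B i j) (λ _ → refl))

  decide : (d : Dec (T i j ≡ minMaxℤ A B i j)) → C i j ≡ ⌊ d ⌋
  decide (yes eq) = Equivalence.from (sol i j)
    ( ≤ᴿ-reflexive t m (λ k → trans (cong (_/ 1) eq) (sym (minMaxProduct-fromℤ A B i j k)))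
    , ≤ᴿ-reflexive m t (λ k → trans (minMaxProduct-fromℤ A B i j k) (cong (_/ 1) (sym eq))))
  decide (no ne) = ¬-not (≉ ne ∘ Equivalence.to (sol i j))

⌊⌋-true : ∀ {P : Set} (d : Dec P) → P → ⌊ d ⌋ ≡ true
⌊⌋-true (yes _) _ = refl
⌊⌋-true (no ¬p) p = contradiction p ¬p

-- M stands for ∞, so that the product with a barrier is a minimum over the edges.
barrier : ∀ {n} → ℕ → Matrix Bool n → Matrix ℤ n
barrier M A i j = if A i j then ℤ.- (+ M) else + M

module Targets {n : ℕ} (ℓ : ℕ) (n<2^ℓ : n < 2 ^ ℓ) where

  open Refinement ℓ n<2^ℓ using (IsTarget; offset)

  -- As `M` exceeds all `|x i j|`, the maximum with `-M` leaves an entry alone and the maximum with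
  -- `M` lifts it above every target. So non-edges never attain the target, and without edges
  -- nothing is reported.
  barrier-target : ∀ {M x} A d → (∀ i j → suc ∣ x i j ∣ ≤ M) →
    IsTarget x A (offset d) (target? x (barrier M A) (λ i j → x i j ℤ.- offset d))
  barrier-target {M} {x} A d small = record { attained = attained′ ; detected = detected′ }
    where
    t : Matrix ℤ n
    t i j = x i j ℤ.- offset d

    low : ∀ i j → ℤ.- (+ M) ℤ.≤ x i j
    low i j = ℤ.≤-trans (ℤ.neg-mono-≤ (+≤+ (ℕ.≤-trans (ℕ.n≤1+n _) (small i j)))) (-∣i∣≤i (x i j))
      where
      -∣i∣≤i : ∀ i → ℤ.- (+ ∣ i ∣) ℤ.≤ i
      -∣i∣≤i (+ zero)  = ℤ.≤-refl
      -∣i∣≤i (+ suc _) = -≤+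
      -∣i∣≤i -[1+ _ ]  = ℤ.≤-refl

    high : ∀ i j → t i j ℤ.< + M
    high i j = ℤ.≤-<-trans (ℤ.≤-trans (t≤x d) (i≤∣i∣ (x i j))) (ℤ.+<+ (small i j))
      where
      t≤x : ∀ d → x i j ℤ.- offset d ℤ.≤ x i j
      t≤x ↑ = ℤ.i-j≤i (x i j) 1ℤ
      t≤x ↓ = ℤ.i-j≤i (x i j) 0ℤ

    open-entry : ∀ {k j} i → A k j ≡ true → x i k ℤ.⊔ barrier M A k j ≡ x i k
    open-entry i p rewrite p = ℤ.i≥j⇒i⊔j≡i (low i _)

    attained′ : ∀ {i j} → target? x (barrier M A) t ∋ i ⟶ j → ∃[ m ] A ∋ m ⟶ j × x i m ≡ t i j
    attained′ {i} {j} ⟪ p ⟫ with t i j ℤ.≟ minMaxℤ x (barrier M A) i j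
    ... | yes eq with k , att ← minMaxℤ-attained x (barrier M A) i j = entry (A k j) refl
      where
      entry : ∀ b → A k j ≡ b → ∃[ m ] A ∋ m ⟶ j × x i m ≡ t i j
      entry true  q = k , ⟪ q ⟫ , sym (trans eq (trans att (open-entry i q)))
      entry false q = contradiction
        (ℤ.<-≤-trans (high i j) (ℤ.≤-trans (blocked q) (ℤ.≤-reflexive (sym (trans eq att)))))
        (ℤ.<-irrefl refl)
        where
        blocked : A k j ≡ false → + M ℤ.≤ x i k ℤ.⊔ barrier M A k j
        blocked q rewrite q = ℤ.i≤j⊔i (x i k) (+ M)

    detected′ : ∀ {i j m} → A ∋ m ⟶ j → x i m ≡ t i j →
      (∀ m′ → A ∋ m′ ⟶ j → t i j ℤ.≤ x i m′) → target? x (barrier M A) t ∋ i ⟶ j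
    detected′ {i} {j} {m} ⟪ e ⟫ eq least =
      ⟪ ⌊⌋-true (t i j ℤ.≟ minMaxℤ x (barrier M A) i j) (ℤ.≤-antisym below above) ⟫
      where
      above : minMaxℤ x (barrier M A) i j ℤ.≤ t i j
      above = ℤ.≤-trans (minMaxℤ-≤ x (barrier M A) i j m)
                (ℤ.≤-reflexive (trans (open-entry i e) eq))

      below : t i j ℤ.≤ minMaxℤ x (barrier M A) i j
      below with k , att ← minMaxℤ-attained x (barrier M A) i j =
        subst (t i j ℤ.≤_) (sym att) (entry (A k j) refl)
        where
        entry : ∀ b → A k j ≡ b → t i j ℤ.≤ x i k ℤ.⊔ barrier M A k j
        entry true  q = ℤ.≤-trans (least k ⟪ q ⟫) (ℤ.i≤i⊔j (x i k) _)
        entry false q rewrite q = ℤ.≤-trans (ℤ.<⇒≤ (high i j)) (ℤ.i≤j⊔i (x i k) (+ M))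

-- Memory

≡ᵇ-refl : ∀ m → (m ≡ᵇ m) ≡ true
≡ᵇ-refl zero    = refl
≡ᵇ-refl (suc m) = ≡ᵇ-refl m

module _ {A : Set} (f : ℕ → ℕ → A) (a i : ℕ) {v : A} where

  update-same : (f [ a , i ↦ v ]) a i ≡ v
  update-same rewrite ≡ᵇ-refl a | ≡ᵇ-refl i = refl

  update-other : ∀ {b j} → b ≢ a ⊎ j ≢ i → (f [ a , i ↦ v ]) b j ≡ f b j
  update-other {b} {j} ne with a ≡ᵇ b in eqA | i ≡ᵇ j in eqI
  ... | false | _     = refl
  ... | true  | false = refl
  ... | true  | true  with ne
  ...   | inj₁ b≢a = contradiction (sym (ℕ.≡ᵇ⇒≡ a b (subst T (sym eqA) tt))) b≢a
  ...   | inj₂ j≢i = contradiction (sym (ℕ.≡ᵇ⇒≡ i j (subst T (sym eqI) tt))) j≢i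

-- One more than the largest index of a word array that is stored to. Stores to real cells do not
-- count, since only word arrays hold lasting data.
writes : Cmd → ℕ
writes skip                              = 0
writes (store a _ _)                     = suc a
writes (copyᴿ _ _ _ _)                   = 0
writes (castᴿ _ _ _)                     = 0
writes (c ⨾ d)                           = writes c ⊔ writes d
writes (if _ ≤ _ then c else d)          = writes c ⊔ writes d
writes (ifᴿ _ [ _ ]≤ _ [ _ ]then c else d) = writes c ⊔ writes d
writes (while _ ≤ _ loop c)              = writes c

run-frame : ∀ {B c μ k μ′} → Run B c μ k μ′ → ∀ {a} → writes c ≤ a → ∀ i → word μ′ a i ≡ word μ a i
run-frame Semantics.skip           le i = refl
run-frame (Semantics.store {μ} {a} {i = j} _ _) le i = update-other (word μ) a j (inj₁ (ℕ.>⇒≢ le))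
run-frame (Semantics.copyᴿ _ _)    le i = refl
run-frame (Semantics.castᴿ _ _)    le i = refl
run-frame (Semantics._⨾_ {c = c} {d} r s) le i = trans
  (run-frame s (ℕ.≤-trans (ℕ.m≤n⊔m (writes c) (writes d)) le) i)
  (run-frame r (ℕ.≤-trans (ℕ.m≤m⊔n (writes c) (writes d)) le) i)
run-frame (Semantics.if-then {c = c} {d} _ _ _ r)  le = run-frame r (ℕ.≤-trans (ℕ.m≤m⊔n (writes c) (writes d)) le)
run-frame (Semantics.if-else {c = c} {d} _ _ _ r)  le = run-frame r (ℕ.≤-trans (ℕ.m≤n⊔m (writes c) (writes d)) le)
run-frame (Semantics.ifᴿ-then {c = c} {d} _ _ _ r) le = run-frame r (ℕ.≤-trans (ℕ.m≤m⊔n (writes c) (writes d)) le)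
run-frame (Semantics.ifᴿ-else {c = c} {d} _ _ _ r) le = run-frame r (ℕ.≤-trans (ℕ.m≤n⊔m (writes c) (writes d)) le)
run-frame (Semantics.while-stop _ _ _)     le i = refl
run-frame (Semantics.while-step _ _ _ r s) le i = trans (run-frame s le i) (run-frame r le i)

module Machine (B : ℕ) where

  open Semantics B using (fit; apply; address; eval; evalAddress) public

  fit-just : ∀ {z} → ∣ z ∣ ≤ B → fit z ≡ just z
  fit-just {z} le with ∣ z ∣ ≤ᵇ B in eq
  ... | true  = refl
  ... | false = ⊥-elim (subst T eq (ℕ.≤⇒≤ᵇ le))

  fit-bounded : ∀ z {v} → fit z ≡ just v → ∣ v ∣ ≤ B
  fit-bounded z eq with ∣ z ∣ ≤ᵇ B in le
  fit-bounded z refl | true = ℕ.≤ᵇ⇒≤ ∣ z ∣ B (subst T (sym le) tt)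

  apply-bounded : ∀ o x y {v} → apply o x y ≡ just v → ∣ v ∣ ≤ B
  apply-bounded add x y          eq = fit-bounded _ eq
  apply-bounded sub x y          eq = fit-bounded _ eq
  apply-bounded mul x y          eq = fit-bounded _ eq
  apply-bounded div x (+ suc _)  eq = fit-bounded _ eq
  apply-bounded div x -[1+ _ ]   eq = fit-bounded _ eq

  eval-bounded : ∀ {μ} → Bounded B μ → ∀ e {v} → eval μ e ≡ just v → ∣ v ∣ ≤ B
  eval-bounded bd (lit z) eq = fit-bounded z eq
  eval-bounded {μ} bd (load a e) eq with eval μ e
  ... | just (+ i) with refl ← eq = bd a i
  eval-bounded {μ} bd (op o e f) eq with eval μ e | eval μ f
  ... | just x | just y = apply-bounded o x y eq

  update-bounded : ∀ f a i v → (∀ b j → ∣ f b j ∣ ≤ B) → ∣ v ∣ ≤ B → ∀ b j → ∣ (f [ a , i ↦ v ]) b j ∣ ≤ B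
  update-bounded f a i v bd le b j with (a ≡ᵇ b) ∧ (i ≡ᵇ j)
  ... | true  = le
  ... | false = bd b j

  -- Overflow leaves the machine stuck, so every stored value fits.
  run-bounded : ∀ {c μ k μ′} → Run B c μ k μ′ → Bounded B μ → Bounded B μ′
  run-bounded Semantics.skip                   bd = bd
  run-bounded (Semantics.store {μ} {a} {f = f} {i} {v} _ eq) bd =
    update-bounded (word μ) a i v bd (eval-bounded {μ} bd f eq)
  run-bounded (Semantics.copyᴿ _ _)            bd = bd
  run-bounded (Semantics.castᴿ _ _)            bd = bd
  run-bounded (r Semantics.⨾ s)                bd = run-bounded s (run-bounded r bd)
  run-bounded (Semantics.if-then _ _ _ r)      bd = run-bounded r bd
  run-bounded (Semantics.if-else _ _ _ r)      bd = run-bounded r bd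
  run-bounded (Semantics.ifᴿ-then _ _ _ r)     bd = run-bounded r bd
  run-bounded (Semantics.ifᴿ-else _ _ _ r)     bd = run-bounded r bd
  run-bounded (Semantics.while-stop _ _ _)     bd = bd
  run-bounded (Semantics.while-step _ _ _ r s) bd = run-bounded s (run-bounded r bd)

  -- A total-correctness triple with a time bound. Boundedness is carried along because the given
  -- programs demand it of the memory they start in.
  Exec : Cmd → Memory → ℕ → (Memory → Set) → Set
  Exec c μ t Q = ∃[ k ] ∃[ μ′ ] Run B c μ k μ′ × k ≤ t × Bounded B μ′ × Q μ′

  exec-seq : ∀ {c d μ t s Q R} → Exec c μ t Q →
    (∀ μ′ → Bounded B μ′ → Q μ′ → Exec d μ′ s R) → Exec (c ⨾ d) μ (t + s) R
  exec-seq (k , μ₁ , r , k≤ , bd , q) next with l , μ₂ , r′ , l≤ , bd′ , q′ ← next μ₁ bd q =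
    k + l , μ₂ , r Semantics.⨾ r′ , ℕ.+-mono-≤ k≤ l≤ , bd′ , q′

  exec-weaken : ∀ {c μ t s Q R} → t ≤ s → (∀ {μ′} → Q μ′ → R μ′) → Exec c μ t Q → Exec c μ s R
  exec-weaken t≤s f (k , μ′ , r , k≤ , bd , q) = k , μ′ , r , ℕ.≤-trans k≤ t≤s , bd , f q

  infix 4 _⊢_⇓_

  record _⊢_⇓_ (μ : Memory) (e : Exp) (v : ℤ) : Set where
    constructor ⇓
    field value : eval μ e ≡ just v

  open _⊢_⇓_ public

  ⇓-cast : ∀ {μ e x y} → x ≡ y → μ ⊢ e ⇓ x → μ ⊢ e ⇓ y
  ⇓-cast refl p = p

  ⇓-lit : ∀ {μ z} → ∣ z ∣ ≤ B → μ ⊢ lit z ⇓ z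
  ⇓-lit le = ⇓ (fit-just le)

  ⇓-load : ∀ {μ e i} a → μ ⊢ e ⇓ + i → μ ⊢ load a e ⇓ word μ a i
  ⇓-load {μ} {e} {i} a (⇓ eq) = ⇓ lemma
    where
    lemma : eval μ (load a e) ≡ just (word μ a i)
    lemma rewrite eq = refl

  ⇓-op : ∀ {μ e f x y z} o → μ ⊢ e ⇓ x → μ ⊢ f ⇓ y → apply o x y ≡ just z → μ ⊢ op o e f ⇓ z
  ⇓-op {μ} {e} {f} {z = z} o (⇓ p) (⇓ q) r = ⇓ lemma
    where
    lemma : eval μ (op o e f) ≡ just z
    lemma rewrite p | q = r

  ⇓-add : ∀ {μ e f x y} → μ ⊢ e ⇓ x → μ ⊢ f ⇓ y → ∣ x ℤ.+ y ∣ ≤ B → μ ⊢ op add e f ⇓ x ℤ.+ y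
  ⇓-add p q le = ⇓-op add p q (fit-just le)

  ⇓-sub : ∀ {μ e f x y} → μ ⊢ e ⇓ x → μ ⊢ f ⇓ y → ∣ x ℤ.- y ∣ ≤ B → μ ⊢ op sub e f ⇓ x ℤ.- y
  ⇓-sub p q le = ⇓-op sub p q (fit-just le)

  ⇓-mul : ∀ {μ e f x y} → μ ⊢ e ⇓ x → μ ⊢ f ⇓ y → ∣ x ℤ.* y ∣ ≤ B → μ ⊢ op mul e f ⇓ x ℤ.* y
  ⇓-mul p q le = ⇓-op mul p q (fit-just le)

  ⇓-address : ∀ {μ e i} → μ ⊢ e ⇓ + i → evalAddress μ e ≡ just i
  ⇓-address {μ} {e} {i} (⇓ eq) = lemma
    where
    lemma : evalAddress μ e ≡ just i
    lemma rewrite eq = refl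

  ⇓-bounded : ∀ {μ e v} → Bounded B μ → μ ⊢ e ⇓ v → ∣ v ∣ ≤ B
  ⇓-bounded {μ} {e} bd (⇓ eq) = eval-bounded {μ} bd e eq

  exec-store : ∀ {μ a e f i v} → Bounded B μ → μ ⊢ e ⇓ + i → μ ⊢ f ⇓ v →
    Exec (store a e f) μ (1 + (size e + size f)) (_≡ ⟨ word μ [ a , i ↦ v ] , real μ ⟩)
  exec-store {μ} {a} {i = i} {v} bd p q = _ , _ , Semantics.store (⇓-address p) (value q) , ℕ.≤-refl ,
    update-bounded (word μ) a i v bd (⇓-bounded bd q) , refl

  exec-castᴿ : ∀ {μ a e f i v} → Bounded B μ → μ ⊢ e ⇓ + i → μ ⊢ f ⇓ v →
    Exec (castᴿ a e f) μ (1 + (size e + size f)) (_≡ ⟨ word μ , real μ [ a , i ↦ fromℚ (v / 1) ] ⟩)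
  exec-castᴿ bd p q = _ , _ , Semantics.castᴿ (⇓-address p) (value q) , ℕ.≤-refl , bd , refl

  exec-while-stop : ∀ {c μ e f x y} {R : Memory → Set} → Bounded B μ → μ ⊢ e ⇓ x → μ ⊢ f ⇓ y → y ℤ.< x → R μ →
    Exec (while e ≤ f loop c) μ (1 + (size e + size f)) R
  exec-while-stop {μ = μ} bd p q lt r = _ , μ , Semantics.while-stop (value p) (value q) lt , ℕ.≤-refl , bd , r

  exec-while-step : ∀ {c μ e f x y t s} {Q R : Memory → Set} → μ ⊢ e ⇓ x → μ ⊢ f ⇓ y → x ℤ.≤ y → Exec c μ t Q →
    (∀ μ′ → Bounded B μ′ → Q μ′ → Exec (while e ≤ f loop c) μ′ s R) →
    Exec (while e ≤ f loop c) μ ((1 + (size e + size f)) + (t + s)) R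
  exec-while-step {e = e} {f} p q le (k , μ₁ , run , k≤ , bd₁ , r) next
    with l , μ₂ , run′ , l≤ , bd₂ , r′ ← next μ₁ bd₁ r =
    _ , μ₂ , Semantics.while-step (value p) (value q) le run run′ ,
    ℕ.+-monoʳ-≤ (1 + (size e + size f)) (ℕ.+-mono-≤ k≤ l≤) , bd₂ , r′

-- Counted loops over registers, which are the first cells of one array

module Code (base : ℕ) where

  reg : ℕ → Exp
  reg r = load base (lit (+ r))

  set : ℕ → Exp → Cmd
  set r e = store base (lit (+ r)) e

  for : ℕ → ℕ → Cmd → Cmd
  for r b c = set r (lit 0ℤ) ⨾
    -- The only test is `≤`, so `r < b` is written as `1 + r ≤ b`.
    (while op add (lit 1ℤ) (reg r) ≤ reg b loop (c ⨾ set r (op add (reg r) (lit 1ℤ))))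

  fill : ℕ → Exp → Cmd
  fill a e = for 3 1 (store a (reg 3) e)

  fillᴿ : ℕ → Exp → Cmd
  fillᴿ a e = for 3 1 (castᴿ a (reg 3) e)

module Registers (B : ℕ) (base : ℕ) where

  open Machine B public
  open Code base public

  _[_:=_] : Memory → ℕ → ℤ → Memory
  μ [ r := v ] = ⟨ word μ [ base , r ↦ v ] , real μ ⟩

  ⇓-reg : ∀ {μ r v} → r ≤ B → word μ base r ≡ v → μ ⊢ reg r ⇓ v
  ⇓-reg r≤B refl = ⇓-load base (⇓-lit r≤B)

  exec-set : ∀ {μ r e v} → Bounded B μ → r ≤ B → μ ⊢ e ⇓ v →
    Exec (set r e) μ (2 + size e) (_≡ μ [ r := v ])
  exec-set bd r≤B eq = exec-store bd (⇓-lit r≤B) eq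

  module _ {r b N T : ℕ} {c : Cmd} (r≤B : r ≤ B) (b≤B : b ≤ B) (N<B : suc N ≤ B)
           (Inv : ℕ → Memory → Set)
           (stable : ∀ {t μ v} → Inv t μ → Inv t (μ [ r := v ]))
           (bound : ∀ {t μ} → Inv t μ → word μ base b ≡ + N)
           (body : ∀ {t μ} → t < N → Bounded B μ → Inv t μ → word μ base r ≡ + t →
                   Exec c μ T (λ μ′ → Inv (suc t) μ′ × word μ′ base r ≡ + t)) where

    private
      1≤B : 1 ≤ B
      1≤B = ℕ.≤-trans (s≤s z≤n) N<B

      advance : ∀ {t μ} → t < N → Bounded B μ → Inv t μ → word μ base r ≡ + t →
        Exec (c ⨾ set r (op add (reg r) (lit 1ℤ))) μ (T + 6)
          (λ μ′ → Inv (suc t) μ′ × word μ′ base r ≡ + suc t)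
      advance {t} t<N bd inv at = exec-seq (body t<N bd inv at) λ μ′ bd′ (inv′ , at′) →
        exec-weaken {t = 6} ℕ.≤-refl
          (λ { refl → stable inv′ , update-same (word μ′) base r })
          (exec-set bd′ r≤B (⇓-op add (⇓-reg {μ′} r≤B at′) (⇓-lit 1≤B)
            (trans (cong (λ x → fit (+ x)) (ℕ.+-comm t 1)) (fit-just (ℕ.≤-trans t<N (ℕ.<⇒≤ N<B))))))

      loop-correct : ∀ m {t μ} → t + m ≡ N → Bounded B μ → Inv t μ → word μ base r ≡ + t →
        Exec (while op add (lit 1ℤ) (reg r) ≤ reg b loop (c ⨾ set r (op add (reg r) (lit 1ℤ)))) μ
          (7 + m * (13 + T)) (Inv N)
      loop-correct m {t} {μ} eq bd inv at
        with test ← ⇓-add (⇓-lit {μ} {1ℤ} 1≤B) (⇓-reg r≤B at)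
                      ((ℕ.≤-trans (s≤s (ℕ.≤-trans (ℕ.m≤m+n t m) (ℕ.≤-reflexive eq))) N<B))
        with m
      ... | zero = _ , μ , Semantics.while-stop (value test) (value (⇓-reg {μ} b≤B (bound inv)))
                     (ℤ.+<+ (s≤s (ℕ.≤-reflexive (trans (sym eq) (ℕ.+-identityʳ t))))) ,
                   ℕ.≤-refl , bd , subst (λ t → Inv t μ) (trans (sym (ℕ.+-identityʳ t)) eq) inv
      ... | suc m
        with t<N ← subst (suc t ≤_) eq (ℕ.≤-trans (s≤s (ℕ.m≤m+n t m)) (ℕ.≤-reflexive (sym (ℕ.+-suc t m))))
        with k , μ₁ , run , k≤ , bd₁ , inv₁ , at₁ ← advance t<N bd inv at
        with l , μ₂ , run′ , l≤ , bd₂ , inv₂ ← loop-correct m (trans (sym (ℕ.+-suc t m)) eq) bd₁ inv₁ at₁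
        = _ , μ₂ , Semantics.while-step (value test) (value (⇓-reg {μ} b≤B (bound inv))) (+≤+ t<N) run run′ ,
          ℕ.+-monoʳ-≤ 7 (ℕ.≤-trans (ℕ.+-mono-≤ k≤ l≤) (ℕ.≤-reflexive (cost T (m * (13 + T))))) , bd₂ , inv₂
        where
        cost : ∀ t y → (t + 6) + (7 + y) ≡ (13 + t) + y
        cost = ℕ-solve-∀

    -- Setting the counter costs 3, each of the `N + 1` tests 7, and each increment 6.
    exec-for : ∀ {μ} → Bounded B μ → Inv 0 μ → Exec (for r b c) μ (10 + N * (13 + T)) (Inv N)
    exec-for {μ} bd inv = exec-seq {t = 3} {s = 7 + N * (13 + T)} (exec-set {μ} bd r≤B (⇓-lit z≤n))
      λ { μ′ bd′ refl → loop-correct N refl bd′ (stable inv) (update-same (word μ) base r) }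

-- Loops over the entries of a matrix

index-injective : ∀ {n} (i j k l : Fin n) → index i j ≡ index k l → i ≡ k × j ≡ l
index-injective {n} i j k l eq = Fin.combine-injective i j k l (Fin.toℕ-injective
  (trans (toℕ-index i j) (trans eq (sym (toℕ-index k l)))))
  where
  toℕ-index : ∀ (i j : Fin n) → toℕ (combine i j) ≡ index i j
  toℕ-index i j = trans (Fin.toℕ-combine i j) (cong (λ x → x + toℕ j) (ℕ.*-comm n (toℕ i)))

index-surjective : ∀ {n t} → t < n * n → ∃[ i ] ∃[ j ] index {n} i j ≡ t
index-surjective {n} {t} t<
  with i , j , eq ← Fin.combine-surjective {n} {n} (fromℕ< t<) =
  i , j , trans (cong (λ x → x + toℕ j) (ℕ.*-comm (toℕ i) n))
            (trans (sym (Fin.toℕ-combine i j)) (trans (cong toℕ eq) (Fin.toℕ-fromℕ< t<)))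

index-< : ∀ {n} (i j : Fin n) → index i j < n * n
index-< {n} i j = subst (_< n * n)
  (trans (Fin.toℕ-combine i j) (cong (λ x → x + toℕ j) (ℕ.*-comm n (toℕ i))))
  (Fin.toℕ<n (combine i j))

module Filling (B base n : ℕ) (n²<B : suc (n * n) ≤ B) (16≤B : 16 ≤ B) where

  open Registers B base public

  -- Register 0 holds n, register 1 holds n * n, and register 3 is the loop
  -- counter.
  Outside : ℕ → ℕ → Set
  Outside b x = b ≢ base ⊎ x ≢ 3

  small-reg : ∀ {r} → r ≤ 16 → r ≤ B
  small-reg le = ℕ.≤-trans le 16≤B

  outside? : ∀ {b x v μ} → Outside b x → word (μ [ 3 := v ]) b x ≡ word μ b x
  outside? {μ = μ} out = update-other (word μ) base 3 out

  module _ {a : ℕ} {e : Exp} (v : Matrix ℤ n) {μ₀ : Memory} (bd₀ : Bounded B μ₀) (n² : word μ₀ base 1 ≡ + (n * n)) where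

    -- The premise lets `e` read `a` itself: its cells from the current index on still have their
    -- old contents. This permits updates in place.
    exec-fill : a ≢ base →
      (∀ i j μ → word μ base 3 ≡ + index i j →
        (∀ b x → Outside b x → b ≢ a ⊎ index i j ≤ x → word μ b x ≡ word μ₀ b x) → μ ⊢ e ⇓ v i j) →
      Exec (fill a e) μ₀ (10 + n * n * (13 + (3 + size e))) (λ μ →
        (∀ i j → word μ a (index i j) ≡ v i j) ×
        (∀ b x → Outside b x → b ≢ a → word μ b x ≡ word μ₀ b x))
    exec-fill a≢base ev = exec-weaken ℕ.≤-refl
      (λ (done , same) → (λ i j → done i j (index-< i j)) , λ b x out b≢a → same b x out (inj₁ b≢a))
      (exec-for {r = 3} {1} {n * n} (small-reg (ℕ.m≤m+n 3 13)) (small-reg (ℕ.m≤m+n 1 15)) n²<B Inv (λ {t} {μ} → stable {t} {μ})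
        (λ (_ , same) → trans (same base 1 (inj₂ λ ()) (inj₁ (a≢base ∘ sym))) n²) body bd₀ ((λ _ _ ()) , λ _ _ _ _ → refl))
      where
      Inv : ℕ → Memory → Set
      Inv t μ = (∀ i j → index i j < t → word μ a (index i j) ≡ v i j) ×
                (∀ b x → Outside b x → b ≢ a ⊎ t ≤ x → word μ b x ≡ word μ₀ b x)

      stable : ∀ {t μ w} → Inv t μ → Inv t (μ [ 3 := w ])
      stable {μ = μ} (done , same) =
        (λ i j lt → trans (outside? {μ = μ} (inj₁ a≢base)) (done i j lt)) ,
        λ b x out or → trans (outside? {μ = μ} out) (same b x out or)

      body : ∀ {t μ} → t < n * n → Bounded B μ → Inv t μ → word μ base 3 ≡ + t →
        Exec (store a (reg 3) e) μ (3 + size e) (λ μ′ → Inv (suc t) μ′ × word μ′ base 3 ≡ + t)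
      body {μ = μ} t< bd (done , same) at with i , j , refl ← index-surjective {n} t< =
        exec-weaken ℕ.≤-refl (λ { refl → (done′ , same′) ,
            trans (update-other (word μ) a t (inj₁ (a≢base ∘ sym))) at })
          (exec-store bd (⇓-reg {μ} (small-reg (ℕ.m≤m+n 3 13)) at) (ev i j μ at same))
        where
        t = index i j

        done′ : ∀ k l → index k l < suc t → (word μ [ a , t ↦ v i j ]) a (index k l) ≡ v k l
        done′ k l lt with index k l ℕ.≟ t
        ... | yes eq with refl , refl ← index-injective k l i j eq = update-same (word μ) a t
        ... | no  ne = trans (update-other (word μ) a t (inj₂ ne))
                         (done k l (ℕ.≤∧≢⇒< (ℕ.≤-pred lt) ne))

        same′ : ∀ b x → Outside b x → b ≢ a ⊎ suc t ≤ x → (word μ [ a , t ↦ v i j ]) b x ≡ word μ₀ b x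
        same′ b x out (inj₁ b≢a) = trans (update-other (word μ) a t (inj₁ b≢a)) (same b x out (inj₁ b≢a))
        same′ b x out (inj₂ t<x) = trans (update-other (word μ) a t (inj₂ (ℕ.>⇒≢ t<x)))
                                 (same b x out (inj₂ (ℕ.<⇒≤ t<x)))

    exec-fillᴿ :
      (∀ i j μ → word μ base 3 ≡ + index i j →
        (∀ b x → Outside b x → word μ b x ≡ word μ₀ b x) → μ ⊢ e ⇓ v i j) →
      Exec (fillᴿ a e) μ₀ (10 + n * n * (13 + (3 + size e))) (λ μ →
        (∀ i j → real μ a (index i j) ≡ fromℚ (v i j / 1)) ×
        (∀ b x → Outside b x → word μ b x ≡ word μ₀ b x) ×
        (∀ b x → b ≢ a → real μ b x ≡ real μ₀ b x))
    exec-fillᴿ ev = exec-weaken ℕ.≤-refl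
      (λ (done , same) → (λ i j → done i j (index-< i j)) , same)
      (exec-for {r = 3} {1} {n * n} (small-reg (ℕ.m≤m+n 3 13)) (small-reg (ℕ.m≤m+n 1 15)) n²<B Inv (λ {t} {μ} → stable {t} {μ})
        (λ (_ , same , _) → trans (same base 1 (inj₂ λ ())) n²) body bd₀ ((λ _ _ ()) , (λ _ _ _ → refl) , λ _ _ _ → refl))
      where
      Inv : ℕ → Memory → Set
      Inv t μ = (∀ i j → index i j < t → real μ a (index i j) ≡ fromℚ (v i j / 1)) ×
                (∀ b x → Outside b x → word μ b x ≡ word μ₀ b x) ×
                (∀ b x → b ≢ a → real μ b x ≡ real μ₀ b x)

      stable : ∀ {t μ w} → Inv t μ → Inv t (μ [ 3 := w ])
      stable {μ = μ} (done , same , sameᴿ) = done , (λ b x out → trans (outside? {μ = μ} out) (same b x out)) , sameᴿ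

      body : ∀ {t μ} → t < n * n → Bounded B μ → Inv t μ → word μ base 3 ≡ + t →
        Exec (castᴿ a (reg 3) e) μ (3 + size e) (λ μ′ → Inv (suc t) μ′ × word μ′ base 3 ≡ + t)
      body {μ = μ} t< bd (done , same , sameᴿ) at with i , j , refl ← index-surjective {n} t< =
        exec-weaken ℕ.≤-refl (λ { refl → (done′ , same , same′) , at })
          (exec-castᴿ bd (⇓-reg {μ} (small-reg (ℕ.m≤m+n 3 13)) at) (ev i j μ at same))
        where
        t = index i j

        done′ : ∀ k l → index k l < suc t →
          (real μ [ a , t ↦ fromℚ (v i j / 1) ]) a (index k l) ≡ fromℚ (v k l / 1)
        done′ k l lt with index k l ℕ.≟ t
        ... | yes eq with refl , refl ← index-injective k l i j eq = update-same (real μ) a t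
        ... | no  ne = trans (update-other (real μ) a t (inj₂ ne))
                         (done k l (ℕ.≤∧≢⇒< (ℕ.≤-pred lt) ne))

        same′ : ∀ b x → b ≢ a → (real μ [ a , t ↦ fromℚ (v i j / 1) ]) b x ≡ real μ₀ b x
        same′ b x b≢a = trans (update-other (real μ) a t (inj₁ b≢a)) (sameᴿ b x b≢a)

-- Arithmetic on encoded matrices

-- Covers all linear demands on the word size, such as `2n + 1` for the stacks and `16n + 17` for
-- refinement.
linear≤capacity : ∀ {n B m} → 32 * (2 + n) ≤ B → ∀ k c → k ≤ 32 → c ≤ 32 → m ≤ k * n + c → m ≤ B
linear≤capacity {n} capacity k c k≤ c≤ le = ℕ.≤-trans le (ℕ.≤-trans
  (ℕ.+-mono-≤ (ℕ.*-monoˡ-≤ n k≤) c≤)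
  (ℕ.≤-trans (ℕ.≤-trans (ℕ.+-monoʳ-≤ (32 * n) (ℕ.m≤m+n 32 32)) (ℕ.≤-reflexive (eq n))) capacity))
  where
  eq : ∀ n → 32 * n + 64 ≡ 32 * (2 + n)
  eq = ℕ-solve-∀

suc-double : ∀ n → suc (n + n) ≡ 2 * n + 1
suc-double = ℕ-solve-∀

bits : ∀ {n} → Matrix Bool n → Matrix ℤ n
bits A i j = bit (A i j)

/-unique : ∀ r q d .{{_ : ℕ.NonZero d}} → r < d → (r + q * d) ℕ./ d ≡ q
/-unique r q d r<d = trans (ℕ.+-distrib-/-∣ʳ r (divides-refl q))
  (cong₂ _+_ (ℕ.m<n⇒m/n≡0 r<d) (ℕ.m*n/n≡m q d))

+/+ : ∀ m n → (+ m) ℤ./ (+ suc n) ≡ + (m ℕ./ suc n)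
+/+ m n = ℤ.*-identityˡ (+ (m ℕ./ suc n))

count : ∀ {n} → (Fin n → Bool) → ℕ
count {zero}  f = 0
count {suc n} f = (if f zero then 1 else 0) + count (f ∘ suc)

sum≡count : ∀ {n} (f g : Fin n → Bool) →
  sum ℤ.+-0-rawMonoid {n} (λ k → bit (f k) ℤ.* bit (g k)) ≡ + count (λ k → f k ∧ g k)
sum≡count {zero}  f g = refl
sum≡count {suc n} f g = trans
  (cong (λ z → (bit (f zero) ℤ.* bit (g zero)) ℤ.+ z) (sum≡count (f ∘ suc) (g ∘ suc)))
  (head (f zero) (g zero))
  where
  head : ∀ a b → (bit a ℤ.* bit b) ℤ.+ (+ count (λ k → f (suc k) ∧ g (suc k))) ≡
                 + ((if a ∧ b then 1 else 0) + count (λ k → f (suc k) ∧ g (suc k)))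
  head true  true  = refl
  head true  false = refl
  head false true  = refl
  head false false = refl

count≤n : ∀ {n} (f : Fin n → Bool) → count f ≤ n
count≤n {zero}  f = z≤n
count≤n {suc n} f with f zero
... | true  = s≤s (count≤n (f ∘ suc))
... | false = ℕ.m≤n⇒m≤1+n (count≤n (f ∘ suc))

count-some : ∀ {n} (f : Fin n → Bool) →
  (some f ≡ false × count f ≡ 0) ⊎ (some f ≡ true × ∃[ c ] count f ≡ suc c)
count-some {zero}  f = inj₁ (refl , refl)
count-some {suc n} f with f zero
... | true  = inj₂ (refl , _ , refl)
... | false = count-some (f ∘ suc)

-- For 0 ≤ c ≤ n the quotient of c + n by n + 1 is 0 or 1 according to whether
-- c is zero.
threshold : ∀ {n} (f : Fin n → Bool) → (+ (count f + n)) ℤ./ (+ suc n) ≡ bit (some f)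
threshold {n} f with count-some f
... | inj₁ (eq , c≡0) rewrite eq | c≡0 = trans (+/+ n n) (cong +_ (ℕ.m<n⇒m/n≡0 (ℕ.n<1+n n)))
... | inj₂ (eq , c , c≡) rewrite eq | c≡ = trans (+/+ (suc c + n) n) (cong +_ quotient)
  where
  quotient : (suc c + n) ℕ./ suc n ≡ 1
  quotient = trans (ℕ./-congˡ {o = suc n} (trans (sym (ℕ.+-suc c n)) (cong (λ y → c + y) (sym (ℕ.*-identityˡ (suc n))))))
    (/-unique c 1 (suc n) (s≤s (ℕ.≤-trans (ℕ.n≤1+n c) (subst (_≤ n) c≡ (count≤n f)))))

bit≡ : ∀ b → bit b ≡ + (if b then 1 else 0)
bit≡ true  = refl
bit≡ false = refl

bit< : ∀ b → (if b then 1 else 0) < 2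
bit< true  = s≤s (s≤s z≤n)
bit< false = s≤s z≤n

-- A stack of bits, the latest one being the least significant.
stack : (ℕ → Bool) → ℕ → ℕ
stack f zero    = 0
stack f (suc t) = (if f t then 1 else 0) + stack f t * 2

stack< : ∀ f t → stack f t < 2 ^ t
stack< f zero    = s≤s z≤n
stack< f (suc t) = begin-strict
  (if f t then 1 else 0) + stack f t * 2 <⟨ ℕ.+-monoˡ-< (stack f t * 2) (bit< (f t)) ⟩
  2 + stack f t * 2                      ≡⟨⟩
  suc (stack f t) * 2                    ≤⟨ ℕ.*-monoˡ-≤ 2 (stack< f t) ⟩
  2 ^ t * 2                              ≡⟨ ℕ.*-comm (2 ^ t) 2 ⟩
  2 * 2 ^ t                              ∎
  where open ℕ.≤-Reasoning

stack/2 : ∀ f t → (+ stack f (suc t)) ℤ./ (+ 2) ≡ + stack f t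
stack/2 f t = trans (+/+ (stack f (suc t)) 1) (cong +_ (/-unique (if f t then 1 else 0) (stack f t) 2 (bit< (f t))))

stack-parity : ∀ f t → (+ stack f (suc t)) ℤ.- (+ 2) ℤ.* (+ stack f t) ≡ bit (f t)
stack-parity f t = trans (cong (λ z → (+ (b + s * 2)) ℤ.- z) (sym (ℤ.pos-* 2 s)))
  (trans (cong₂ (λ y z → y ℤ.- z) (ℤ.pos-+ b (s * 2)) (cong +_ (ℕ.*-comm 2 s)))
    (trans (cancel (+ b) (+ (s * 2))) (sym (bit≡ (f t)))))
  where
  b = if f t then 1 else 0
  s = stack f t

  cancel : ∀ x y → (x ℤ.+ y) ℤ.- y ≡ x
  cancel = solve-∀

stack-push : ∀ f t → ((+ stack f t) ℤ.+ (+ stack f t)) ℤ.+ bit (f t) ≡ + stack f (suc t)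
stack-push f t rewrite bit≡ (f t) = cong +_ (double (stack f t) (if f t then 1 else 0))
  where
  double : ∀ s b → (s + s) + b ≡ b + s * 2
  double = ℕ-solve-∀

-- Instructions

module Instructions (mm tmm : Cmd) (base : ℕ) where

  open Code base public

  arr : ℕ → ℕ
  arr a = base + suc a

  entry : ℕ → Exp
  entry a = load (arr a) (reg 3)

  -- `mulC` rewrites the size in cell 0 of array 0, as an earlier call may have destroyed it. The
  -- integer product counts intermediate vertices, and the final quotient tests whether there are
  -- any.
  orC andC mulC : ℕ → ℕ → ℕ → Cmd
  orC d a b  = fill (arr d) (op sub (op add (entry a) (entry b)) (op mul (entry a) (entry b)))
  andC d a b = fill (arr d) (op mul (entry a) (entry b))
  mulC d a b =
    store 0 (lit 0ℤ) (reg 0) ⨾ (fill 1 (entry a) ⨾ (fill 2 (entry b) ⨾ (mm ⨾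
    fill (arr d) (op div (op add (load 3 (reg 3)) (reg 0)) (op add (lit 1ℤ) (reg 0))))))

  closeC : ℕ → ℕ → Cmd
  closeC one a = orC a a one ⨾ for 4 2 (mulC a a a)

  clearC : ℕ → Cmd
  clearC s = fill (arr s) (lit 0ℤ)

  pushC popC refineC : ℕ → ℕ → Cmd
  pushC s b = fill (arr s) (op add (op add (entry s) (entry s)) (entry b))
  popC s b =
    fill (arr b) (op sub (entry s) (op mul (lit (+ 2)) (op div (entry s) (lit (+ 2))))) ⨾
    fill (arr s) (op div (entry s) (lit (+ 2)))
  refineC x b = fill (arr x) (op sub (op add (entry x) (entry x)) (entry b))

  startC : ℕ → ℕ → ℕ → ℕ → Cmd
  startC x r o q = fill (arr x) (op sub (op sub (op sub (lit (+ 2)) (entry r)) (entry o)) (entry q))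

  -- For a bit `a`, the factor `1 - 2a` is the sign of the barrier, whose height is `8 (1 + n)`.
  barrierE : ℕ → Exp
  barrierE a = op mul (op sub (lit 1ℤ) (op add (entry a) (entry a)))
                      (op mul (lit (+ 8)) (op add (lit 1ℤ) (reg 0)))

  targetC : ℕ → ℕ → ℕ → ℤ → Cmd
  targetC d x a o =
    store 0 (lit 0ℤ) (reg 0) ⨾ (fillᴿ 0 (entry x) ⨾ (fillᴿ 1 (barrierE a) ⨾
    (fillᴿ 2 (op sub (entry x) (lit o)) ⨾ (tmm ⨾
    fill (arr d) (load 1 (reg 3))))))

State : ℕ → Set
State n = ℕ → Matrix ℤ n

assign : ∀ {n} → State n → ℕ → Matrix ℤ n → State n
assign σ d v a = if d ≡ᵇ a then v else σ a

-- What `Solves` provides once the size and a sufficient word bound are fixed.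
Correct : Cmd → Problem → (n B t : ℕ) → Set
Correct p P n B t = ∀ (x : Input n) μ → Bounded B μ → word μ 0 0 ≡ + n → StoresIn μ x →
  ∃[ k ] ∃[ μ′ ] Run B p μ k μ′ × k ≤ t × Σ[ y ∈ Output n ] StoresOut μ′ y × Solution x y
  where open Problem P

-- Up to constant factors, U bounds the cost of one pass over a matrix and of one call
-- of mm or tmm, and V that of any instruction; closeC makes Λ ≈ log n calls.
module Execution
  (mm tmm : Cmd) (base n B fₙ Tₙ ℓ Λ U V : ℕ)
  (5≤base : 5 ≤ base) (mm-writes : writes mm ≤ base) (tmm-writes : writes tmm ≤ base)
  (n²<B : suc (n * n) ≤ B) (capacity : 32 * (2 + n) ≤ B)
  (n<2^ℓ : n < 2 ^ ℓ) (2^ℓ≤ : 2 ^ ℓ ≤ suc (n + n)) (ℓ≤Λ : ℓ ≤ Λ) (1≤Λ : 1 ≤ Λ)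
  (≤U : 1 + n * n + (fₙ + Tₙ) ≤ U) (≤V : 1000 * (Λ * U) ≤ V)
  (mm-correct : Correct mm (MatMul 0) n B fₙ) (tmm-correct : Correct tmm TargetMinMax n B Tₙ)
  where

  16≤B : 16 ≤ B
  16≤B = ℕ.≤-trans (ℕ.≤-trans (ℕ.m≤m+n 16 48) (ℕ.*-monoʳ-≤ 32 (ℕ.m≤m+n 2 n))) capacity

  open Instructions mm tmm base public
  open Filling B base n n²<B 16≤B public hiding (reg; set; for; fill; fillᴿ)
  open Refinement ℓ n<2^ℓ public
  open Targets ℓ n<2^ℓ public

  small-literal : ∀ {m} → m ≤ 16 → m ≤ B
  small-literal le = ℕ.≤-trans le 16≤B

  small-linear : ∀ {m} k c → k ≤ 32 → c ≤ 32 → m ≤ k * n + c → m ≤ B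
  small-linear = linear≤capacity capacity

  arr≢base : ∀ a → arr a ≢ base
  arr≢base a eq = ℕ.m+1+n≢m base eq

  arr-injective : ∀ {a b} → arr a ≡ arr b → a ≡ b
  arr-injective eq = ℕ.suc-injective (ℕ.+-cancelˡ-≡ base _ _ eq)

  base≤arr : ∀ a → base ≤ arr a
  base≤arr a = ℕ.m≤m+n base (suc a)

  record Rep (σ : State n) (μ : Memory) : Set where
    field
      reg-n  : word μ base 0 ≡ + n
      reg-n² : word μ base 1 ≡ + (n * n)
      reg-ℓ  : word μ base 2 ≡ + ℓ
      entries : ∀ a i j → word μ (arr a) (index i j) ≡ σ a i j

  open Rep public

  Private : Memory → Memory → Set
  Private μ μ′ = ∀ b x → base ≤ b → Outside b x → word μ′ b x ≡ word μ b x

  rep-private : ∀ {σ μ μ′} → Private μ μ′ → Rep σ μ → Rep σ μ′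
  rep-private same rep = record
    { reg-n   = trans (same base 0 ℕ.≤-refl (inj₂ λ ())) (reg-n rep)
    ; reg-n²  = trans (same base 1 ℕ.≤-refl (inj₂ λ ())) (reg-n² rep)
    ; reg-ℓ   = trans (same base 2 ℕ.≤-refl (inj₂ λ ())) (reg-ℓ rep)
    ; entries = λ a i j → trans (same (arr a) _ (base≤arr a) (inj₁ (arr≢base a))) (entries rep a i j)
    }

  assign-entries : ∀ {σ : State n} {d v} a (w : Matrix ℤ n) →
    (∀ i j → d ≡ a → w i j ≡ v i j) → (∀ i j → d ≢ a → w i j ≡ σ a i j) →
    ∀ i j → w i j ≡ assign σ d v a i j
  assign-entries {σ} {d} {v} a w new old i j = cases (d ≡ᵇ a) refl
    where
    cases : ∀ b → (d ≡ᵇ a) ≡ b → w i j ≡ (if b then v else σ a) i j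
    cases true  eq = new i j (ℕ.≡ᵇ⇒≡ d a (subst T (sym eq) tt))
    cases false eq = old i j λ d≡a → subst T eq (ℕ.≡⇒≡ᵇ d a d≡a)

  rep-assign : ∀ {σ μ μ′ d v} → (∀ b x → base ≤ b → Outside b x → b ≢ arr d → word μ′ b x ≡ word μ b x) →
    (∀ i j → word μ′ (arr d) (index i j) ≡ v i j) → Rep σ μ → Rep (assign σ d v) μ′
  rep-assign {σ} {d = d} same done rep = record
    { reg-n   = trans (same base 0 ℕ.≤-refl (inj₂ λ ()) (arr≢base d ∘ sym)) (reg-n rep)
    ; reg-n²  = trans (same base 1 ℕ.≤-refl (inj₂ λ ()) (arr≢base d ∘ sym)) (reg-n² rep)
    ; reg-ℓ   = trans (same base 2 ℕ.≤-refl (inj₂ λ ()) (arr≢base d ∘ sym)) (reg-ℓ rep)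
    ; entries = λ a → assign-entries {σ} a _
        (λ { i j refl → done i j })
        (λ i j d≢a → trans (same (arr a) _ (base≤arr a) (inj₁ (arr≢base a)) (λ eq → d≢a (sym (arr-injective eq))))
                        (entries rep a i j))
    }

  -- Registers from 4 on are counters of enclosing loops; depth d says that the
  -- first d of them may be overwritten.
  Result : ℕ → State n → Memory → Memory → Set
  Result d σ μ μ′ = Rep σ μ′ × (∀ r → 4 + d ≤ r → word μ′ base r ≡ word μ base r)

  Impl : ℕ → ℕ → Cmd → State n → State n → Set
  Impl d t c σ σ′ = ∀ {μ} → Bounded B μ → Rep σ μ → Exec c μ t (Result d σ′ μ)

  counter≢3 : ∀ {d r} → 4 + d ≤ r → r ≢ 3
  counter≢3 {d} le = ℕ.>⇒≢ (ℕ.≤-trans (ℕ.m≤m+n 4 d) le)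

  deepen : ∀ {d σ μ μ′} → Result 0 σ μ μ′ → Result d σ μ μ′
  deepen {d} (rep , same) = rep , λ r le → same r (ℕ.≤-trans (ℕ.m≤m+n 4 d) le)

  infixr 5 _then_

  _then_ : ∀ {δ t s c d σ σ′ σ″} → Impl δ t c σ σ′ → Impl δ s d σ′ σ″ → Impl δ (t + s) (c ⨾ d) σ σ″
  _then_ f g {μ} bd rep = exec-seq (f bd rep) λ μ′ bd′ (rep′ , same) →
    exec-weaken ℕ.≤-refl (λ (rep″ , same′) → rep″ , λ r le → trans (same′ r le) (same r le)) (g bd′ rep′)

  record Env (σ : State n) (i j : Fin n) (μ₀ μ : Memory) : Set where
    field
      ⇓-entry : ∀ a → μ ⊢ entry a ⇓ σ a i j
      ⇓-n     : μ ⊢ reg 0 ⇓ + n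
      ⇓-low   : ∀ {b} → b < base → μ ⊢ load b (reg 3) ⇓ word μ₀ b (index i j)

  open Env public

  -- Here 66 is `13 + 3 + 50`: loop overhead, the store, and a generous bound on the size of any
  -- expression filled in.
  fill-cost : ∀ {s} → s ≤ 50 → 10 + n * n * (13 + (3 + s)) ≤ 66 * U
  fill-cost {s} s≤ = ℕ.≤-trans (ℕ.+-mono-≤ (ℕ.m≤m+n 10 56) (ℕ.*-monoʳ-≤ (n * n) (ℕ.+-monoʳ-≤ 16 s≤)))
    (ℕ.≤-trans (ℕ.≤-reflexive (eq (n * n))) (ℕ.*-monoʳ-≤ 66 (ℕ.≤-trans (ℕ.m≤m+n (1 + n * n) (fₙ + Tₙ)) ≤U)))
    where
    eq : ∀ m → 66 + m * 66 ≡ 66 * (1 + m)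
    eq = ℕ-solve-∀

  env : ∀ {σ μ₀ μ i j} → Rep σ μ₀ → word μ base 3 ≡ + index i j →
    (∀ b x → base ≤ b → x ≡ index i j ⊎ b ≡ base → Outside b x → word μ b x ≡ word μ₀ b x) →
    (∀ b x → b < base → x ≡ index i j → word μ b x ≡ word μ₀ b x) → Env σ i j μ₀ μ
  env {σ} {μ₀} {μ} {i} {j} rep at same low = record
    { ⇓-entry = λ a → subst (μ ⊢ entry a ⇓_)
        (trans (same (arr a) _ (base≤arr a) (inj₁ refl) (inj₁ (arr≢base a))) (entries rep a i j))
        (⇓-load (arr a) idx)
    ; ⇓-n = ⇓-reg (small-literal z≤n) (trans (same base 0 ℕ.≤-refl (inj₂ refl) (inj₂ λ ())) (reg-n rep))
    ; ⇓-low = λ {b} b< → subst (μ ⊢ load b (reg 3) ⇓_) (low b _ b< refl) (⇓-load b idx)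
    }
    where
    idx : μ ⊢ reg 3 ⇓ + index i j
    idx = ⇓-reg (small-literal (ℕ.m≤m+n 3 13)) at

  low≢base : ∀ {a} → a < base → a ≢ base
  low≢base lt = ℕ.<⇒≢ lt

  exec-fill-keep : ∀ {σ μ₀} d {e} (v : Matrix ℤ n) → size e ≤ 50 → Bounded B μ₀ → Rep σ μ₀ →
    (∀ i j {μ} → Env σ i j μ₀ μ → μ ⊢ e ⇓ v i j) →
    Exec (fill (arr d) e) μ₀ (66 * U) (λ μ → Result 0 (assign σ d v) μ₀ μ ×
      (∀ b x → b < base → word μ b x ≡ word μ₀ b x))
  exec-fill-keep {σ} {μ₀} d v size≤ bd rep ev = exec-weaken (fill-cost size≤)
    (λ (done , same) →
      (rep-assign (λ b x _ → same b x) done rep , λ r le → same base r (inj₂ (counter≢3 {0} le)) (arr≢base d ∘ sym)) ,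
      λ b x b< → same b x (inj₁ (low≢base b<)) (ℕ.<⇒≢ (ℕ.<-≤-trans b< (base≤arr d))))
    (exec-fill v bd (reg-n² rep) (arr≢base d) λ i j μ at same → ev i j (env rep at
      (λ { b x _ (inj₁ refl) out → same b x out (inj₂ ℕ.≤-refl)
         ; b x _ (inj₂ refl) out → same b x out (inj₁ (arr≢base d ∘ sym)) })
      (λ { b x b< refl → same b x (inj₁ (low≢base b<)) (inj₂ ℕ.≤-refl) })))

  exec-fill-private : ∀ {σ μ₀} d {e} (v : Matrix ℤ n) → size e ≤ 50 → Bounded B μ₀ → Rep σ μ₀ →
    (∀ i j {μ} → Env σ i j μ₀ μ → μ ⊢ e ⇓ v i j) →
    Exec (fill (arr d) e) μ₀ (66 * U) (Result 0 (assign σ d v) μ₀)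
  exec-fill-private d v size≤ bd rep ev = exec-weaken ℕ.≤-refl proj₁ (exec-fill-keep d v size≤ bd rep ev)

  exec-fill-low : ∀ {σ μ₀} a {e} (v : Matrix ℤ n) → a < base → size e ≤ 50 → Bounded B μ₀ → Rep σ μ₀ →
    (∀ i j {μ} → Env σ i j μ₀ μ → μ ⊢ e ⇓ v i j) →
    Exec (fill a e) μ₀ (66 * U) (λ μ → (∀ i j → word μ a (index i j) ≡ v i j) × Result 0 σ μ₀ μ ×
      (∀ b x → b < base → b ≢ a → word μ b x ≡ word μ₀ b x))
  exec-fill-low {σ} {μ₀} a v a<base size≤ bd rep ev = exec-weaken (fill-cost size≤)
    (λ (done , same) → done ,
      (rep-private (λ b x ≤b out → same b x out (ℕ.>⇒≢ (ℕ.<-≤-trans a<base ≤b))) rep ,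
       λ r le → same base r (inj₂ (counter≢3 {0} le)) (low≢base a<base ∘ sym)) ,
      λ b x b< b≢a → same b x (inj₁ (low≢base b<)) b≢a)
    (exec-fill v bd (reg-n² rep) (low≢base a<base) λ i j μ at same → ev i j (env rep at
      (λ { b x _ (inj₁ refl) out → same b x out (inj₂ ℕ.≤-refl)
         ; b x _ (inj₂ refl) out → same b x out (inj₁ (low≢base a<base ∘ sym)) })
      (λ { b x b< refl → same b x (inj₁ (low≢base b<)) (inj₂ ℕ.≤-refl) })))

  exec-fillᴿ-low : ∀ {σ μ₀} a {e} (v : Matrix ℤ n) → size e ≤ 50 → Bounded B μ₀ → Rep σ μ₀ →
    (∀ i j {μ} → Env σ i j μ₀ μ → μ ⊢ e ⇓ v i j) →
    Exec (fillᴿ a e) μ₀ (66 * U) (λ μ → (∀ i j → real μ a (index i j) ≡ fromℤ (v i j)) × Result 0 σ μ₀ μ ×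
      (∀ b x → b < base → word μ b x ≡ word μ₀ b x) × (∀ b x → b ≢ a → real μ b x ≡ real μ₀ b x))
  exec-fillᴿ-low {σ} {μ₀} a v size≤ bd rep ev = exec-weaken (fill-cost size≤)
    (λ (done , same , sameᴿ) → done ,
      (rep-private (λ b x _ out → same b x out) rep , λ r le → same base r (inj₂ (counter≢3 {0} le))) ,
      (λ b x b< → same b x (inj₁ (low≢base b<))) , sameᴿ)
    (exec-fillᴿ v bd (reg-n² rep) λ i j μ at same → ev i j (env rep at
      (λ b x _ _ out → same b x out) (λ b x b< _ → same b x (inj₁ (low≢base b<)))))

  impl-fill : ∀ {δ σ} d {e} (v : Matrix ℤ n) → size e ≤ 50 →
    (∀ i j {μ₀ μ} → Env σ i j μ₀ μ → μ ⊢ e ⇓ v i j) → Impl δ (66 * U) (fill (arr d) e) σ (assign σ d v)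
  impl-fill {δ} d v size≤ ev {μ} bd rep = exec-weaken ℕ.≤-refl (λ {μ′} → deepen {δ} {μ = μ} {μ′}) (exec-fill-private d v size≤ bd rep (λ i j → ev i j))

  ⇓-bits : ∀ {σ i j μ₀ μ} {A : Matrix Bool n} a → σ a ≡ bits A → Env σ i j μ₀ μ → μ ⊢ entry a ⇓ bit (A i j)
  ⇓-bits {i = i} {j} {μ = μ} a eq env = subst (λ v → μ ⊢ entry a ⇓ v i j) eq (⇓-entry env a)

  bit-≤ : ∀ b {k} → 1 ≤ k → k ≤ 16 → ∣ bit b ∣ ≤ B
  bit-≤ b 1≤k k≤ = small-literal (ℕ.≤-trans (∣bit∣≤1 b) (ℕ.≤-trans 1≤k k≤))

  impl-or : ∀ {δ σ A B} d a b → σ a ≡ bits A → σ b ≡ bits B →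
    Impl δ (66 * U) (orC d a b) σ (assign σ d (bits (A ∪ B)))
  impl-or {_} {σ} {A} {B′} d a b eqA eqB = impl-fill d (bits (A ∪ B′)) (ℕ.m≤m+n 15 35) λ i j env →
    or-value (A i j) (B′ i j) (⇓-bits a eqA env) (⇓-bits b eqB env)
    where
    or-value : ∀ x y {μ e f} → μ ⊢ e ⇓ bit x → μ ⊢ f ⇓ bit y →
      μ ⊢ op sub (op add e f) (op mul e f) ⇓ bit (x ∨ y)
    or-value true  true  p q = ⇓-sub (⇓-add p q (small-literal (ℕ.m≤m+n 2 14))) (⇓-mul p q (small-literal (ℕ.m≤m+n 1 15))) (small-literal (ℕ.m≤m+n 1 15))
    or-value true  false p q = ⇓-sub (⇓-add p q (small-literal (ℕ.m≤m+n 1 15))) (⇓-mul p q (small-literal z≤n)) (small-literal (ℕ.m≤m+n 1 15))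
    or-value false true  p q = ⇓-sub (⇓-add p q (small-literal (ℕ.m≤m+n 1 15))) (⇓-mul p q (small-literal z≤n)) (small-literal (ℕ.m≤m+n 1 15))
    or-value false false p q = ⇓-sub (⇓-add p q (small-literal z≤n)) (⇓-mul p q (small-literal z≤n)) (small-literal z≤n)

  impl-and : ∀ {δ σ A B} d a b → σ a ≡ bits A → σ b ≡ bits B →
    Impl δ (66 * U) (andC d a b) σ (assign σ d (bits (λ i j → A i j ∧ B i j)))
  impl-and {_} {σ} {A} {B′} d a b eqA eqB = impl-fill d (bits (λ i j → A i j ∧ B′ i j)) (ℕ.m≤m+n 7 43) λ i j env →
    and-value (A i j) (B′ i j) (⇓-bits a eqA env) (⇓-bits b eqB env)
    where
    and-value : ∀ x y {μ e f} → μ ⊢ e ⇓ bit x → μ ⊢ f ⇓ bit y → μ ⊢ op mul e f ⇓ bit (x ∧ y)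
    and-value true  true  p q = ⇓-mul p q (small-literal (ℕ.m≤m+n 1 15))
    and-value true  false p q = ⇓-mul p q (small-literal z≤n)
    and-value false true  p q = ⇓-mul p q (small-literal z≤n)
    and-value false false p q = ⇓-mul p q (small-literal z≤n)

  exec-size : ∀ {σ μ} → Bounded B μ → Rep σ μ → Exec (store 0 (lit 0ℤ) (reg 0)) μ 4
    (λ μ′ → word μ′ 0 0 ≡ + n × Result 0 σ μ μ′)
  exec-size {μ = μ} bd rep = exec-weaken ℕ.≤-refl
    (λ { refl → update-same (word μ) 0 0 ,
      rep-private (λ b x ≤b _ → update-other (word μ) 0 0 (inj₁ (≢0 ≤b))) rep ,
      λ r _ → update-other (word μ) 0 0 (inj₁ (≢0 ℕ.≤-refl)) })
    (exec-store bd (⇓-lit z≤n) (⇓-reg (small-literal z≤n) (reg-n rep)))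
    where
    ≢0 : ∀ {b} → base ≤ b → b ≢ 0
    ≢0 ≤b = ℕ.>⇒≢ (ℕ.≤-trans (ℕ.≤-trans (s≤s z≤n) 5≤base) ≤b)

  low : ∀ {a} → a < 5 → a < base
  low lt = ℕ.<-≤-trans lt 5≤base

  1≤U : 1 ≤ U
  1≤U = ℕ.≤-trans (s≤s z≤n) ≤U

  fₙ≤U : fₙ ≤ U
  fₙ≤U = ℕ.≤-trans (ℕ.m≤m+n fₙ Tₙ) (ℕ.≤-trans (ℕ.m≤n+m (fₙ + Tₙ) (1 + n * n)) ≤U)

  Tₙ≤U : Tₙ ≤ U
  Tₙ≤U = ℕ.≤-trans (ℕ.m≤n+m Tₙ fₙ) (ℕ.≤-trans (ℕ.m≤n+m (fₙ + Tₙ) (1 + n * n)) ≤U)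

  impl-mul : ∀ {δ σ A B} d a b → σ a ≡ bits A → σ b ≡ bits B →
    Impl δ (203 * U) (mulC d a b) σ (assign σ d (bits (A ∙ B)))
  impl-mul {δ} {σ} {A} {B′} d a b eqA eqB {μ} bd rep = exec-weaken cost (λ {μ′} → deepen {δ} {μ = μ} {μ′})
    (exec-seq (exec-size bd rep) λ μ₁ bd₁ (size₁ , rep₁ , s₁) →
     exec-seq (exec-fill-low 1 (bits A) (low (ℕ.m≤m+n 2 3)) (ℕ.m≤m+n 3 47) bd₁ rep₁ (λ i j → ⇓-bits a eqA))
       λ μ₂ bd₂ (A₂ , (rep₂ , s₂) , low₂) →
     exec-seq (exec-fill-low 2 (bits B′) (low (ℕ.m≤m+n 3 2)) (ℕ.m≤m+n 3 47) bd₂ rep₂ (λ i j → ⇓-bits b eqB))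
       λ μ₃ bd₃ (B₃ , (rep₃ , s₃) , low₃) →
     exec-seq (call μ₃ bd₃ (trans (low₃ 0 0 (low (s≤s z≤n)) (λ ())) (trans (low₂ 0 0 (low (s≤s z≤n)) (λ ())) size₁))
                 (λ i j → trans (low₃ 1 _ (low (ℕ.m≤m+n 2 3)) (λ ())) (A₂ i j)) B₃ rep₃)
       λ μ₄ bd₄ (C₄ , rep₄ , s₄) →
     exec-weaken ℕ.≤-refl (λ (rep₅ , s₅) → rep₅ , λ r le →
         trans (s₅ r le) (trans (s₄ r le) (trans (s₃ r le) (trans (s₂ r le) (s₁ r le)))))
       (exec-fill-private d (bits (A ∙ B′)) (ℕ.m≤m+n 11 39) bd₄ rep₄ λ i j env → result C₄ i j env))
    where
    cost : 4 + (66 * U + (66 * U + (fₙ + 66 * U))) ≤ 203 * U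
    cost = ℕ.≤-trans (ℕ.≤-reflexive (eq fₙ (66 * U)))
      (ℕ.≤-trans (ℕ.+-mono-≤ (ℕ.+-mono-≤ (ℕ.*-monoʳ-≤ 4 1≤U) fₙ≤U) (ℕ.≤-refl {3 * (66 * U)})) (ℕ.≤-reflexive (eq₂ U)))
      where
      eq : ∀ f u → 4 + (u + (u + (f + u))) ≡ ((4 * 1) + f) + 3 * u
      eq = ℕ-solve-∀
      eq₂ : ∀ u → ((4 * u) + u) + 3 * (66 * u) ≡ 203 * u
      eq₂ = ℕ-solve-∀

    bits-small : ∀ (A : Matrix Bool n) i j → ∣ bits A i j ∣ ≤ n ^ 0
    bits-small A i j = ∣bit∣≤1 (A i j)

    counts : Matrix ℕ n
    counts i j = count (λ k → A i k ∧ B′ k j)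

    call : ∀ μ → Bounded B μ → word μ 0 0 ≡ + n → StoresWords μ 1 (bits A) → StoresWords μ 2 (bits B′) →
      Rep σ μ → Exec mm μ fₙ (λ μ′ → StoresWords μ′ 3 (λ i j → + counts i j) × Result 0 σ μ μ′)
    call μ bd n₀ sA sB rep =
      let k , μ′ , run , k≤ , C , sC , eq =
            mm-correct ((bits A , bits-small A) , (bits B′ , bits-small B′)) μ bd n₀ (sA , sB) in
      k , μ′ , run , k≤ , run-bounded run bd ,
      (λ i j → trans (sC i j) (trans (eq i j) (sum≡count (A i) (λ k → B′ k j)))) ,
      rep-private (λ b x ≤b _ → run-frame run (ℕ.≤-trans mm-writes ≤b) x) rep ,
      λ r _ → run-frame run mm-writes r

    result : ∀ {μ₄} → StoresWords μ₄ 3 (λ i j → + counts i j) → ∀ i j {μ} → Env σ i j μ₄ μ →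
      μ ⊢ op div (op add (load 3 (reg 3)) (reg 0)) (op add (lit 1ℤ) (reg 0)) ⇓ bit ((A ∙ B′) i j)
    result {μ₄} C₄ i j {μ} env = ⇓-cast (threshold f)
      (⇓-op div (⇓-add entry-value (⇓-n env) (small-linear 2 0 (ℕ.m≤m+n 2 30) z≤n 2n))
                (⇓-add (⇓-lit (small-literal (ℕ.m≤m+n 1 15))) (⇓-n env) (small-linear 1 1 (ℕ.m≤m+n 1 31) (ℕ.m≤m+n 1 31) n+1))
                (fit-just (subst (λ z → ∣ z ∣ ≤ B) (sym (threshold f)) (small-literal (ℕ.≤-trans (∣bit∣≤1 (some f)) (ℕ.m≤m+n 1 15))))))
      where
      f : Fin n → Bool
      f k = A i k ∧ B′ k j

      entry-value : μ ⊢ load 3 (reg 3) ⇓ + count f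
      entry-value = subst (μ ⊢ load 3 (reg 3) ⇓_) (C₄ i j) (⇓-low env (low (ℕ.m≤m+n 4 1)))

      2n : count f + n ≤ 2 * n + 0
      2n = ℕ.≤-trans (ℕ.+-monoˡ-≤ n (count≤n f)) (ℕ.≤-reflexive (eq n))
        where
        eq : ∀ n → n + n ≡ 2 * n + 0
        eq = ℕ-solve-∀

      n+1 : suc n ≤ 1 * n + 1
      n+1 = ℕ.≤-reflexive (eq n)
        where
        eq : ∀ n → suc n ≡ 1 * n + 1
        eq = ℕ-solve-∀

  ℓ<B : suc ℓ ≤ B
  ℓ<B = small-linear 2 1 (ℕ.m≤m+n 2 30) (ℕ.m≤m+n 1 31)
    (ℕ.≤-trans (n<2^n ℓ) (ℕ.≤-trans 2^ℓ≤ (ℕ.≤-reflexive (suc-double n))))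

  assign-same : ∀ (σ : State n) a v → assign σ a v a ≡ v
  assign-same σ a v = cong (λ b → if b then v else σ a) (≡ᵇ-refl a)

  -- States are functions; they are compared entry by entry, so that no extensionality is assumed.
  rep-cong : ∀ {σ σ′ : State n} {μ} → (∀ a i j → σ a i j ≡ σ′ a i j) → Rep σ μ → Rep σ′ μ
  rep-cong eq rep = record
    { reg-n = reg-n rep ; reg-n² = reg-n² rep ; reg-ℓ = reg-ℓ rep
    ; entries = λ a i j → trans (entries rep a i j) (eq a i j) }

  if-if : ∀ {A : Set} b {x y z : A} → (if b then x else (if b then y else z)) ≡ (if b then x else z)
  if-if true  = refl
  if-if false = refl

  rep-overwrite : ∀ {σ a v w μ} → Rep (assign (assign σ a v) a w) μ → Rep (assign σ a w) μ
  rep-overwrite {σ} {a} {v} {w} = rep-cong λ b i j → cong (λ m → m i j) (if-if (a ≡ᵇ b) {w} {v} {σ b})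

  rep-counter : ∀ {σ μ v} r → 4 ≤ r → Rep σ μ → Rep σ (μ [ r := v ])
  rep-counter {μ = μ} r 4≤r rep = record
    { reg-n   = trans (update-other (word μ) base r (inj₂ (ℕ.<⇒≢ (ℕ.≤-trans (s≤s z≤n) 4≤r)))) (reg-n rep)
    ; reg-n²  = trans (update-other (word μ) base r (inj₂ (ℕ.<⇒≢ (ℕ.≤-trans (s≤s (s≤s z≤n)) 4≤r)))) (reg-n² rep)
    ; reg-ℓ   = trans (update-other (word μ) base r (inj₂ (ℕ.<⇒≢ (ℕ.≤-trans (ℕ.m≤m+n 3 1) 4≤r)))) (reg-ℓ rep)
    ; entries = λ a i j → trans (update-other (word μ) base r (inj₁ (arr≢base a))) (entries rep a i j)
    }

  -- The depth is at least 1 because the squaring loop uses register 4 as its counter.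
  impl-close : ∀ {δ σ A} one a → σ one ≡ bits identity → σ a ≡ bits A →
    Impl (suc δ) V (closeC one a) σ (assign σ a (bits (closure A)))
  impl-close {δ} {σ} {A} one a eq1 eqA {μ} bd rep = exec-weaken cost (λ x → x)
    (exec-seq (impl-or {suc δ} {σ} a a one eqA eq1 bd rep) λ μ₁ bd₁ (rep₁ , same₁) →
     exec-weaken ℕ.≤-refl (λ (rep₂ , same₂) → rep-overwrite {σ} {a} rep₂ , λ r le → trans (same₂ r le) (same₁ r le))
      (exec-for {r = 4} {2} {ℓ} {203 * U} (small-literal (ℕ.m≤m+n 4 12)) (small-literal (ℕ.m≤m+n 2 14)) ℓ<B
        (Inv μ₁) (λ {t} {μ} → stable {μ₁} {t} {μ}) (λ (rep , _) → reg-ℓ rep) (λ {t} {μ} → body {μ₁} {t} {μ}) bd₁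
        (rep-self rep₁ , λ _ _ → refl)))
    where
    σ₁ : State n
    σ₁ = assign σ a (bits (A ∪ identity))

    σ′ : ℕ → State n
    σ′ t = assign σ₁ a (bits (squares t (A ∪ identity)))

    Inv : Memory → ℕ → Memory → Set
    Inv μ₁ t μ = Rep (σ′ t) μ × (∀ r → 4 + suc δ ≤ r → word μ base r ≡ word μ₁ base r)

    rep-self : ∀ {μ} → Rep σ₁ μ → Rep (σ′ 0) μ
    rep-self = rep-cong λ b i j → cong (λ m → m i j) (sym (if-if (a ≡ᵇ b) {bits (A ∪ identity)} {bits (A ∪ identity)} {σ b}))

    stable : ∀ {μ₁ t μ v} → Inv μ₁ t μ → Inv μ₁ t (μ [ 4 := v ])
    stable {μ = μ} (rep , same) = rep-counter 4 ℕ.≤-refl rep ,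
      λ r le → trans (update-other (word μ) base 4 (inj₂ (ℕ.>⇒≢ (ℕ.≤-trans (s≤s (ℕ.m≤m+n 4 δ)) (ℕ.≤-trans (ℕ.≤-reflexive (sym (ℕ.+-suc 4 δ))) le))))) (same r le)

    body : ∀ {μ₁ t μ} → t < ℓ → Bounded B μ → Inv μ₁ t μ → word μ base 4 ≡ + t →
      Exec (mulC a a a) μ (203 * U) (λ μ′ → Inv μ₁ (suc t) μ′ × word μ′ base 4 ≡ + t)
    body {t = t} _ bd (rep , same) at = exec-weaken ℕ.≤-refl
      (λ (rep′ , same′) → (rep-overwrite {σ₁} {a} {bits (squares t (A ∪ identity))} rep′ , λ r le → trans (same′ r (ℕ.≤-trans (ℕ.m≤m+n 4 (suc δ)) le)) (same r le)) ,
                          trans (same′ 4 ℕ.≤-refl) at)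
      (impl-mul {0} {σ′ t} a a a (assign-same σ₁ a _) (assign-same σ₁ a _) bd rep)

    cost : 66 * U + (10 + ℓ * (13 + 203 * U)) ≤ V
    cost = begin
      66 * U + (10 + ℓ * (13 + 203 * U))                     ≤⟨ ℕ.+-monoʳ-≤ (66 * U) (ℕ.+-mono-≤ (ℕ.*-monoʳ-≤ 10 1≤U)
                                                                  (ℕ.*-mono-≤ ℓ≤Λ (ℕ.+-monoˡ-≤ (203 * U) (ℕ.*-monoʳ-≤ 13 1≤U)))) ⟩
      66 * U + (10 * U + Λ * (13 * U + 203 * U))             ≡⟨ eq U Λ ⟩
      76 * (1 * U) + 216 * (Λ * U)                           ≤⟨ ℕ.+-monoˡ-≤ (216 * (Λ * U)) (ℕ.*-monoʳ-≤ 76 (ℕ.*-monoˡ-≤ U 1≤Λ)) ⟩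
      76 * (Λ * U) + 216 * (Λ * U)                           ≡⟨ ℕ.*-distribʳ-+ (Λ * U) 76 216 ⟨
      292 * (Λ * U)                                          ≤⟨ ℕ.*-monoˡ-≤ (Λ * U) (ℕ.m≤m+n 292 708) ⟩
      1000 * (Λ * U)                                         ≤⟨ ≤V ⟩
      V                                                      ∎
      where
      open ℕ.≤-Reasoning
      eq : ∀ u l → 66 * u + (10 * u + l * (13 * u + 203 * u)) ≡ 76 * (1 * u) + 216 * (l * u)
      eq = ℕ-solve-∀

  ∣+∣-≤ : ∀ {x y a b} → ∣ x ∣ ≤ a → ∣ y ∣ ≤ b → ∣ x ℤ.+ y ∣ ≤ a + b
  ∣+∣-≤ {x} {y} p q = ℕ.≤-trans (ℤ.∣i+j∣≤∣i∣+∣j∣ x y) (ℕ.+-mono-≤ p q)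

  ∣-∣-≤ : ∀ {x y a b} → ∣ x ∣ ≤ a → ∣ y ∣ ≤ b → ∣ x ℤ.- y ∣ ≤ a + b
  ∣-∣-≤ {x} {y} p q = ℕ.≤-trans (ℤ.∣i-j∣≤∣i∣+∣j∣ x y) (ℕ.+-mono-≤ p q)

  ⇓-value : ∀ {σ : State n} {i j μ₀ μ} {v : Matrix ℤ n} a → σ a ≡ v → Env σ i j μ₀ μ → μ ⊢ entry a ⇓ v i j
  ⇓-value {i = i} {j} {μ = μ} a eq env = subst (λ v → μ ⊢ entry a ⇓ v i j) eq (⇓-entry env a)

  impl-clear : ∀ {δ σ} s → Impl δ (66 * U) (clearC s) σ (assign σ s (λ _ _ → 0ℤ))
  impl-clear s = impl-fill s (λ _ _ → 0ℤ) (ℕ.m≤m+n 1 49) λ _ _ _ → ⇓-lit z≤n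

  stackM : (ℕ → Matrix Bool n) → ℕ → Matrix ℤ n
  stackM F t i j = + stack (λ k → F k i j) t

  -- This is where `2 ^ ℓ ≤ suc (n + n)` pays off: one bit per level still makes a number linear in
  -- `n`.
  stack-fits : ∀ f {t} → t ≤ ℓ → stack f t ≤ B
  stack-fits f {t} t≤ℓ = small-linear 2 1 (ℕ.m≤m+n 2 30) (ℕ.m≤m+n 1 31) (ℕ.≤-trans (ℕ.<⇒≤ (stack< f t))
    (ℕ.≤-trans (ℕ.^-monoʳ-≤ 2 t≤ℓ) (ℕ.≤-trans 2^ℓ≤ (ℕ.≤-reflexive (suc-double n)))))

  double-fits : ∀ f {t} → t < ℓ → stack f t * 2 ≤ B
  double-fits f {t} t<ℓ = ℕ.≤-trans (ℕ.m≤n+m (stack f t * 2) (if f t then 1 else 0)) (stack-fits f t<ℓ)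

  impl-push : ∀ {δ σ F t} s b → t < ℓ → σ s ≡ stackM F t → σ b ≡ bits (F t) →
    Impl δ (66 * U) (pushC s b) σ (assign σ s (stackM F (suc t)))
  impl-push {F = F} {t} s b t<ℓ eqS eqB = impl-fill s (stackM F (suc t)) (ℕ.m≤m+n 11 39) λ i j {μ₀} {μ} env →
    let f = λ k → F k i j in
    ⇓-cast (stack-push f t)
      (⇓-add (⇓-add (⇓-value s eqS env) (⇓-value s eqS env)
                (ℕ.≤-trans (ℕ.≤-reflexive (double (stack f t))) (double-fits f t<ℓ)))
             (⇓-bits b eqB env)
             (subst (λ z → ∣ z ∣ ≤ B) (sym (stack-push f t)) (stack-fits f t<ℓ)))
    where
    double : ∀ s → s + s ≡ s * 2
    double = ℕ-solve-∀

  ⇓-half : ∀ {μ e} f {t} → t < ℓ → μ ⊢ e ⇓ + stack f (suc t) → μ ⊢ op div e (lit (+ 2)) ⇓ + stack f t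
  ⇓-half {μ} {e} f {t} t<ℓ p = ⇓-cast (stack/2 f t)
    (⇓-op div p (⇓-lit {z = + 2} (small-literal (ℕ.m≤m+n 2 14)))
      (fit-just (subst (λ z → ∣ z ∣ ≤ B) (sym (stack/2 f t)) (stack-fits f (ℕ.<⇒≤ t<ℓ)))))

  impl-pop : ∀ {δ σ F t} s b → t < ℓ → σ s ≡ stackM F (suc t) →
    -- Says that writing `b` leaves the stack alone, in a form that holds by computation for
    -- distinct literal names.
    assign σ b (bits (F t)) s ≡ stackM F (suc t) →
    Impl δ (66 * U + 66 * U) (popC s b) σ (assign (assign σ b (bits (F t))) s (stackM F t))
  impl-pop {δ} {σ} {F} {t} s b t<ℓ eqS eqS′ =
    impl-fill {δ} {σ} b (bits (F t)) (ℕ.m≤m+n 11 39) (λ i j {μ₀} {μ} env →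
      let f = λ k → F k i j in
      ⇓-cast (stack-parity f t)
        (⇓-sub (⇓-value s eqS env)
          (⇓-mul (⇓-lit {z = + 2} (small-literal (ℕ.m≤m+n 2 14))) (⇓-half f t<ℓ (⇓-value s eqS env))
            (subst (_≤ B) (sym (trans (ℤ.abs-* (+ 2) (+ stack f t)) (ℕ.*-comm 2 (stack f t)))) (double-fits f t<ℓ)))
          (subst (λ z → ∣ z ∣ ≤ B) (sym (stack-parity f t)) (bit-≤ (f t) ℕ.≤-refl (s≤s z≤n)))))
    then
    impl-fill {δ} {assign σ b (bits (F t))} s (stackM F t) (ℕ.m≤m+n 5 45) (λ i j env →
      ⇓-half (λ k → F k i j) t<ℓ (⇓-value s eqS′ env))

  impl-start : ∀ {δ σ R O Q} x r o q → σ r ≡ bits R → σ o ≡ bits O → σ q ≡ bits Q →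
    Impl δ (66 * U) (startC x r o q) σ (assign σ x (start R O Q))
  impl-start {R = R} {O} {Q} x r o q eqR eqO eqQ = impl-fill x (start R O Q) (ℕ.m≤m+n 13 37) λ i j env →
    let 3≤ = ∣-∣-≤ {+ 2} {bit (R i j)} {2} {1} ℕ.≤-refl (∣bit∣≤1 (R i j))
        4≤ = ∣-∣-≤ {(+ 2) ℤ.- bit (R i j)} {bit (O i j)} 3≤ (∣bit∣≤1 (O i j))
        5≤ = ∣-∣-≤ {((+ 2) ℤ.- bit (R i j)) ℤ.- bit (O i j)} {bit (Q i j)} 4≤ (∣bit∣≤1 (Q i j))
    in ⇓-sub (⇓-sub (⇓-sub (⇓-lit (small-literal (ℕ.m≤m+n 2 14))) (⇓-bits r eqR env) (small-literal (ℕ.≤-trans 3≤ (ℕ.m≤m+n 3 13))))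
                (⇓-bits o eqO env) (small-literal (ℕ.≤-trans 4≤ (ℕ.m≤m+n 4 12))))
         (⇓-bits q eqQ env) (small-literal (ℕ.≤-trans 5≤ (ℕ.m≤m+n 5 11)))

  Small : Matrix ℤ n → Set
  Small x = ∀ i j → suc ∣ x i j ∣ ≤ 8 * (1 + n)

  impl-refine : ∀ {δ σ X A} x b → σ x ≡ X → Small X → σ b ≡ bits A →
    Impl δ (66 * U) (refineC x b) σ (assign σ x (refine X A))
  impl-refine {X = X} {A} x b eqX small eqA = impl-fill x (refine X A) (ℕ.m≤m+n 11 39) λ i j env →
    let k≤ = ℕ.≤-trans (ℕ.n≤1+n _) (small i j)
        2k≤ = ∣+∣-≤ {X i j} {X i j} k≤ k≤
        2k+1≤ = ∣-∣-≤ {X i j ℤ.+ X i j} {bit (A i j)} 2k≤ (∣bit∣≤1 (A i j))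
    in ⇓-sub (⇓-add (⇓-value x eqX env) (⇓-value x eqX env)
                (small-linear 16 16 (ℕ.m≤m+n 16 16) (ℕ.m≤m+n 16 16) (ℕ.≤-trans 2k≤ (ℕ.≤-reflexive (eq₁ n)))))
         (⇓-bits b eqA env)
         (small-linear 16 17 (ℕ.m≤m+n 16 16) (ℕ.m≤m+n 17 15) (ℕ.≤-trans 2k+1≤ (ℕ.≤-reflexive (eq₂ n))))
    where
    eq₁ : ∀ n → 8 * (1 + n) + 8 * (1 + n) ≡ 16 * n + 16
    eq₁ = ℕ-solve-∀
    eq₂ : ∀ n → 8 * (1 + n) + 8 * (1 + n) + 1 ≡ 16 * n + 17
    eq₂ = ℕ-solve-∀

  impl-target : ∀ {δ σ X A} d x a dir → σ x ≡ X → Small X → σ a ≡ bits A →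
    Impl δ (270 * U) (targetC d x a (offset dir)) σ
      (assign σ d (bits (target? X (barrier (8 * (1 + n)) A) (λ i j → X i j ℤ.- offset dir))))
  impl-target {δ} {σ} {X} {A} d x a dir eqX small eqA {μ} bd rep = exec-weaken cost (λ {μ′} → deepen {δ} {μ = μ} {μ′})
    (exec-seq (exec-size bd rep) λ μ₁ bd₁ (size₁ , rep₁ , s₁) →
     exec-seq (exec-fillᴿ-low 0 X (ℕ.m≤m+n 3 47) bd₁ rep₁ (λ i j → ⇓-value x eqX))
       λ μ₂ bd₂ (X₂ , (rep₂ , s₂) , low₂ , real₂) →
     exec-seq (exec-fillᴿ-low 1 M (ℕ.m≤m+n 16 34) bd₂ rep₂ (λ i j env → barrier-value (A i j) (⇓-bits a eqA env) (⇓-n env)))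
       λ μ₃ bd₃ (M₃ , (rep₃ , s₃) , low₃ , real₃) →
     exec-seq (exec-fillᴿ-low 2 t (ℕ.m≤m+n 5 45) bd₃ rep₃ (λ i j env → target-value i j (⇓-value x eqX env)))
       λ μ₄ bd₄ (t₄ , (rep₄ , s₄) , low₄ , real₄) →
     exec-seq (call μ₄ bd₄
         (trans (low₄ 0 0 (low (s≤s z≤n))) (trans (low₃ 0 0 (low (s≤s z≤n))) (trans (low₂ 0 0 (low (s≤s z≤n))) size₁)))
         (λ i j → trans (real₄ 0 _ (λ ())) (trans (real₃ 0 _ (λ ())) (X₂ i j)))
         (λ i j → trans (real₄ 1 _ (λ ())) (M₃ i j)) t₄ rep₄)
       λ μ₅ bd₅ (C₅ , rep₅ , s₅) →
     exec-weaken ℕ.≤-refl (λ (rep₆ , s₆) → rep₆ , λ r le → trans (s₆ r le) (trans (s₅ r le)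
         (trans (s₄ r le) (trans (s₃ r le) (trans (s₂ r le) (s₁ r le))))))
       (exec-fill-private d (bits C) (ℕ.m≤m+n 3 47) bd₅ rep₅ λ i j {μ} env →
         subst (μ ⊢ load 1 (reg 3) ⇓_) (C₅ i j) (⇓-low env (low (ℕ.m≤m+n 2 3)))))
    where
    M t : Matrix ℤ n
    M = barrier (8 * (1 + n)) A
    t i j = X i j ℤ.- offset dir

    C : Matrix Bool n
    C = target? X M t

    cost : 4 + (66 * U + (66 * U + (66 * U + (Tₙ + 66 * U)))) ≤ 270 * U
    cost = ℕ.≤-trans (ℕ.≤-reflexive (eq Tₙ (66 * U)))
      (ℕ.≤-trans (ℕ.+-mono-≤ (ℕ.+-mono-≤ (ℕ.*-monoʳ-≤ 4 1≤U) Tₙ≤U) (ℕ.≤-refl {4 * (66 * U)}))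
        (ℕ.≤-trans (ℕ.≤-reflexive (eq₂ U)) (ℕ.*-monoˡ-≤ U (ℕ.m≤m+n 269 1))))
      where
      eq : ∀ f u → 4 + (u + (u + (u + (f + u)))) ≡ ((4 * 1) + f) + 4 * u
      eq = ℕ-solve-∀
      eq₂ : ∀ u → ((4 * u) + u) + 4 * (66 * u) ≡ 269 * u
      eq₂ = ℕ-solve-∀

    8n+8 : 8 * (1 + n) ≤ B
    8n+8 = small-linear 8 8 (ℕ.m≤m+n 8 24) (ℕ.m≤m+n 8 24) (ℕ.≤-reflexive (eq n))
      where
      eq : ∀ n → 8 * (1 + n) ≡ 8 * n + 8
      eq = ℕ-solve-∀

    ⇓-8n+8 : ∀ {μ} → μ ⊢ reg 0 ⇓ + n → μ ⊢ op mul (lit (+ 8)) (op add (lit 1ℤ) (reg 0)) ⇓ + (8 * (1 + n))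
    ⇓-8n+8 {μ} p = ⇓-cast (sym (ℤ.pos-* 8 (1 + n)))
      (⇓-mul (⇓-lit {z = + 8} (small-literal (ℕ.m≤m+n 8 8)))
        (⇓-add (⇓-lit {z = 1ℤ} (small-literal (s≤s z≤n))) p (ℕ.≤-trans (ℕ.m≤m+n (1 + n) (7 * (1 + n))) 8n+8))
        (subst (λ z → ∣ z ∣ ≤ B) (ℤ.pos-* 8 (1 + n)) 8n+8))

    barrier-value : ∀ b {μ} → μ ⊢ entry a ⇓ bit b → μ ⊢ reg 0 ⇓ + n →
      μ ⊢ barrierE a ⇓ (if b then ℤ.- (+ (8 * (1 + n))) else + (8 * (1 + n)))
    barrier-value true {μ} p q = ⇓-cast (ℤ.-1*i≡-i (+ (8 * (1 + n))))
      (⇓-mul (⇓-sub (⇓-lit {z = 1ℤ} (small-literal (s≤s z≤n))) (⇓-add p p (small-literal (ℕ.m≤m+n 2 14))) (small-literal (s≤s z≤n))) (⇓-8n+8 q)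
        (subst (λ z → ∣ z ∣ ≤ B) (sym (ℤ.-1*i≡-i (+ (8 * (1 + n))))) 8n+8))
    barrier-value false {μ} p q = ⇓-cast (ℤ.*-identityˡ (+ (8 * (1 + n))))
      (⇓-mul (⇓-sub (⇓-lit {z = 1ℤ} (small-literal (s≤s z≤n))) (⇓-add p p (small-literal z≤n)) (small-literal (s≤s z≤n))) (⇓-8n+8 q)
        (subst (λ z → ∣ z ∣ ≤ B) (sym (ℤ.*-identityˡ (+ (8 * (1 + n))))) 8n+8))

    ∣offset∣≤1 : ∀ dir → ∣ offset dir ∣ ≤ 1
    ∣offset∣≤1 ↑ = ℕ.≤-refl
    ∣offset∣≤1 ↓ = z≤n

    target-value : ∀ i j {μ} → μ ⊢ entry x ⇓ X i j → μ ⊢ op sub (entry x) (lit (offset dir)) ⇓ t i j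
    target-value i j p = ⇓-sub p (⇓-lit (small-literal (ℕ.≤-trans (∣offset∣≤1 dir) (s≤s z≤n))))
      (ℕ.≤-trans (ℕ.≤-trans (∣-∣-≤ {X i j} {offset dir} ℕ.≤-refl (∣offset∣≤1 dir))
        (ℕ.≤-reflexive (ℕ.+-comm ∣ X i j ∣ 1))) (ℕ.≤-trans (small i j) 8n+8))

    call : ∀ μ → Bounded B μ → word μ 0 0 ≡ + n → StoresReals μ 0 (λ i j → fromℤ (X i j)) →
      StoresReals μ 1 (λ i j → fromℤ (M i j)) → StoresReals μ 2 (λ i j → fromℤ (t i j)) →
      Rep σ μ → Exec tmm μ Tₙ (λ μ′ → StoresWords μ′ 1 (bits C) × Result 0 σ μ μ′)
    call μ bd n₀ sX sM st rep =
      let k , μ′ , run , k≤ , D , sD , sol = tmm-correct (_ , _ , _) μ bd n₀ (sX , sM , st) in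
      k , μ′ , run , k≤ , run-bounded run bd ,
      (λ i j → trans (sD i j) (cong bit (target-solution X M t D sol i j))) ,
      rep-private (λ b x ≤b _ → run-frame run (ℕ.≤-trans tmm-writes ≤b) x) rep ,
      λ r _ → run-frame run tmm-writes r

-- The program

module Program (mm tmm : Cmd) (base : ℕ) where

  open Instructions mm tmm base public

  -- The names of the matrices: the current layer is in 0, 1 and 2, the identity
  -- in 3, reachability in 4, the negative and the nonpositive pairs in 7
  -- and 8, the distances in 9, the stacks of the layers in 10 and 11; 5 and 6 are
  -- temporary.
  reachC firstC ascendC topC descendC finalC mainC sizesC decodeC diagonalC outputC apspC : Cmd
  reachC   = orC 4 0 1 ⨾ (orC 4 4 2 ⨾ closeC 3 4)
  firstC   = closeC 3 2 ⨾ (mulC 0 0 2 ⨾ mulC 1 1 2)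
  ascendC  = pushC 10 0 ⨾ (pushC 11 1 ⨾ (mulC 5 0 1 ⨾ (mulC 6 1 0 ⨾ (orC 5 5 6 ⨾ (orC 5 5 1 ⨾ (orC 2 5 2 ⨾
             (closeC 3 2 ⨾ (mulC 6 0 0 ⨾ (orC 0 0 6 ⨾ (mulC 1 1 1 ⨾ (mulC 0 0 2 ⨾ mulC 1 1 2)))))))))))
  topC     = mulC 7 2 1 ⨾ (orC 8 2 7 ⨾ (mulC 5 2 0 ⨾ (orC 5 8 5 ⨾ startC 9 5 8 7)))
  descendC = popC 10 0 ⨾ (popC 11 1 ⨾ (mulC 5 8 1 ⨾ (mulC 6 7 0 ⨾ (orC 7 7 5 ⨾ (orC 7 7 6 ⨾
             (targetC 5 9 0 1ℤ ⨾ (targetC 6 9 1 0ℤ ⨾ (orC 5 5 6 ⨾ refineC 9 5))))))))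
  finalC   = andC 7 7 3 ⨾ (mulC 5 4 7 ⨾ mulC 5 5 4)
  mainC    = (clearC 10 ⨾ (clearC 11 ⨾ (reachC ⨾ firstC))) ⨾
             (for 5 2 ascendC ⨾ (topC ⨾ (for 5 2 descendC ⨾ finalC)))

  powerC : Cmd
  powerC = while reg 3 ≤ reg 0 loop (set 3 (op add (reg 3) (reg 3)) ⨾ set 2 (op add (reg 2) (lit 1ℤ)))

  sizesC = set 0 (load 0 (lit 0ℤ)) ⨾ (set 1 (op mul (reg 0) (reg 0)) ⨾
           (set 2 (lit 0ℤ) ⨾ (set 3 (lit 1ℤ) ⨾ powerC)))

  -- For a missing edge the value word is arbitrary; the factor `1 - t`, with `t` the tag, replaces
  -- it by 0.
  weightE : Exp
  weightE = op mul (op sub (lit 1ℤ) (load 1 (reg 3))) (load 2 (reg 3))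

  edgeE : Weight → Exp
  edgeE 1ʷ  = op div (op mul weightE (op add weightE (lit 1ℤ))) (lit (+ 2))
  edgeE -1ʷ = op div (op mul weightE (op sub weightE (lit 1ℤ))) (lit (+ 2))
  edgeE 0ʷ  = op sub (op sub (lit 1ℤ) (load 1 (reg 3))) (op mul weightE weightE)

  decodeC   = fill (arr 0) (edgeE 1ʷ) ⨾ (fill (arr 1) (edgeE -1ʷ) ⨾ fill (arr 2) (edgeE 0ʷ))
  diagonalC = fill (arr 3) (lit 0ℤ) ⨾
              for 4 0 (store (arr 3) (op add (op mul (reg 4) (reg 0)) (reg 4)) (lit 1ℤ))
  -- With reachability `r` and unboundedness `u`, `1 - r (1 + u)` is 1, 0 or -1, the tags of ∞, a
  -- finite value and -∞.
  outputC   = fill 3 (op sub (lit 1ℤ) (op mul (entry 4) (op add (lit 1ℤ) (entry 5)))) ⨾ fill 4 (entry 9)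
  apspC     = sizesC ⨾ (decodeC ⨾ (diagonalC ⨾ (mainC ⨾ outputC)))

-- Correctness of the program, phase by phase

module Main
  (mm tmm : Cmd) (base n B fₙ Tₙ ℓ Λ U V : ℕ)
  (5≤base : 5 ≤ base) (mm-writes : writes mm ≤ base) (tmm-writes : writes tmm ≤ base)
  (n²<B : suc (n * n) ≤ B) (capacity : 32 * (2 + n) ≤ B)
  (n<2^ℓ : n < 2 ^ ℓ) (2^ℓ≤ : 2 ^ ℓ ≤ suc (n + n)) (ℓ≤Λ : ℓ ≤ Λ) (1≤Λ : 1 ≤ Λ)
  (≤U : 1 + n * n + (fₙ + Tₙ) ≤ U) (≤V : 1000 * (Λ * U) ≤ V)
  (mm-correct : Correct mm (MatMul 0) n B fₙ) (tmm-correct : Correct tmm TargetMinMax n B Tₙ)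
  where

  open Program mm tmm base public using (reachC; firstC; ascendC; topC; descendC; finalC; mainC; weightE; edgeE; decodeC; diagonalC; outputC)
  open Execution mm tmm base n B fₙ Tₙ ℓ Λ U V 5≤base mm-writes tmm-writes n²<B capacity
    n<2^ℓ 2^ℓ≤ ℓ≤Λ 1≤Λ ≤U ≤V mm-correct tmm-correct public

  lit≤ : ∀ m → {T (m ≤ᵇ 16)} → m ≤ B
  lit≤ m {le} = small-literal (ℕ.≤ᵇ⇒≤ m 16 le)

  impl-weaken : ∀ {δ t s c σ σ′} → t ≤ s → Impl δ t c σ σ′ → Impl δ s c σ σ′
  impl-weaken le f bd rep = exec-weaken le (λ r → r) (f bd rep)

  U≤V : ∀ k → {T (k ≤ᵇ 1000)} → k * U ≤ V
  U≤V k {le} = ℕ.≤-trans (ℕ.*-mono-≤ (ℕ.≤ᵇ⇒≤ k 1000 le)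
    (ℕ.≤-trans (ℕ.≤-reflexive (sym (ℕ.*-identityˡ U))) (ℕ.*-monoˡ-≤ U 1≤Λ))) ≤V

  fast : ∀ k {δ c σ σ′} → {T (k ≤ᵇ 1000)} → Impl δ (k * U) c σ σ′ → Impl δ V c σ σ′
  fast k {σ = σ} {_} {le} = impl-weaken {σ = σ} (U≤V k {le})

  -- The counter is register 5, so a body of depth 1 may use register 4 for closures.
  exec-loop : ∀ {t c} (Inv : ℕ → State n → Set) →
    (∀ k {σ} → k < ℓ → Inv k σ → ∃[ σ′ ] Inv (suc k) σ′ × Impl 1 t c σ σ′) →
    ∀ {σ μ} → Inv 0 σ → Bounded B μ → Rep σ μ →
    Exec (for 5 2 c) μ (10 + ℓ * (13 + t)) (λ μ′ → ∃[ σ′ ] Inv ℓ σ′ × Rep σ′ μ′)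
  exec-loop {t} {c} Inv step {σ} inv bd rep =
    exec-for {r = 5} {2} {ℓ} (small-literal (ℕ.m≤m+n 5 11)) (small-literal (ℕ.m≤m+n 2 14)) ℓ<B
      (λ k μ → ∃[ σ′ ] Inv k σ′ × Rep σ′ μ)
      (λ (σ′ , inv′ , rep′) → σ′ , inv′ , rep-counter 5 (ℕ.m≤m+n 4 1) rep′)
      (λ (_ , _ , rep′) → reg-ℓ rep′)
      (λ {k} {μ} k<ℓ bd′ (σ′ , inv′ , rep′) at → case step k {σ′} k<ℓ inv′ of λ (σ″ , inv″ , impl) →
        exec-weaken ℕ.≤-refl (λ (rep″ , same) → (σ″ , inv″ , rep″) , trans (same 5 ℕ.≤-refl) at) (impl bd′ rep′))
      bd (σ , inv , rep)

  module _ (G : Graph n) where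

    open Distances ℓ n<2^ℓ G using (first; first-saturated; reach; unbounded; answer; answer-correct)
    open Signs ℓ n<2^ℓ using (Detects; nonpositive-refine; negative-refine)

    X : ℕ → Layer n
    X zero    = first
    X (suc k) = halve (X k)

    X-saturated : ∀ k → Saturated (X k)
    X-saturated zero    = first-saturated
    X-saturated (suc k) = halve-saturated (X k)

    -- Two stacks, because refinement and the signs read `P` and `N` of a layer. Layer `k` itself is
    -- still in the arrays 0, 1 and 2.
    record Ascending (k : ℕ) (σ : State n) : Set where
      field
        P≡ : σ 0 ≡ bits (P (X k))
        N≡ : σ 1 ≡ bits (N (X k))
        Z≡ : σ 2 ≡ bits (Z (X k))
        I≡ : σ 3 ≡ bits identity
        R≡ : σ 4 ≡ bits reach
        stackP≡ : σ 10 ≡ stackM (λ k → P (X k)) k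
        stackN≡ : σ 11 ≡ stackM (λ k → N (X k)) k

    ascend : ∀ k {σ} → k < ℓ → Ascending k σ → ∃[ σ′ ] Ascending (suc k) σ′ × Impl 1 (13 * V) ascendC σ σ′
    ascend k {σ} k<ℓ inv = _ ,
      -- Array names are literals, so `assign` reduces and the claims about new contents hold by
      -- computation.
      record { P≡ = refl ; N≡ = refl ; Z≡ = refl ; I≡ = I≡ ; R≡ = R≡ ; stackP≡ = refl ; stackN≡ = refl } ,
      impl-weaken {σ = σ} (ℕ.≤-reflexive (eq V))
        (fast 66 (impl-push {F = λ k → P (X k)} 10 0 k<ℓ stackP≡ P≡) then
         fast 66 (impl-push {F = λ k → N (X k)} 11 1 k<ℓ stackN≡ N≡) then
         fast 203 (impl-mul {A = p} {m} 5 0 1 P≡ N≡) then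
         fast 203 (impl-mul {A = m} {p} 6 1 0 N≡ P≡) then
         fast 66 (impl-or {A = p ∙ m} {m ∙ p} 5 5 6 refl refl) then
         fast 66 (impl-or {A = p ∙ m ∪ m ∙ p} {m} 5 5 1 refl N≡) then
         fast 66 (impl-or {A = p ∙ m ∪ m ∙ p ∪ m} {z} 2 5 2 refl Z≡) then
         impl-close {A = halve⁰ (X k)} 3 2 I≡ refl then
         fast 203 (impl-mul {A = p} {p} 6 0 0 P≡ P≡) then
         fast 66 (impl-or {A = p} {p ∙ p} 0 0 6 P≡ refl) then
         fast 203 (impl-mul {A = m} {m} 1 1 1 N≡ N≡) then
         fast 203 (impl-mul {A = p ∪ p ∙ p} {closure (halve⁰ (X k))} 0 0 2 refl refl) then
         fast 203 (impl-mul {A = m ∙ m} {closure (halve⁰ (X k))} 1 1 2 refl refl))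
      where
      open Ascending inv
      p m z : Matrix Bool n
      p = P (X k)
      m = N (X k)
      z = Z (X k)

      eq : ∀ v → v + (v + (v + (v + (v + (v + (v + (v + (v + (v + (v + (v + v))))))))))) ≡ 13 * v
      eq = ℕ-solve-∀

    record Descending (k : ℕ) (σ : State n) : Set where
      field
        {x} : Matrix ℤ n
        {Q O} : Matrix Bool n
        I≡ : σ 3 ≡ bits identity
        R≡ : σ 4 ≡ bits reach
        stackP≡ : σ 10 ≡ stackM (λ k → P (X k)) k
        stackN≡ : σ 11 ≡ stackM (λ k → N (X k)) k
        x≡ : σ 9 ≡ x
        Q≡ : σ 7 ≡ bits Q
        O≡ : σ 8 ≡ bits O
        -- The bound on counted steps is 1 at level `ℓ` and doubles with each level down.
        approximates : Approximates (X k) (2 ^ (ℓ ∸ k)) x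
        negative     : Detects (X k) (2 ^ (ℓ ∸ k)) -1ℤ Q
        nonpositive  : Detects (X k) (2 ^ (ℓ ∸ k)) 0ℤ O

    scale-double : ∀ {k} → k < ℓ → 2 ^ (ℓ ∸ suc k) + 2 ^ (ℓ ∸ suc k) ≡ 2 ^ (ℓ ∸ k)
    scale-double {k} k<ℓ = trans (cong (λ y → 2 ^ (ℓ ∸ suc k) + y) (sym (ℕ.+-identityʳ (2 ^ (ℓ ∸ suc k)))))
      (cong (2 ^_) (sym (ℕ.+-∸-assoc 1 k<ℓ)))

    -- Origin of the barrier height: the entries stay below `3 * 2 ^ ℓ ≤ 6n + 3`, and `8 (1 + n)` is
    -- above that at all levels.
    approximation-small : ∀ {k x} → Approximates (X k) (2 ^ (ℓ ∸ k)) x → Small x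
    approximation-small {k} ap i j = ℕ.≤-trans (small ap i j) (ℕ.≤-trans
      (ℕ.*-monoʳ-≤ 3 (ℕ.≤-trans (ℕ.^-monoʳ-≤ 2 (ℕ.m∸n≤m ℓ k)) 2^ℓ≤))
      (ℕ.≤-trans (ℕ.m≤m+n _ (2 * n + 5)) (ℕ.≤-reflexive (eq n))))
      where
      eq : ∀ n → 3 * suc (n + n) + (2 * n + 5) ≡ 8 * (1 + n)
      eq = ℕ-solve-∀

    descend : ∀ k {σ} → k < ℓ → Descending (suc k) σ → ∃[ σ′ ] Descending k σ′ × Impl 1 (12 * V) descendC σ σ′
    descend k {σ} k<ℓ inv = _ ,
      record
        { I≡ = I≡ ; R≡ = R≡ ; stackP≡ = refl ; stackN≡ = refl ; x≡ = refl ; Q≡ = refl ; O≡ = O≡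
        ; approximates = subst (λ s → Approximates (X k) s (refine x (c ↑ ∪ c ↓))) (scale-double k<ℓ)
            (refine-approximates (X-saturated k) {c = c} approximates
              λ { ↑ → barrier-target (P (X k)) ↑ x-small ; ↓ → barrier-target (N (X k)) ↓ x-small })
        ; negative = subst (λ s → Detects (X k) s -1ℤ (Q ∪ O ∙ N (X k) ∪ Q ∙ P (X k))) (scale-double k<ℓ)
            (negative-refine (X-saturated k) nonpositive negative)
        ; nonpositive = subst (λ s → Detects (X k) s 0ℤ O) (scale-double k<ℓ)
            (nonpositive-refine (X-saturated k) nonpositive)
        } ,
      impl-weaken {σ = σ} (ℕ.≤-reflexive (eq V))
        (impl-weaken (ℕ.+-mono-≤ (U≤V 66) (U≤V 66)) (impl-pop {F = λ k → P (X k)} 10 0 k<ℓ stackP≡ stackP≡) then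
         impl-weaken (ℕ.+-mono-≤ (U≤V 66) (U≤V 66)) (impl-pop {F = λ k → N (X k)} 11 1 k<ℓ stackN≡ stackN≡) then
         fast 203 (impl-mul {A = O} {m} 5 8 1 O≡ refl) then
         fast 203 (impl-mul {A = Q} {p} 6 7 0 Q≡ refl) then
         fast 66 (impl-or {A = Q} {O ∙ m} 7 7 5 Q≡ refl) then
         fast 66 (impl-or {A = Q ∪ O ∙ m} {Q ∙ p} 7 7 6 refl refl) then
         fast 270 (impl-target {X = x} {A = p} 5 9 0 ↑ x≡ x-small refl) then
         fast 270 (impl-target {X = x} {A = m} 6 9 1 ↓ x≡ x-small refl) then
         fast 66 (impl-or {A = c ↑} {c ↓} 5 5 6 refl refl) then
         fast 66 (impl-refine {X = x} {A = c ↑ ∪ c ↓} 9 5 x≡ x-small refl))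
      where
      open Descending inv
      p m : Matrix Bool n
      p = P (X k)
      m = N (X k)

      c : Dir → Matrix Bool n
      c d = target? x (barrier (8 * (1 + n)) (edge (X k) d)) (λ i j → x i j ℤ.- offset d)

      x-small : Small x
      x-small = approximation-small {suc k} approximates

      eq : ∀ v → (v + v) + ((v + v) + (v + (v + (v + (v + (v + (v + (v + v)))))))) ≡ 12 * v
      eq = ℕ-solve-∀

    top : ∀ {σ} → Ascending ℓ σ → ∃[ σ′ ] Descending ℓ σ′ × Impl 1 (5 * V) topC σ σ′
    top {σ} inv = _ ,
      record
        { I≡ = I≡ ; R≡ = R≡ ; stackP≡ = stackP≡ ; stackN≡ = stackN≡ ; x≡ = refl ; Q≡ = refl ; O≡ = refl
        ; approximates = subst (λ s → Approximates Y s (start (O ∪ Z Y ∙ P Y) O Q)) scale top-approximates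
        ; negative     = subst (λ s → Detects Y s -1ℤ Q) scale top-negative
        ; nonpositive  = subst (λ s → Detects Y s 0ℤ O) scale top-nonpositive
        } ,
      impl-weaken {σ = σ} (ℕ.≤-reflexive (eq V))
        (fast 203 (impl-mul {A = Z Y} {N Y} 7 2 1 Z≡ N≡) then
         fast 66 (impl-or {A = Z Y} {Q} 8 2 7 Z≡ refl) then
         fast 203 (impl-mul {A = Z Y} {P Y} 5 2 0 Z≡ P≡) then
         fast 66 (impl-or {A = O} {Z Y ∙ P Y} 5 8 5 refl refl) then
         fast 66 (impl-start {R = O ∪ Z Y ∙ P Y} {O} {Q} 9 5 8 7 refl refl refl))
      where
      open Ascending inv
      Y = X ℓ
      open Top ℓ n<2^ℓ (X-saturated ℓ) using (top-approximates; top-negative; top-nonpositive)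

      Q O : Matrix Bool n
      Q = Z Y ∙ N Y
      O = Z Y ∪ Q

      scale : 1 ≡ 2 ^ (ℓ ∸ ℓ)
      scale = sym (cong (2 ^_) (ℕ.n∸n≡0 ℓ))

      eq : ∀ v → v + (v + (v + (v + v))) ≡ 5 * v
      eq = ℕ-solve-∀

    Answered : State n → Set
    Answered σ = ∃[ x ] ∃[ Q ] σ 9 ≡ x × σ 4 ≡ bits reach × σ 5 ≡ bits (unbounded Q) ×
      (∀ i j → IsDistance G i j (answer x Q i j))

    final : ∀ {σ} → Descending 0 σ → ∃[ σ′ ] Answered σ′ × Impl 1 (3 * V) finalC σ σ′
    final {σ} inv = _ , (x , Q , x≡ , R≡ , refl , answer-correct approximates negative) ,
      impl-weaken {σ = σ} (ℕ.≤-reflexive (eq V))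
        (fast 66 (impl-and {A = Q} {identity} 7 7 3 Q≡ I≡) then
         fast 203 (impl-mul {A = reach} {Q ∩ identity} 5 4 7 R≡ refl) then
         fast 203 (impl-mul {A = reach ∙ (Q ∩ identity)} {reach} 5 5 4 refl R≡))
      where
      open Descending inv
      eq : ∀ v → v + (v + v) ≡ 3 * v
      eq = ℕ-solve-∀

    E : Weight → Matrix Bool n
    E w i j = weighs w (G i j)

    Decoded : State n → Set
    Decoded σ = σ 0 ≡ bits (E 1ʷ) × σ 1 ≡ bits (E -1ʷ) × σ 2 ≡ bits (E 0ʷ) × σ 3 ≡ bits identity

    init : ∀ {σ} → Decoded σ → ∃[ σ′ ] Ascending 0 σ′ ×
      Impl 1 (8 * V) (clearC 10 ⨾ (clearC 11 ⨾ (reachC ⨾ firstC))) σ σ′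
    init {σ} (E₊ , E₋ , E₀ , I≡) = _ ,
      record { P≡ = refl ; N≡ = refl ; Z≡ = refl ; I≡ = I≡ ; R≡ = refl ; stackP≡ = refl ; stackN≡ = refl } ,
      impl-weaken {σ = σ} (ℕ.≤-reflexive (eq V))
        (fast 66 (impl-clear 10) then
         fast 66 (impl-clear 11) then
         (fast 66 (impl-or {A = E 1ʷ} {E -1ʷ} 4 0 1 E₊ E₋) then
          fast 66 (impl-or {A = E 1ʷ ∪ E -1ʷ} {E 0ʷ} 4 4 2 refl E₀) then
          impl-close {A = E 1ʷ ∪ E -1ʷ ∪ E 0ʷ} 3 4 I≡ refl) then
         (impl-close {A = E 0ʷ} 3 2 I≡ E₀ then
          fast 203 (impl-mul {A = E 1ʷ} {closure (E 0ʷ)} 0 0 2 E₊ refl) then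
          fast 203 (impl-mul {A = E -1ʷ} {closure (E 0ʷ)} 1 1 2 E₋ refl)))
      where
      eq : ∀ v → v + (v + ((v + (v + v)) + (v + (v + v)))) ≡ 8 * v
      eq = ℕ-solve-∀

    1≤V : 1 ≤ V
    1≤V = ℕ.≤-trans (ℕ.≤-trans (ℕ.≤-trans (s≤s z≤n) ≤U) (ℕ.≤-reflexive (sym (ℕ.*-identityˡ U)))) (U≤V 1)

    main-cost : 8 * V + ((10 + ℓ * (13 + 13 * V)) + (5 * V + ((10 + ℓ * (13 + 12 * V)) + 3 * V))) ≤ 88 * (Λ * V)
    main-cost = begin
      8 * V + ((10 + ℓ * (13 + 13 * V)) + (5 * V + ((10 + ℓ * (13 + 12 * V)) + 3 * V)))
        ≤⟨ ℕ.+-monoʳ-≤ (8 * V) (ℕ.+-mono-≤ (each 13) (ℕ.+-monoʳ-≤ (5 * V) (ℕ.+-monoˡ-≤ (3 * V) (each 12)))) ⟩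
      8 * V + ((10 * V + Λ * (13 * V + 13 * V)) + (5 * V + ((10 * V + Λ * (13 * V + 12 * V)) + 3 * V)))
        ≡⟨ eq V Λ ⟩
      36 * (1 * V) + 51 * (Λ * V)
        ≤⟨ ℕ.+-monoˡ-≤ (51 * (Λ * V)) (ℕ.*-monoʳ-≤ 36 (ℕ.*-monoˡ-≤ V 1≤Λ)) ⟩
      36 * (Λ * V) + 51 * (Λ * V)
        ≡⟨ ℕ.*-distribʳ-+ (Λ * V) 36 51 ⟨
      87 * (Λ * V)
        ≤⟨ ℕ.*-monoˡ-≤ (Λ * V) (ℕ.m≤m+n 87 1) ⟩
      88 * (Λ * V) ∎
      where
      open ℕ.≤-Reasoning

      each : ∀ k → 10 + ℓ * (13 + k * V) ≤ 10 * V + Λ * (13 * V + k * V)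
      each k = ℕ.+-mono-≤ (ℕ.*-monoʳ-≤ 10 1≤V) (ℕ.*-mono-≤ ℓ≤Λ (ℕ.+-monoˡ-≤ (k * V) (ℕ.*-monoʳ-≤ 13 1≤V)))

      eq : ∀ v l → 8 * v + ((10 * v + l * (13 * v + 13 * v)) + (5 * v + ((10 * v + l * (13 * v + 12 * v)) + 3 * v)))
           ≡ 36 * (1 * v) + 51 * (l * v)
      eq = ℕ-solve-∀

    exec-outcome : ∀ {t c σ μ} {Inv : State n → Set} → (∃[ σ′ ] Inv σ′ × Impl 1 t c σ σ′) →
      Bounded B μ → Rep σ μ → Exec c μ t (λ μ′ → ∃[ σ′ ] Inv σ′ × Rep σ′ μ′)
    exec-outcome (σ′ , inv , impl) bd rep = exec-weaken ℕ.≤-refl (λ (rep′ , _) → σ′ , inv , rep′) (impl bd rep)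

    exec-main : ∀ {σ μ} → Decoded σ → Bounded B μ → Rep σ μ →
      Exec mainC μ (88 * (Λ * V)) (λ μ′ → ∃[ σ′ ] Answered σ′ × Rep σ′ μ′)
    exec-main dec bd rep = exec-weaken main-cost (λ r → r)
      (exec-seq (exec-outcome (init dec) bd rep) λ μ₁ bd₁ (_ , asc₁ , rep₁) →
       exec-seq (exec-loop Ascending ascend asc₁ bd₁ rep₁) λ μ₂ bd₂ (_ , asc₂ , rep₂) →
       exec-seq (exec-outcome (top asc₂) bd₂ rep₂) λ μ₃ bd₃ (_ , desc₃ , rep₃) →
       -- The counter goes up while the level goes down.
       exec-seq (exec-loop (λ t → Descending (ℓ ∸ t)) descend-step desc₃ bd₃ rep₃) λ μ₄ bd₄ (σ₄ , desc₄ , rep₄) →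
       exec-outcome (final (subst (λ k → Descending k σ₄) (ℕ.n∸n≡0 ℓ) desc₄)) bd₄ rep₄)
      where
      descend-step : ∀ t {σ} → t < ℓ → Descending (ℓ ∸ t) σ →
        ∃[ σ′ ] Descending (ℓ ∸ suc t) σ′ × Impl 1 (12 * V) descendC σ σ′
      descend-step t {σ} t<ℓ desc = descend (ℓ ∸ suc t)
        (subst (_≤ ℓ) (ℕ.+-∸-assoc 1 t<ℓ) (ℕ.m∸n≤m ℓ t))
        (subst (λ k → Descending k σ) (ℕ.+-∸-assoc 1 t<ℓ) desc)

    weight-value : Weight ⁺ → ℤ
    weight-value Supremum.[ w ] = ⟦ w ⟧
    weight-value ⊤⁺             = 0ℤ

    ⇓-weight : ∀ g {t v μ} → Encodes t v (extended g) → μ ⊢ load 1 (reg 3) ⇓ t → μ ⊢ load 2 (reg 3) ⇓ v →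
      μ ⊢ weightE ⇓ weight-value g
    ⇓-weight Supremum.[ w ] {μ = μ} (refl , refl) p q = ⇓-cast (ℤ.*-identityˡ ⟦ w ⟧)
      (⇓-mul (⇓-sub (⇓-lit {z = 1ℤ} (lit≤ 1)) p (lit≤ 1)) q
        (subst (λ z → ∣ z ∣ ≤ B) (sym (ℤ.*-identityˡ ⟦ w ⟧)) (small-literal (ℕ.≤-trans (∣w∣≤1 w) (s≤s z≤n)))))
      where
      ∣w∣≤1 : ∀ w → ∣ ⟦ w ⟧ ∣ ≤ 1
      ∣w∣≤1 1ʷ  = ℕ.≤-refl
      ∣w∣≤1 0ʷ  = z≤n
      ∣w∣≤1 -1ʷ = ℕ.≤-refl
    ⇓-weight ⊤⁺ {v = v} {μ} refl p q = ⇓-cast (ℤ.*-zeroˡ v)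
      (⇓-mul (⇓-sub (⇓-lit {z = 1ℤ} (lit≤ 1)) p (lit≤ 0)) q (subst (λ z → ∣ z ∣ ≤ B) (sym (ℤ.*-zeroˡ v)) z≤n))

    ⇓-edge : ∀ w g {t v μ} → Encodes t v (extended g) → μ ⊢ load 1 (reg 3) ⇓ t → μ ⊢ load 2 (reg 3) ⇓ v →
      μ ⊢ edgeE w ⇓ bit (weighs w g)
    ⇓-edge 1ʷ g {t} {v} {μ} enc p q = cases g (⇓-weight g enc p q)
      where
      cases : ∀ g → μ ⊢ weightE ⇓ weight-value g → μ ⊢ edgeE 1ʷ ⇓ bit (weighs 1ʷ g)
      cases ⊤⁺                u = ⇓-op div (⇓-mul u (⇓-add u (⇓-lit {z = 1ℤ} (lit≤ 1)) (lit≤ 1)) (lit≤ 0)) (⇓-lit {z = + 2} (lit≤ 2)) (fit-just (lit≤ 0))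
      cases Supremum.[ 0ʷ ]  u = ⇓-op div (⇓-mul u (⇓-add u (⇓-lit {z = 1ℤ} (lit≤ 1)) (lit≤ 1)) (lit≤ 0)) (⇓-lit {z = + 2} (lit≤ 2)) (fit-just (lit≤ 0))
      cases Supremum.[ 1ʷ ]  u = ⇓-op div (⇓-mul u (⇓-add u (⇓-lit {z = 1ℤ} (lit≤ 1)) (lit≤ 2)) (lit≤ 2)) (⇓-lit {z = + 2} (lit≤ 2)) (fit-just (lit≤ 1))
      cases Supremum.[ -1ʷ ] u = ⇓-op div (⇓-mul u (⇓-add u (⇓-lit {z = 1ℤ} (lit≤ 1)) (lit≤ 0)) (lit≤ 0)) (⇓-lit {z = + 2} (lit≤ 2)) (fit-just (lit≤ 0))
    ⇓-edge -1ʷ g {t} {v} {μ} enc p q = cases g (⇓-weight g enc p q)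
      where
      cases : ∀ g → μ ⊢ weightE ⇓ weight-value g → μ ⊢ edgeE -1ʷ ⇓ bit (weighs -1ʷ g)
      cases ⊤⁺                u = ⇓-op div (⇓-mul u (⇓-sub u (⇓-lit {z = 1ℤ} (lit≤ 1)) (lit≤ 1)) (lit≤ 0)) (⇓-lit {z = + 2} (lit≤ 2)) (fit-just (lit≤ 0))
      cases Supremum.[ 0ʷ ]  u = ⇓-op div (⇓-mul u (⇓-sub u (⇓-lit {z = 1ℤ} (lit≤ 1)) (lit≤ 1)) (lit≤ 0)) (⇓-lit {z = + 2} (lit≤ 2)) (fit-just (lit≤ 0))
      cases Supremum.[ 1ʷ ]  u = ⇓-op div (⇓-mul u (⇓-sub u (⇓-lit {z = 1ℤ} (lit≤ 1)) (lit≤ 0)) (lit≤ 0)) (⇓-lit {z = + 2} (lit≤ 2)) (fit-just (lit≤ 0))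
      cases Supremum.[ -1ʷ ] u = ⇓-op div (⇓-mul u (⇓-sub u (⇓-lit {z = 1ℤ} (lit≤ 1)) (lit≤ 2)) (lit≤ 2)) (⇓-lit {z = + 2} (lit≤ 2)) (fit-just (lit≤ 1))
    ⇓-edge 0ʷ g {t} {v} {μ} enc p q = cases g enc (⇓-weight g enc p q)
      where
      cases : ∀ g → Encodes t v (extended g) → μ ⊢ weightE ⇓ weight-value g → μ ⊢ edgeE 0ʷ ⇓ bit (weighs 0ʷ g)
      cases ⊤⁺                refl       u = ⇓-sub (⇓-sub (⇓-lit {z = 1ℤ} (lit≤ 1)) p (lit≤ 0)) (⇓-mul u u (lit≤ 0)) (lit≤ 0)
      cases Supremum.[ 0ʷ ]  (refl , _) u = ⇓-sub (⇓-sub (⇓-lit {z = 1ℤ} (lit≤ 1)) p (lit≤ 1)) (⇓-mul u u (lit≤ 0)) (lit≤ 1)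
      cases Supremum.[ 1ʷ ]  (refl , _) u = ⇓-sub (⇓-sub (⇓-lit {z = 1ℤ} (lit≤ 1)) p (lit≤ 1)) (⇓-mul u u (lit≤ 1)) (lit≤ 0)
      cases Supremum.[ -1ʷ ] (refl , _) u = ⇓-sub (⇓-sub (⇓-lit {z = 1ℤ} (lit≤ 1)) p (lit≤ 1)) (⇓-mul u u (lit≤ 1)) (lit≤ 0)

    exec-decode : ∀ {σ μ} → Bounded B μ → Rep σ μ → StoresExtended μ 1 2 (λ i j → extended (G i j)) →
      Exec decodeC μ (198 * U) (λ μ′ → ∃[ σ′ ]
        (σ′ 0 ≡ bits (E 1ʷ) × σ′ 1 ≡ bits (E -1ʷ) × σ′ 2 ≡ bits (E 0ʷ)) × Rep σ′ μ′)
    exec-decode {μ = μ} bd rep enc = exec-weaken {t = 66 * U + (66 * U + 66 * U)} (ℕ.≤-reflexive (eq U)) (λ r → r)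
      (exec-seq (exec-fill-keep 0 (bits (E 1ʷ)) (ℕ.m≤m+n 23 27) bd rep (λ i j → ⇓-edge′ 1ʷ enc))
         λ μ₁ bd₁ ((rep₁ , _) , low₁) →
       exec-seq (exec-fill-keep 1 (bits (E -1ʷ)) (ℕ.m≤m+n 23 27) bd₁ rep₁ (λ i j → ⇓-edge′ -1ʷ (keep {μ} {μ₁} low₁ enc)))
         λ μ₂ bd₂ ((rep₂ , _) , low₂) →
       exec-weaken ℕ.≤-refl (λ (rep₃ , _) → _ , (refl , refl , refl) , rep₃)
         (exec-fill-private 2 (bits (E 0ʷ)) (ℕ.m≤m+n 25 25) bd₂ rep₂
           (λ i j → ⇓-edge′ 0ʷ (keep {μ₁} {μ₂} low₂ (keep {μ} {μ₁} low₁ enc)))))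
      where
      Encoded : Memory → Set
      Encoded μ = StoresExtended μ 1 2 (λ i j → extended (G i j))

      keep : ∀ {μ μ′} → (∀ b x → b < base → word μ′ b x ≡ word μ b x) → Encoded μ → Encoded μ′
      keep same enc i j = subst₂ (λ t v → Encodes t v (extended (G i j)))
        (sym (same 1 _ (low (ℕ.m≤m+n 2 3)))) (sym (same 2 _ (low (ℕ.m≤m+n 3 2)))) (enc i j)

      ⇓-edge′ : ∀ w {σ i j μ₀ μ} → Encoded μ₀ → Env σ i j μ₀ μ → μ ⊢ edgeE w ⇓ bit (E w i j)
      ⇓-edge′ w {i = i} {j} enc env = ⇓-edge w (G i j) (enc i j)
        (⇓-low env (low (ℕ.m≤m+n 2 3))) (⇓-low env (low (ℕ.m≤m+n 3 2)))

      eq : ∀ u → 66 * u + (66 * u + 66 * u) ≡ 198 * u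
      eq = ℕ-solve-∀

    exec-diagonal : ∀ {σ μ} → Bounded B μ → Rep σ μ →
      Exec diagonalC μ (99 * U) (λ μ′ → Rep (assign σ 3 (bits identity)) μ′)
    exec-diagonal {σ} {μ} bd rep = exec-weaken {t = 66 * U + (10 + n * (13 + 10))} cost (λ r → r)
      (exec-seq (exec-fill-private 3 (λ _ _ → 0ℤ) (s≤s z≤n) bd rep (λ _ _ _ → ⇓-lit z≤n))
       λ μ₁ bd₁ (rep₁ , _) → exec-weaken ℕ.≤-refl
        (λ (v , rep′ , done , _) → rep-cong (assign-cong v (λ i j → done i j (Fin.toℕ<n i))) rep′)
        (exec-for {r = 4} {0} {n} (small-literal (ℕ.m≤m+n 4 12)) (small-literal z≤n) n<B Inv
          (λ (v , rep′ , p) → v , rep-counter 4 ℕ.≤-refl rep′ , p) (λ (_ , rep′ , _) → reg-n rep′)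
          (λ {t} {μ} → body {t} {μ}) bd₁
          ((λ _ _ → 0ℤ) , rep₁ , (λ _ _ ()) , λ _ _ _ → refl)))
      where
      Inv : ℕ → Memory → Set
      -- Rows before `t` are finished and the others are still zero, which is what the cells off the
      -- diagonal of row `t` need.
      Inv t μ = ∃[ v ] Rep (assign σ 3 v) μ × (∀ i j → toℕ i < t → v i j ≡ bit (identity i j)) ×
                (∀ i j → t ≤ toℕ i → v i j ≡ 0ℤ)

      assign-cong : ∀ v {w : Matrix ℤ n} → (∀ i j → v i j ≡ w i j) → ∀ a i j → assign σ 3 v a i j ≡ assign σ 3 w a i j
      assign-cong v {w} eq a i j = cases (3 ℕ.≡ᵇ a)
        where
        cases : ∀ b → (if b then v else σ a) i j ≡ (if b then w else σ a) i j
        cases true  = eq i j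
        cases false = refl

      body : ∀ {t μ} → t < n → Bounded B μ → Inv t μ → word μ base 4 ≡ + t →
        Exec (store (arr 3) (op add (op mul (reg 4) (reg 0)) (reg 4)) (lit 1ℤ)) μ 10
          (λ μ′ → Inv (suc t) μ′ × word μ′ base 4 ≡ + t)
      body {t} {μ} t<n bd (v , rep , done , todo) at = exec-weaken {t = 10} ℕ.≤-refl
        (λ { refl → (cells , rep-overwrite {σ} {3} {v} (rep-assign
               (λ b x _ _ b≢ → update-other (word μ) (arr 3) k (inj₁ b≢)) (λ _ _ → refl) rep) , done′ , todo′) ,
             trans (update-other (word μ) (arr 3) k (inj₁ (arr≢base 3 ∘ sym))) at })
        (exec-store {i = k} bd at-index (⇓-lit {z = 1ℤ} (lit≤ 1)))
        where
        i : Fin n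
        i = fromℕ< t<n

        k : ℕ
        k = index i i

        k≡ : t * n + t ≡ k
        k≡ = cong (λ y → y * n + y) (sym (Fin.toℕ-fromℕ< t<n))

        k<n² : t * n + t < n * n
        k<n² = subst (_< n * n) (sym k≡) (index-< i i)

        at-index : μ ⊢ op add (op mul (reg 4) (reg 0)) (reg 4) ⇓ + k
        at-index = ⇓-cast (cong +_ k≡) (⇓-add
          (⇓-cast (sym (ℤ.pos-* t n)) (⇓-mul
            (⇓-reg {μ} (small-literal (ℕ.m≤m+n 4 12)) at) (⇓-reg {μ} (small-literal z≤n) (reg-n rep))
            (subst (λ z → ∣ z ∣ ≤ B) (ℤ.pos-* t n)
              (ℕ.≤-trans (ℕ.m≤m+n (t * n) t) (ℕ.≤-trans (ℕ.<⇒≤ k<n²) (ℕ.<⇒≤ n²<B))))))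
          (⇓-reg {μ} (small-literal (ℕ.m≤m+n 4 12)) at)
          (ℕ.≤-trans (ℕ.<⇒≤ k<n²) (ℕ.<⇒≤ n²<B)))

        cells : Matrix ℤ n
        cells j l = (word μ [ arr 3 , k ↦ 1ℤ ]) (arr 3) (index j l)

        old : ∀ j l → index j l ≢ k → cells j l ≡ v j l
        old j l ne = trans (update-other (word μ) (arr 3) k (inj₂ ne)) (entries rep 3 j l)

        done′ : ∀ j l → toℕ j < suc t → cells j l ≡ bit (identity j l)
        done′ j l j≤t = cases (index j l ℕ.≟ k) (toℕ j ℕ.≟ t)
          where
          j≡i : toℕ j ≡ t → j ≡ i
          j≡i j≡t = Fin.toℕ-injective (trans j≡t (sym (Fin.toℕ-fromℕ< t<n)))

          off-diagonal : j ≡ i → index j l ≢ k → identity j l ≡ false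
          off-diagonal j≡i ne = ¬-not λ eq → ne (cong₂ index j≡i (trans (sym (identity⇒≡ j l eq)) j≡i))

          cases : Dec (index j l ≡ k) → Dec (toℕ j ≡ t) → cells j l ≡ bit (identity j l)
          cases (yes eq) _ = let j≡i , l≡i = index-injective j l i i eq in
            trans (cong ((word μ [ arr 3 , k ↦ 1ℤ ]) (arr 3)) eq)
              (trans (update-same (word μ) (arr 3) k)
                (cong bit (sym (trans (cong₂ identity j≡i l≡i) (identity-refl i)))))
          cases (no ne) (no j≢t)  = trans (old j l ne) (done j l (ℕ.≤∧≢⇒< (ℕ.≤-pred j≤t) j≢t))
          cases (no ne) (yes j≡t) = trans (old j l ne) (trans (todo j l (ℕ.≤-reflexive (sym j≡t)))
            (cong bit (sym (off-diagonal (j≡i j≡t) ne))))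

        todo′ : ∀ j l → suc t ≤ toℕ j → cells j l ≡ 0ℤ
        todo′ j l t<j = trans (old j l (λ eq → ℕ.<-irrefl
          (trans (sym (Fin.toℕ-fromℕ< t<n)) (cong toℕ (sym (proj₁ (index-injective j l i i eq))))) t<j))
          (todo j l (ℕ.<⇒≤ t<j))

      n<B : suc n ≤ B
      n<B = small-linear 1 1 (s≤s z≤n) (s≤s z≤n) (ℕ.≤-reflexive (eq n))
        where
        eq : ∀ n → suc n ≡ 1 * n + 1
        eq = ℕ-solve-∀

      cost : 66 * U + (10 + n * (13 + 10)) ≤ 99 * U
      cost = ℕ.≤-trans (ℕ.+-monoʳ-≤ (66 * U) (ℕ.+-mono-≤ (ℕ.*-monoʳ-≤ 10 1≤U)
               (ℕ.≤-trans (ℕ.≤-reflexive (ℕ.*-comm n 23)) (ℕ.*-monoʳ-≤ 23 n≤U)))) (ℕ.≤-reflexive (eq U))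
        where
        n≤n² : ∀ n → n ≤ n * n
        n≤n² zero    = z≤n
        n≤n² (suc n) = ℕ.m≤m*n (suc n) (suc n)

        n≤U : n ≤ U
        n≤U = ℕ.≤-trans (ℕ.≤-trans (n≤n² n) (ℕ.≤-trans (ℕ.n≤1+n (n * n)) (ℕ.m≤m+n (1 + n * n) (fₙ + Tₙ)))) ≤U

        eq : ∀ u → 66 * u + (10 * u + 23 * u) ≡ 99 * u
        eq = ℕ-solve-∀

    exec-output : ∀ {σ μ} → Bounded B μ → Rep σ μ → Answered σ →
      Exec outputC μ (132 * U) (λ μ′ → Σ[ D ∈ Matrix (ℤ ±) n ] StoresExtended μ′ 3 4 D × (∀ i j → IsDistance G i j (D i j)))
    exec-output {σ} {μ} bd rep (x , Q , x≡ , R≡ , U≡ , correct) =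
      exec-weaken {t = 66 * U + 66 * U} (ℕ.≤-reflexive (sym (ℕ.*-distribʳ-+ U 66 66))) (λ r → r)
        (exec-seq (exec-fill-low 3 kind (low (ℕ.m≤m+n 4 1)) (ℕ.m≤m+n 11 39) bd rep
            (λ i j env → ⇓-kind (reach i j) (unbounded Q i j) (⇓-bits 4 R≡ env) (⇓-bits 5 U≡ env)))
          λ μ₁ bd₁ (kind₁ , (rep₁ , _) , _) → exec-weaken ℕ.≤-refl
            (λ (x₂ , _ , low₂) → answer x Q , (λ i j → encodes i j
                (trans (low₂ 3 _ (low (ℕ.m≤m+n 4 1)) (λ ())) (kind₁ i j)) (x₂ i j)) , correct)
            (exec-fill-low 4 x 5≤base (ℕ.m≤m+n 3 47) bd₁ rep₁ (λ i j → ⇓-value 9 x≡)))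
      where
      kind-of : Bool → Bool → ℤ
      kind-of r u = 1ℤ ℤ.- (bit r ℤ.* (1ℤ ℤ.+ bit u))

      kind : Matrix ℤ n
      kind i j = kind-of (reach i j) (unbounded Q i j)

      ⇓-kind : ∀ r u {μ e f} → μ ⊢ e ⇓ bit r → μ ⊢ f ⇓ bit u →
        μ ⊢ op sub (lit 1ℤ) (op mul e (op add (lit 1ℤ) f)) ⇓ kind-of r u
      ⇓-kind true  true  p q = ⇓-sub (⇓-lit {z = 1ℤ} (lit≤ 1)) (⇓-mul p (⇓-add (⇓-lit {z = 1ℤ} (lit≤ 1)) q (lit≤ 2)) (lit≤ 2)) (lit≤ 1)
      ⇓-kind true  false p q = ⇓-sub (⇓-lit {z = 1ℤ} (lit≤ 1)) (⇓-mul p (⇓-add (⇓-lit {z = 1ℤ} (lit≤ 1)) q (lit≤ 1)) (lit≤ 1)) (lit≤ 0)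
      ⇓-kind false true  p q = ⇓-sub (⇓-lit {z = 1ℤ} (lit≤ 1)) (⇓-mul p (⇓-add (⇓-lit {z = 1ℤ} (lit≤ 1)) q (lit≤ 2)) (lit≤ 0)) (lit≤ 1)
      ⇓-kind false false p q = ⇓-sub (⇓-lit {z = 1ℤ} (lit≤ 1)) (⇓-mul p (⇓-add (⇓-lit {z = 1ℤ} (lit≤ 1)) q (lit≤ 1)) (lit≤ 0)) (lit≤ 1)

      encodes : ∀ i j {t v} → t ≡ kind i j → v ≡ x i j → Encodes t v (answer x Q i j)
      encodes i j eq eqx with reach i j | unbounded Q i j
      ... | true  | true  = eq
      ... | true  | false = eq , eqx
      ... | false | true  = eq
      ... | false | false = eq

-- Computing the number of levels

module Sizes (base n B Λ : ℕ) (5≤base : 5 ≤ base) (n²<B : suc (n * n) ≤ B) (capacity : 32 * (2 + n) ≤ B)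
             (log-bound : ∀ i → 2 ^ i ≤ n → suc i ≤ Λ) where

  open Registers B base
  -- These two commands call neither of the given programs, so `skip` can stand in for both.
  open Program skip skip base using (powerC; sizesC)

  private
    small : ∀ {m} → m ≤ 32 → m ≤ B
    small le = linear≤capacity capacity 0 32 z≤n ℕ.≤-refl le

    double-fits : ∀ {m} → m ≤ n → m + m ≤ suc (n + n)
    double-fits le = ℕ.≤-trans (ℕ.+-mono-≤ le le) (ℕ.n≤1+n _)

    2n+1≤B : suc (n + n) ≤ B
    2n+1≤B = linear≤capacity capacity 2 1 (ℕ.m≤m+n 2 30) (ℕ.m≤m+n 1 31) (ℕ.≤-reflexive (suc-double n))

    other : ∀ μ r {v r′} → r′ ≢ r → word (μ [ r := v ]) base r′ ≡ word μ base r′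
    other μ r ne = update-other (word μ) base r (inj₂ ne)

    2^suc : ∀ i → 2 ^ suc i ≡ 2 ^ i + 2 ^ i
    2^suc i = cong (λ y → 2 ^ i + y) (ℕ.+-identityʳ (2 ^ i))

    advance : ∀ {i μ} → 2 ^ i ≤ n → suc i ≤ B → Bounded B μ →
      word μ base 0 ≡ + n → word μ base 1 ≡ + (n * n) → word μ base 2 ≡ + i → word μ base 3 ≡ + (2 ^ i) →
      Exec (set 3 (op add (reg 3) (reg 3)) ⨾ set 2 (op add (reg 2) (lit 1ℤ))) μ 13 (λ μ′ →
      word μ′ base 0 ≡ + n × word μ′ base 1 ≡ + (n * n) × word μ′ base 2 ≡ + suc i ×
      word μ′ base 3 ≡ + (2 ^ suc i) × (∀ b x → b ≢ base → word μ′ b x ≡ word μ b x))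
    advance {i} {μ} 2^i≤n i<B bd r0 r1 r2 r3 = exec-seq {t = 7} {6}
      (exec-set bd (small (ℕ.m≤m+n 3 29))
        (⇓-add (⇓-reg {μ} (small (ℕ.m≤m+n 3 29)) r3) (⇓-reg {μ} (small (ℕ.m≤m+n 3 29)) r3)
          (ℕ.≤-trans (double-fits 2^i≤n) 2n+1≤B)))
      λ { μ′ bd′ refl → exec-weaken {t = 6} ℕ.≤-refl
        (λ { refl →
          trans (other μ′ 2 (λ ())) (trans (other μ 3 (λ ())) r0) ,
          trans (other μ′ 2 (λ ())) (trans (other μ 3 (λ ())) r1) ,
          trans (update-same (word μ′) base 2) (cong +_ (ℕ.+-comm i 1)) ,
          trans (other μ′ 2 (λ ())) (trans (update-same (word μ) base 3) (cong +_ (sym (2^suc i)))) ,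
          λ b x b≢ → trans (update-other (word μ′) base 2 (inj₁ b≢)) (update-other (word μ) base 3 (inj₁ b≢)) })
        (exec-set {μ′} bd′ (small (ℕ.m≤m+n 2 30))
          (⇓-add (⇓-reg {μ′} (small (ℕ.m≤m+n 2 30)) (trans (other μ 3 (λ ())) r2)) (⇓-lit {μ′} {1ℤ} (small (s≤s z≤n)))
            (ℕ.≤-trans (ℕ.≤-reflexive (ℕ.+-comm i 1)) i<B))) }

    fuel-step : ∀ {i m} → n < 2 ^ i + suc m → n < 2 ^ suc i + m
    fuel-step {i} {m} fuel = ℕ.<-≤-trans fuel (ℕ.≤-trans (ℕ.≤-reflexive (ℕ.+-suc (2 ^ i) m))
      (ℕ.+-monoˡ-≤ m (ℕ.≤-trans (ℕ.+-monoˡ-≤ (2 ^ i) (ℕ.m^n>0 2 i)) (ℕ.≤-reflexive (sym (2^suc i))))))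

    power-cost : ∀ {i} → suc i ≤ Λ → 5 + (13 + (5 + 18 * (Λ ∸ suc i))) ≡ 5 + 18 * (Λ ∸ i)
    power-cost {i} i<Λ = trans (eq (Λ ∸ suc i)) (cong (λ y → 5 + 18 * y) (sym (ℕ.+-∸-assoc 1 i<Λ)))
      where
      eq : ∀ y → 5 + (13 + (5 + 18 * y)) ≡ 5 + 18 * (1 + y)
      eq = ℕ-solve-∀

  Sized : Memory → Memory → Set
  Sized μ μ′ = ∃[ ℓ ] (n < 2 ^ ℓ × 2 ^ ℓ ≤ suc (n + n) × ℓ ≤ Λ) ×
    (word μ′ base 0 ≡ + n × word μ′ base 1 ≡ + (n * n) × word μ′ base 2 ≡ + ℓ) ×
    (∀ b x → b ≢ base → word μ′ b x ≡ word μ b x)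

  -- `m` is fuel for the recursion: doubling raises `2 ^ i` by at least 1. The running time comes
  -- instead from `Λ ∸ i`, with 5 for the test and 13 for the body. A power that was at most `n`
  -- before the last doubling is at most `2n` after it.
  exec-power : ∀ m i {μ} → n < 2 ^ i + m → 2 ^ i ≤ suc (n + n) → i ≤ Λ → Bounded B μ →
    word μ base 0 ≡ + n → word μ base 1 ≡ + (n * n) → word μ base 2 ≡ + i → word μ base 3 ≡ + (2 ^ i) →
    Exec powerC μ (5 + 18 * (Λ ∸ i)) (Sized μ)

  power-step : ∀ m i {μ} → Dec (2 ^ i ≤ n) → n < 2 ^ i + m → 2 ^ i ≤ suc (n + n) → i ≤ Λ → Bounded B μ →
    word μ base 0 ≡ + n → word μ base 1 ≡ + (n * n) → word μ base 2 ≡ + i → word μ base 3 ≡ + (2 ^ i) →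
    Exec powerC μ (5 + 18 * (Λ ∸ i)) (Sized μ)

  exec-power m i {μ} = power-step m i {μ} (2 ^ i ℕ.≤? n)

  power-step m i {μ} (no 2^i≰n) fuel fits i≤Λ bd r0 r1 r2 r3 =
    exec-weaken {t = 5} (ℕ.m≤m+n 5 (18 * (Λ ∸ i))) (λ r → r)
      (exec-while-stop bd (⇓-reg {μ} (small (ℕ.m≤m+n 3 29)) r3) (⇓-reg {μ} (small z≤n) r0) (ℤ.+<+ (ℕ.≰⇒> 2^i≰n))
        (i , (ℕ.≰⇒> 2^i≰n , fits , i≤Λ) , (r0 , r1 , r2) , λ _ _ _ → refl))
  power-step zero i (yes 2^i≤n) fuel _ _ _ _ _ _ _ =
    contradiction (subst (n <_) (ℕ.+-identityʳ (2 ^ i)) fuel) (ℕ.≤⇒≯ 2^i≤n)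
  power-step (suc m) i {μ} (yes 2^i≤n) fuel fits i≤Λ bd r0 r1 r2 r3 =
    exec-weaken {t = 5 + (13 + (5 + 18 * (Λ ∸ suc i)))} (ℕ.≤-reflexive (power-cost (log-bound i 2^i≤n))) (λ r → r)
      (exec-while-step {t = 13} {5 + 18 * (Λ ∸ suc i)}
        (⇓-reg {μ} (small (ℕ.m≤m+n 3 29)) r3) (⇓-reg {μ} (small z≤n) r0) (+≤+ 2^i≤n)
        (advance {i} {μ} 2^i≤n (ℕ.≤-trans (n<2^n i) (ℕ.≤-trans fits 2n+1≤B)) bd r0 r1 r2 r3)
        λ μ₁ bd₁ (s0 , s1 , s2 , s3 , same) → exec-weaken ℕ.≤-refl
          (λ (ℓ , bounds , regs , same′) → ℓ , bounds , regs , λ b x b≢ → trans (same′ b x b≢) (same b x b≢))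
          (exec-power m (suc i) {μ₁} (fuel-step {i} {m} fuel)
            (ℕ.≤-trans (ℕ.≤-reflexive (2^suc i)) (double-fits 2^i≤n)) (log-bound i 2^i≤n) bd₁ s0 s1 s2 s3))

  exec-sizes : ∀ {μ} → Bounded B μ → word μ 0 0 ≡ + n → Exec sizesC μ (22 + 18 * Λ) (Sized μ)
  exec-sizes {μ} bd n₀ = exec-weaken {t = 4 + (7 + (3 + (3 + (5 + 18 * Λ))))} ℕ.≤-refl (λ r → r)
    (exec-seq {t = 4} (exec-set {μ} bd (small z≤n) (⇓-load 0 (⇓-lit z≤n))) λ { μ₁ bd₁ refl →
     exec-seq {t = 7} (exec-set {μ₁} bd₁ (small (ℕ.m≤m+n 1 31))
         (⇓-mul (⇓-reg {μ₁} (small z≤n) r0) (⇓-reg {μ₁} (small z≤n) r0)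
           (ℕ.≤-trans (ℕ.≤-reflexive (cong ∣_∣ (sym (ℤ.pos-* n n)))) (ℕ.<⇒≤ n²<B)))) λ { μ₂ bd₂ refl →
     exec-seq {t = 3} (exec-set {μ₂} bd₂ (small (ℕ.m≤m+n 2 30)) (⇓-lit z≤n)) λ { μ₃ bd₃ refl →
     exec-seq {t = 3} (exec-set {μ₃} bd₃ (small (ℕ.m≤m+n 3 29)) (⇓-lit {z = 1ℤ} (small (s≤s z≤n)))) λ { μ₄ bd₄ refl →
     exec-weaken ℕ.≤-refl
       (λ (ℓ , bounds , regs , same) → ℓ , bounds , regs , λ b x b≢ → trans (same b x b≢)
         (trans (update-other (word μ₃) base 3 (inj₁ b≢)) (trans (update-other (word μ₂) base 2 (inj₁ b≢))
           (trans (update-other (word μ₁) base 1 (inj₁ b≢)) (update-other (word μ) base 0 (inj₁ b≢))))))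
       (exec-power (suc n) 0 {μ₄} (ℕ.n≤1+n (suc n))
         (s≤s z≤n) z≤n bd₄
         (trans (other μ₃ 3 (λ ())) (trans (other μ₂ 2 (λ ())) (trans (other μ₁ 1 (λ ())) r0)))
         (trans (other μ₃ 3 (λ ())) (trans (other μ₂ 2 (λ ()))
           (trans (update-same (word μ₁) base 1) (sym (ℤ.pos-* n n)))))
         (trans (other μ₃ 3 (λ ())) (update-same (word μ₂) base 2))
         (update-same (word μ₃) base 3)) } } } })
    where
    r0 : word (μ [ 0 := word μ 0 0 ]) base 0 ≡ + n
    r0 = trans (update-same (word μ) base 0) n₀

-- The complete program

module _
  (mm tmm : Cmd) (base n B fₙ Tₙ Λ : ℕ)
  (5≤base : 5 ≤ base) (mm-writes : writes mm ≤ base) (tmm-writes : writes tmm ≤ base)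
  (n²<B : suc (n * n) ≤ B) (capacity : 32 * (2 + n) ≤ B)
  (log-bound : ∀ i → 2 ^ i ≤ n → suc i ≤ Λ) (1≤Λ : 1 ≤ Λ)
  (mm-correct : Correct mm (MatMul 0) n B fₙ) (tmm-correct : Correct tmm TargetMinMax n B Tₙ)
  where

  open Machine B using (Exec; exec-seq; exec-weaken)
  open Program mm tmm base using (apspC)

  exec-apsp : ∀ U V (G : Graph n) {μ} → 1 + n * n + (fₙ + Tₙ) ≤ U → 1000 * (Λ * U) ≤ V →
    Bounded B μ → word μ 0 0 ≡ + n → StoresExtended μ 1 2 (λ i j → extended (G i j)) →
    Exec apspC μ ((22 + 18 * Λ) + (198 * U + (99 * U + (88 * (Λ * V) + 132 * U)))) (λ μ′ →
      Σ[ D ∈ Matrix (ℤ ±) n ] StoresExtended μ′ 3 4 D × (∀ i j → IsDistance G i j (D i j)))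
  exec-apsp U V G {μ} ≤U ≤V bd n₀ enc =
    exec-seq (Sizes.exec-sizes base n B Λ 5≤base n²<B capacity log-bound {μ} bd n₀)
    λ { μ₁ bd₁ (ℓ , (n<2^ℓ , 2^ℓ≤ , ℓ≤Λ) , (r0 , r1 , r2) , same) → rest μ₁ bd₁ ℓ n<2^ℓ 2^ℓ≤ ℓ≤Λ r0 r1 r2
      (λ i j → subst₂ (λ t v → Encodes t v (extended (G i j)))
        (sym (same 1 _ (low≢ (ℕ.m≤m+n 2 3)))) (sym (same 2 _ (low≢ (ℕ.m≤m+n 3 2)))) (enc i j)) }
    where
    low≢ : ∀ {a} → a < 5 → a ≢ base
    low≢ lt = ℕ.<⇒≢ (ℕ.<-≤-trans lt 5≤base)

    rest : ∀ μ₁ → Bounded B μ₁ → ∀ ℓ → n < 2 ^ ℓ → 2 ^ ℓ ≤ suc (n + n) → ℓ ≤ Λ →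
      word μ₁ base 0 ≡ + n → word μ₁ base 1 ≡ + (n * n) → word μ₁ base 2 ≡ + ℓ →
      StoresExtended μ₁ 1 2 (λ i j → extended (G i j)) →
      Exec _ μ₁ (198 * U + (99 * U + (88 * (Λ * V) + 132 * U))) (λ μ′ →
        Σ[ D ∈ Matrix (ℤ ±) n ] StoresExtended μ′ 3 4 D × (∀ i j → IsDistance G i j (D i j)))
    rest μ₁ bd₁ ℓ n<2^ℓ 2^ℓ≤ ℓ≤Λ r0 r1 r2 enc₁ =
      exec-seq (exec-decode G {σ₁} bd₁ rep₁ enc₁) λ μ₂ bd₂ (σ₂ , (E₊ , E₋ , E₀) , rep₂) →
      exec-seq (exec-diagonal G {σ₂} bd₂ rep₂) λ μ₃ bd₃ rep₃ →
      exec-seq (exec-main G {assign σ₂ 3 (bits identity)} (E₊ , E₋ , E₀ , refl) bd₃ rep₃) λ μ₄ bd₄ (σ₄ , answered , rep₄) →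
      exec-output G {σ₄} bd₄ rep₄ answered
      where
      open Main mm tmm base n B fₙ Tₙ ℓ Λ U V 5≤base mm-writes tmm-writes n²<B capacity
        n<2^ℓ 2^ℓ≤ ℓ≤Λ 1≤Λ ≤U ≤V mm-correct tmm-correct
        using (exec-decode; exec-diagonal; exec-main; exec-output; arr; Rep)

      -- The private arrays start with arbitrary contents, so the initial state is read off the
      -- memory.
      σ₁ : State n
      σ₁ a i j = word μ₁ (arr a) (index i j)

      rep₁ : Rep σ₁ μ₁
      rep₁ = record { reg-n = r0 ; reg-n² = r1 ; reg-ℓ = r2 ; entries = λ _ _ _ → refl }

-- Running time

-- One factor `Λ` comes from the two main loops, the other from the squarings within each closure,
-- which are hidden in `c * (Λ * U)`.
total-cost : ∀ Λ U c → 1 ≤ Λ → 1 ≤ U →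
  (22 + 18 * Λ) + (198 * U + (99 * U + (88 * (Λ * (c * (Λ * U))) + 132 * U))) ≤ (500 + 88 * c) * (Λ * Λ * U)
total-cost Λ U c 1≤Λ 1≤U = begin
  (22 + 18 * Λ) + (198 * U + (99 * U + (88 * (Λ * (c * (Λ * U))) + 132 * U)))
    ≡⟨ eq₁ Λ U c ⟩
  22 * 1 + 18 * Λ + 429 * U + 88 * c * (Λ * Λ * U)
    ≤⟨ ℕ.+-monoˡ-≤ (88 * c * (Λ * Λ * U)) (ℕ.+-mono-≤ (ℕ.+-mono-≤ (ℕ.*-monoʳ-≤ 22 1≤W) (ℕ.*-monoʳ-≤ 18 Λ≤W)) (ℕ.*-monoʳ-≤ 429 U≤W)) ⟩
  22 * (Λ * Λ * U) + 18 * (Λ * Λ * U) + 429 * (Λ * Λ * U) + 88 * c * (Λ * Λ * U)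
    ≡⟨ eq₂ (Λ * Λ * U) c ⟩
  (469 + 88 * c) * (Λ * Λ * U)
    ≤⟨ ℕ.*-monoˡ-≤ (Λ * Λ * U) (ℕ.+-monoˡ-≤ (88 * c) (ℕ.m≤m+n 469 31)) ⟩
  (500 + 88 * c) * (Λ * Λ * U) ∎
  where
  open ℕ.≤-Reasoning

  1≤Λ² : 1 ≤ Λ * Λ
  1≤Λ² = ℕ.*-mono-≤ 1≤Λ 1≤Λ

  U≤W : U ≤ Λ * Λ * U
  U≤W = ℕ.≤-trans (ℕ.≤-reflexive (sym (ℕ.*-identityˡ U))) (ℕ.*-monoˡ-≤ U 1≤Λ²)

  1≤W : 1 ≤ Λ * Λ * U
  1≤W = ℕ.≤-trans 1≤U U≤W

  Λ≤W : Λ ≤ Λ * Λ * U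
  Λ≤W = ℕ.≤-trans (ℕ.≤-reflexive (sym (trans (ℕ.*-identityʳ (Λ * 1)) (ℕ.*-identityʳ Λ))))
    (ℕ.*-mono-≤ (ℕ.*-monoʳ-≤ Λ 1≤Λ) 1≤U)

  eq₁ : ∀ l u c → (22 + 18 * l) + (198 * u + (99 * u + (88 * (l * (c * (l * u))) + 132 * u))) ≡
        22 * 1 + 18 * l + 429 * u + 88 * c * (l * l * u)
  eq₁ = ℕ-solve-∀

  eq₂ : ∀ w c → 22 * w + 18 * w + 429 * w + 88 * c * w ≡ (469 + 88 * c) * w
  eq₂ = ℕ-solve-∀

^-distribʳ-* : ∀ q m n → (m * n) ^ q ≡ m ^ q * n ^ q
^-distribʳ-* zero    m n = refl
^-distribʳ-* (suc q) m n = trans (cong (λ y → m * n * y) (^-distribʳ-* q m n)) (ℕ.[m*n]*[o*p]≡[m*o]*[n*p] m n (m ^ q) (n ^ q))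

time : ℕ → (ℕ → ℕ) → (ℕ → ℕ) → ℕ → ℕ
time K f T n = K * ((1 + ⌊log₂ n ⌋) * (1 + ⌊log₂ n ⌋) * (1 + n * n + (f n + T n)))

-- `T n ≥ n²` absorbs the passes over matrices, so three terms are charged to `T` and only `f` to
-- the power of `n`. The threshold is at least 1 in order that `1 ≤ T n`.
time-∈Õ : ∀ K f T ω → f ∈O[n^ ω ] → (∀ n → n ^ 2 ≤ T n) → time K f T ∈Õ[ T +n^ ω ]
time-∈Õ K f T ω (C , N , f≤) n²≤T = K * (3 + C) , 2 , N ⊔ 1 , bound
  where
  bound : ∀ n → N ⊔ 1 ≤ n → time K f T n ≤ K * (3 + C) * (1 + ⌊log₂ n ⌋) ^ 2 ·⟨ T n + n ^ ω ⟩
  bound n N≤n p q ω<p/q = begin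
    -- Subtracting the share of `T` leaves at most `A * f n`; since both shares must use one
    -- constant, it is `3 + C` up to `K` and logarithms.
    (time K f T n ∸ K * (3 + C) * L ^ 2 * T n) ^ q ≤⟨ ℕ.^-monoˡ-≤ q (ℕ.m≤n+o⇒m∸n≤o _ (K * (3 + C) * L ^ 2 * T n) time≤) ⟩
    (A * f n) ^ q                                  ≡⟨ ^-distribʳ-* q A (f n) ⟩
    A ^ q * f n ^ q                                ≤⟨ ℕ.*-monoʳ-≤ (A ^ q) f^q≤ ⟩
    A ^ q * (C ^ q * n ^ p)                        ≡⟨ ℕ.*-assoc (A ^ q) (C ^ q) (n ^ p) ⟨
    A ^ q * C ^ q * n ^ p                          ≡⟨ cong (_* n ^ p) (^-distribʳ-* q A C) ⟨
    (A * C) ^ q * n ^ p                            ≤⟨ ℕ.*-monoˡ-≤ (n ^ p) (ℕ.^-monoˡ-≤ q AC≤) ⟩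
    (K * (3 + C) * L ^ 2) ^ q * n ^ p              ∎
    where
    open ℕ.≤-Reasoning

    L A : ℕ
    L = 1 + ⌊log₂ n ⌋
    A = K * (L * L)

    1≤n : 1 ≤ n
    1≤n = ℕ.≤-trans (ℕ.m≤n⊔m N 1) N≤n

    f^q≤ : f n ^ q ≤ C ^ q * n ^ p
    f^q≤ = subst (λ z → (f n ∸ z) ^ q ≤ C ^ q * n ^ p) (ℕ.*-zeroʳ C)
      (f≤ n (ℕ.≤-trans (ℕ.m≤m⊔n N 1) N≤n) p q ω<p/q)

    n*n≤T : n * n ≤ T n
    n*n≤T = subst (λ z → n * z ≤ T n) (ℕ.*-identityʳ n) (n²≤T n)

    1≤T : 1 ≤ T n
    1≤T = ℕ.≤-trans (ℕ.*-mono-≤ 1≤n 1≤n) n*n≤T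

    time≤ : time K f T n ≤ K * (3 + C) * L ^ 2 * T n + A * f n
    time≤ = begin
      K * (L * L * (1 + n * n + (f n + T n)))   ≤⟨ ℕ.*-monoʳ-≤ K (ℕ.*-monoʳ-≤ (L * L) (ℕ.+-monoˡ-≤ (f n + T n) (ℕ.+-mono-≤ 1≤T n*n≤T))) ⟩
      K * (L * L * (T n + T n + (f n + T n)))   ≡⟨ eq₁ K L (f n) (T n) ⟩
      K * 3 * (L * L) * T n + A * f n           ≤⟨ ℕ.+-monoˡ-≤ (A * f n) (ℕ.m≤m+n _ (K * C * (L * L) * T n)) ⟩
      K * 3 * (L * L) * T n + K * C * (L * L) * T n + A * f n ≡⟨ eq₂ K L (f n) (T n) C ⟩
      K * (3 + C) * L ^ 2 * T n + A * f n       ∎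
      where
      eq₁ : ∀ k l f t → k * (l * l * (t + t + (f + t))) ≡ k * 3 * (l * l) * t + k * (l * l) * f
      eq₁ = ℕ-solve-∀
      eq₂ : ∀ k l f t c → k * 3 * (l * l) * t + k * c * (l * l) * t + k * (l * l) * f ≡
            k * (3 + c) * (l * (l * 1)) * t + k * (l * l) * f
      eq₂ = ℕ-solve-∀

    AC≤ : A * C ≤ K * (3 + C) * L ^ 2
    AC≤ = ℕ.≤-trans (ℕ.m≤m+n (A * C) (A * 3)) (ℕ.≤-reflexive (eq K L C))
      where
      eq : ∀ k l c → k * (l * l) * c + k * (l * l) * 3 ≡ k * (3 + c) * (l * (l * 1))
      eq = ℕ-solve-∀

overhead : ℕ
overhead = 500 + 88 * 1000

module Reduction
  {mm tmm : Cmd} {f T : ℕ → ℕ}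
  (mm-solves : mm Solves MatMul 0 InTime f) (tmm-solves : tmm Solves TargetMinMax InTime T) where

  cM cT : ℕ
  cM = proj₁ mm-solves
  cT = proj₁ tmm-solves

  -- Beyond the arrays 0 to 4 used for inputs and outputs, and beyond every word array that the
  -- given programs store to.
  base : ℕ
  base = 5 + (writes mm ⊔ writes tmm)

  power≤ : ∀ n {c d} → c ≤ d → (2 + n) ^ c ≤ (2 + n) ^ d
  power≤ n = ℕ.^-monoʳ-≤ (2 + n)

  -- The exponent exceeds those of both given programs. The summand 8 leaves room for
  -- `n² + 1 ≤ (2 + n)²` and for `32 (2 + n) ≤ (2 + n)⁶`, where 32 is `2⁵`.
  solves : ∀ n (G : Graph n) B → (2 + n) ^ (8 + (cM + cT)) ≤ B →
    ∀ μ → Bounded B μ → word μ 0 0 ≡ + n → StoresExtended μ 1 2 (λ i j → extended (G i j)) →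
    ∃[ k ] ∃[ μ′ ] Run B (Program.apspC mm tmm base) μ k μ′ × k ≤ time overhead f T n ×
      Σ[ D ∈ Matrix (ℤ ±) n ] StoresExtended μ′ 3 4 D × (∀ i j → IsDistance G i j (D i j))
  solves n G B le μ bd n₀ enc = finish (exec-apsp mm tmm base n B (f n) (T n) Λ
      (ℕ.m≤m+n 5 _) (ℕ.≤-trans (ℕ.m≤m⊔n (writes mm) (writes tmm)) (ℕ.m≤n+m _ 5))
      (ℕ.≤-trans (ℕ.m≤n⊔m (writes mm) (writes tmm)) (ℕ.m≤n+m _ 5))
      n²<B capacity log-bound (s≤s z≤n)
      (λ x → proj₂ mm-solves n x B (ℕ.≤-trans (power≤ n (ℕ.≤-trans (ℕ.m≤m+n cM cT) (ℕ.m≤n+m (cM + cT) 8))) le))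
      (λ x → proj₂ tmm-solves n x B (ℕ.≤-trans (power≤ n (ℕ.≤-trans (ℕ.m≤n+m cT cM) (ℕ.m≤n+m (cM + cT) 8))) le))
      U (1000 * (Λ * U)) G {μ} ℕ.≤-refl ℕ.≤-refl bd n₀ enc)
    where
    Λ U : ℕ
    Λ = 1 + ⌊log₂ n ⌋
    U = 1 + n * n + (f n + T n)

    n²<B : suc (n * n) ≤ B
    n²<B = ℕ.≤-trans (ℕ.≤-trans (ℕ.m≤m+n _ (4 * n + 3)) (ℕ.≤-reflexive (eq n)))
      (ℕ.≤-trans (power≤ n (ℕ.m≤m+n 2 (6 + (cM + cT)))) le)
      where
      eq : ∀ n → suc (n * n) + (4 * n + 3) ≡ (2 + n) * ((2 + n) * 1)
      eq = ℕ-solve-∀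

    capacity : 32 * (2 + n) ≤ B
    capacity = ℕ.≤-trans (ℕ.*-monoˡ-≤ (2 + n) (ℕ.^-monoˡ-≤ 5 (ℕ.m≤m+n 2 n)))
      (ℕ.≤-trans (ℕ.≤-reflexive (ℕ.*-comm ((2 + n) ^ 5) (2 + n)))
        (ℕ.≤-trans (power≤ n (ℕ.m≤m+n 6 (2 + (cM + cT)))) le))

    log-bound : ∀ i → 2 ^ i ≤ n → suc i ≤ Λ
    log-bound i 2^i≤n = s≤s (subst (_≤ ⌊log₂ n ⌋) (⌊log₂[2^n]⌋≡n i) (⌊log₂⌋-mono-≤ 2^i≤n))

    finish : Machine.Exec B (Program.apspC mm tmm base) μ
        ((22 + 18 * Λ) + (198 * U + (99 * U + (88 * (Λ * (1000 * (Λ * U))) + 132 * U))))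
        (λ μ′ → Σ[ D ∈ Matrix (ℤ ±) n ] StoresExtended μ′ 3 4 D × (∀ i j → IsDistance G i j (D i j))) →
      ∃[ k ] ∃[ μ′ ] Run B (Program.apspC mm tmm base) μ k μ′ × k ≤ time overhead f T n ×
        Σ[ D ∈ Matrix (ℤ ±) n ] StoresExtended μ′ 3 4 D × (∀ i j → IsDistance G i j (D i j))
    finish (k , μ′ , run , k≤ , _ , distances) =
      k , μ′ , run , ℕ.≤-trans k≤ (total-cost Λ U 1000 (s≤s z≤n) (s≤s z≤n)) , distances

theorem1p3 : (ω : ℝ) → MatMulExponent ω →
    (T : ℕ → ℕ) → (∀ n → n ^ 2 ≤ T n) →
    (∃[ p ] p Solves TargetMinMax InTime T) →
    ∃[ q ] ∃[ f ] (q Solves APSP InTime f) × (f ∈Õ[ T +n^ ω ])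
theorem1p3 ω multiplication T n²≤T (tmm , tmm-solves) =
  -- Exponent 0 suffices, as only matrices with entries 0 and 1 are ever multiplied.
  let mm , f , mm-solves , f∈O = multiplication 0
      open Reduction mm-solves tmm-solves
  in  Program.apspC mm tmm base , time overhead f T , (8 + (cM + cT) , solves) , time-∈Õ overhead f T ω f∈O n²≤T
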